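{- Let $\Sigma$ be a finite alphabet. There is a CFM $\mathcal A_{\mathrm{type}}$ over $P$ and $\Sigma\times\mathrm{Types}$ with $2^{|\Sigma|\cdot2^{\mathcal O(|P|\log|P|)}}$ states such that $L(\mathcal A_{\mathrm{type}})=\{(M,\mathrm{type}_M)\mid M\in\mathrm{MSC}(P,\Sigma)\}$.
   Context: Fix a finite set $P$ of processes. A message sequence chart (MSC) over $P$ and $\Sigma$ is $M=((w_p)_{p\in P},\lhd)$ with $w_p\in\Sigma^*$, at least one nonempty; events $E=\bigcup_pE_p$, $E_p=\{p\}\times\{1,\dots,|w_p|\}$; process relation $(p,i)\to(p,i+1)$; labelling $\lambda(p,i)=(p,a)$ with $a$ the $i$-th letter of $w_p$; message relation $\lhd\subseteq\bigcup_{p\ne q}E_p\times E_q$ with $\to\cup\lhd$ acyclic, each event in at most one $\lhd$-pair, and FIFO: for $(e,f),(e',f')\in\lhd\cap(E_p\times E_q)$, $e\to^*e'$ iff $f\to^*f'$. $\mathrm{MSC}(P,\Sigma)$ is the set of MSCs. Let $\le=(\to\cup\lhd)^*$, $<=(\to\cup\lhd)^+$, $e\parallel f$ iff neither $e\le f$ nor $f\le e$, and $\sqsubset=\,<\setminus(\to\cup\lhd)$. An MSC over $P$ and $\Sigma\times\Gamma$ is identified with a pair $(M,\gamma)$, $M\in\mathrm{MSC}(P,\Sigma)$, $\gamma:E\to\Gamma$. Let $\mathrm{Rel}=\{=,\to,\lhd,\parallel,\to^{ -1},\lhd^{ -1},\sqsubset,\sqsubset^{ -1}\}$; for $\bowtie\in\mathrm{Rel}$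 and $e\in E$, $\mathrm{type}^{\bowtie}_M(e)=\{\lambda(f)\mid f\in E,\ e\bowtie f\}\subseteq P\times\Sigma$ (where $e\,R^{ -1}f$ means $f\,R\,e$), $\mathrm{type}_M(e)=(\mathrm{type}^{\bowtie}_M(e))_{\bowtie\in\mathrm{Rel}}$, and $\mathrm{Types}=\prod_{\bowtie\in\mathrm{Rel}}2^{P\times\Sigma}$. A CFM over $P$ and an alphabet $\Sigma_0$ is $((\mathcal A_p)_{p},\mathit{Msg},\mathit{Acc})$ with $\mathcal A_p=(S_p,\iota_p,\Delta_p)$ a finite transition system (states $S_p$, initial state $\iota_p$) over actions $\Sigma_0\cup(\Sigma_0\times\{!,?\}\times\mathit{Msg}\times(P\setminus\{p\}))$ (internal, send $m$ to $q$, receive $m$ from $q$, each with a label in $\Sigma_0$), $\mathit{Msg}$ finite, $\mathit{Acc}\subseteq\prod_pS_p$. A run on an MSC assigns to each $e\in E_p$ a transition of $\Delta_p$ whose label is the $\Sigma_0$-label of $e$, starting each nonempty process in $\iota_p$, chaining along $\to$, with internal transitions at events in no $\lhd$-pair, and for $(e,f)\in\lhd$ from $p$ to $q$ a send $(\cdot,!,m,q)$ at $e$ and a receive $(\cdot,?,m,p)$ at $f$ with equal $m$; it accepts if the tuple of final local states (or $\iota_p$ for empty processes) is in $\mathit{Acc}$. $L(\mathcal A)$ is the set of accepted MSCs; number of states means states per process. -}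

module Defs where

open import Data.Nat using (ℕ; zero; suc; _+_; _*_; _^_; _≤_; _<_)
open import Data.Nat.Logarithm using (⌈log₂_⌉)
open import Data.Fin using (Fin; toℕ; fromℕ)
open import Data.Bool using (Bool; true; false)
open import Data.List using (List; length; lookup)
open import Data.List.Membership.Propositional using (_∈_)
open import Data.Product using (Σ; ∃; _×_; _,_; proj₁; proj₂)
open import Data.Sum using (_⊎_)
open import Data.Empty using (⊥)
open import Data.Unit using (⊤)
open import Relation.Nullary using (¬_)
open import Relation.Binary.PropositionalEquality using (_≡_; _≢_)
open import Relation.Binary.Construct.Closure.ReflexiveTransitive using (Star)
open import Relation.Binary.Construct.Closure.Transitive using (TransClosure)
open import Function.Bundles using (_⇔_)

-- Processes P = Fin n.  Words w_p ∈ A^* for each process.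

Word : ℕ → Set → Set
Word n A = Fin n → List A

-- Events E = ⋃_p E_p,  E_p = {p} × {1..|w_p|}  (0-based here)
Event : {n : ℕ} {A : Set} → Word n A → Set
Event {n} w = Σ (Fin n) (λ p → Fin (length (w p)))

module _ {n : ℕ} {A : Set} (w : Word n A) where

  letter : Event w → A
  letter (p , i) = lookup (w p) i

  data Next : Event w → Event w → Set where
    next : ∀ p (i j : Fin (length (w p))) → toℕ j ≡ suc (toℕ i) →
           Next (p , i) (p , j)

  module _ (msgs : List (Event w × Event w)) where

    Msg : Event w → Event w → Set
    Msg e f = (e , f) ∈ msgs

    data Step : Event w → Event w → Set where
      step→ : ∀ {e f} → Next e f → Step e f
      step⊲ : ∀ {e f} → Msg e f → Step e f

    _≼_ : Event w → Event w → Set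
    e ≼ f = Star Step e f

    _≺_ : Event w → Event w → Set
    e ≺ f = TransClosure Step e f

    _∥_ : Event w → Event w → Set
    e ∥ f = ¬ (e ≼ f) × ¬ (f ≼ e)

    _⊏_ : Event w → Event w → Set
    e ⊏ f = (e ≺ f) × ¬ Next e f × ¬ Msg e f

    Involved : Event w → Event w × Event w → Set
    Involved e (x , y) = (e ≡ x) ⊎ (e ≡ y)

    record IsMSC : Set where
      field
        someNonempty : Σ (Fin n) (λ p → 0 < length (w p))
        msgDistinct  : ∀ e f → Msg e f → proj₁ e ≢ proj₁ f
        acyclic      : ∀ e → ¬ (e ≺ e)
        atMostOne    : ∀ e x y x′ y′ → Msg x y → Msg x′ y′ →
                       Involved e (x , y) → Involved e (x′ , y′) →
                       (x , y) ≡ (x′ , y′)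
        fifo         : ∀ e f e′ f′ → Msg e f → Msg e′ f′ →
                       proj₁ e ≡ proj₁ e′ → proj₁ f ≡ proj₁ f′ →
                       (Star Next e e′ ⇔ Star Next f f′)

record MSC (n : ℕ) (A : Set) : Set where
  field
    word  : Word n A
    msgs  : List (Event word × Event word)
    isMSC : IsMSC word msgs

open MSC public

data Rel : Set where
  r= r→ r⊲ r∥ r→⁻¹ r⊲⁻¹ r⊏ r⊏⁻¹ : Rel

RelHolds : ∀ {n A} (M : MSC n A) → Rel → Event (word M) → Event (word M) → Set
RelHolds M r=    e f = e ≡ f
RelHolds M r→    e f = Next (word M) e f
RelHolds M r⊲    e f = Msg (word M) (msgs M) e f
RelHolds M r∥    e f = _∥_ (word M) (msgs M) e f
RelHolds M r→⁻¹  e f = Next (word M) f e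
RelHolds M r⊲⁻¹  e f = Msg (word M) (msgs M) f e
RelHolds M r⊏    e f = _⊏_ (word M) (msgs M) e f
RelHolds M r⊏⁻¹  e f = _⊏_ (word M) (msgs M) f e

-- Types = ∏_{⋈ ∈ Rel} 2^{P × Σ}, with P = Fin n, Σ = Fin k
-- (a subset of P × Σ is given by its characteristic function)
Types : ℕ → ℕ → Set
Types n k = Rel → Fin n → Fin k → Bool

-- An MSC N over P and Σ × Types, viewed as the pair (M , γ) with M its
-- Σ-projection (same events, same ⊲) and γ e = proj₂ (letter e).
-- N is of the form (M , type_M) iff for every event e, every ⋈ and every
-- (p , a) ∈ P × Σ:  (p , a) ∈ γ(e)^⋈  ⇔  ∃ f. e ⋈ f ∧ λ_M(f) = (p , a).
IsTypeAnnotated : ∀ {n k} → MSC n (Fin k × Types n k) → Set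
IsTypeAnnotated {n} {k} N =
  ∀ (e : Event (word N)) (r : Rel) (p : Fin n) (a : Fin k) →
    (proj₂ (letter (word N) e) r p a ≡ true) ⇔
    (∃ λ f → RelHolds N r e f × proj₁ f ≡ p × proj₁ (letter (word N) f) ≡ a)

data Action (n : ℕ) (A : Set) (m : ℕ) : Set where
  internal : A → Action n A m
  send     : A → Fin m → Fin n → Action n A m
  recv     : A → Fin m → Fin n → Action n A m

actLabel : ∀ {n A m} → Action n A m → A
actLabel (internal a) = a
actLabel (send a _ _) = a
actLabel (recv a _ _) = a

IsInternal : ∀ {n A m} → Action n A m → Set
IsInternal (internal _) = ⊤
IsInternal (send _ _ _) = ⊥
IsInternal (recv _ _ _) = ⊥

record CFM (n : ℕ) (A : Set) : Set where
  field
    nMsg : ℕ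
    size : Fin n → ℕ
    init : (p : Fin n) → Fin (size p)
    Δ    : (p : Fin n) → Fin (size p) → Action n A nMsg → Fin (size p) → Bool
    Acc  : ((p : Fin n) → Fin (size p)) → Bool

open CFM public

lastOr : {X : Set} (l : ℕ) → (Fin l → X) → X → X
lastOr zero    f d = d
lastOr (suc l) f d = f (fromℕ l)

record Run {n : ℕ} {A : Set} (𝒜 : CFM n A) (N : MSC n A) : Set where
  field
    src   : (e : Event (word N)) → Fin (size 𝒜 (proj₁ e))
    act   : (e : Event (word N)) → Action n A (nMsg 𝒜)
    tgt   : (e : Event (word N)) → Fin (size 𝒜 (proj₁ e))
    valid : ∀ e → Δ 𝒜 (proj₁ e) (src e) (act e) (tgt e) ≡ true
    label : ∀ e → actLabel (act e) ≡ letter (word N) e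
    start : ∀ p (i : Fin (length (word N p))) → toℕ i ≡ 0 → src (p , i) ≡ init 𝒜 p
    chain : ∀ p (i j : Fin (length (word N p))) → toℕ j ≡ suc (toℕ i) →
            tgt (p , i) ≡ src (p , j)
    intl  : ∀ e → (∀ f → ¬ Msg (word N) (msgs N) e f) →
                  (∀ f → ¬ Msg (word N) (msgs N) f e) → IsInternal (act e)
    comm  : ∀ e f → Msg (word N) (msgs N) e f →
            Σ (Fin (nMsg 𝒜)) λ m →
              (act e ≡ send (letter (word N) e) m (proj₁ f)) ×
              (act f ≡ recv (letter (word N) f) m (proj₁ e))

  finalState : (p : Fin n) → Fin (size 𝒜 p)
  finalState p = lastOr (length (word N p)) (λ i → tgt (p , i)) (init 𝒜 p)

Accepts : ∀ {n A} → CFM n A → MSC n A → Set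
Accepts 𝒜 N = Σ (Run 𝒜 N) λ ρ → Acc 𝒜 (Run.finalState ρ) ≡ true

stateBound : ℕ → ℕ → ℕ → ℕ
stateBound c n k = 2 ^ (k * 2 ^ (c * (n * ⌈log₂ n ⌉ + 1)))

{-# OPTIONS --safe #-}
module Submission where

-- All types but those for ⊏ and ∥ are read off the neighbours of an event. For ⊏ it suffices to know
-- which labels occur once and which occur twice below (above) an event.
--
-- For e on p and a process q ≠ p, follow a message path from e to q, step back to the last b-labelled
-- event before its end, and follow a message path back to p. If the result h e lies after e for all
-- pairs of paths, then some b-labelled event of q is parallel to e, and conversely. Simple paths
-- suffice, so there are n^O(n) such routes, and by FIFO each h is a monotone map on the positions of p.
-- The CFM certifies each comparison of e with h e by guessing two divisions of p into blocks, numbered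
-- modulo 4: one where e and h e are in different blocks exactly if e < h e, and one where h e and the
-- successor of e are in different blocks exactly if h e ≤ e. The colour of h e is transported back
-- along the route to e. Only the residues of the differences 0, 1 and 2 are admitted. As the true
-- difference drops by at most one from an event to the next, it cannot become negative unnoticed.

-- The obstacle is that `h e` may lie after e, so a CFM cannot compute the comparison while reading;
-- it has to guess, and a wrong guess in either direction would falsify the type. A single division
-- certifies only one outcome: an increase of block numbers proves a strict inequality of positions,
-- while equality of residues proves nothing. Hence two divisions, one whose increases prove e < h e
-- and one whose increases prove h e ≤ e, and every event must show an increase in one of them. The
-- second compares with the successor of e because h e ≤ e becomes strict in that form. Transport of
-- a colour is a local matter because the colour at the end of a route obeys the recursion that
-- defines the route. An event therefore stores one colour for every suffix of every route, and each
-- is determined by the codes of its neighbours. What no neighbour supplies are the colours at ∞,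
-- possibly on another process; these form a constant that all processes guess and the acceptance
-- condition compares.

open import Defs
open import Data.Nat using (ℕ; _≤_)
open import Data.Fin using (Fin)
open import Data.Product using (Σ; _×_)
open import Function.Bundles using (_⇔_)

open import Data.Bool as Bool using (Bool; true; false)
open import Data.Empty using (⊥; ⊥-elim)
open import Data.Fin as F using (Fin; toℕ; fromℕ; fromℕ<; inject≤; zero; suc; combine; remQuot; finToFun; funToFin)
open import Data.Fin.Induction using (spo-wellFounded)
open import Data.Fin.Properties using
  ( toℕ-fromℕ<; fromℕ<-toℕ; toℕ<n; toℕ-injective; toℕ-fromℕ; remQuot-combine; combine-injective
  ; inject≤-injective; injective⇒≤; finToFun-funToFin; _≟_; any?; all? )
open import Data.List as List using (List; length; tabulate; []; _∷_)
open import Data.List.Extrema.Nat using (max; xs≤max)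
open import Data.List.Membership.Propositional using (find; lose)
open import Data.List.Membership.Propositional.Properties using (∈-tabulate⁺; ∈-∃++; ∈-lookup)
import Data.List.Relation.Unary.All as All
open import Data.List.Relation.Unary.All.Properties using (¬Any⇒All¬)
import Data.List.Relation.Unary.Any as Any
open import Data.List.Relation.Unary.Unique.Propositional using (Unique; []; _∷_)
open import Data.Maybe as Maybe using (Maybe; just; nothing)
import Data.Maybe.Properties as Maybe
open import Data.Nat as ℕ hiding (_≟_)
open import Data.Nat.DivMod using (m≡m%n+[m/n]*n; m%n<n; %-distribˡ-+; m<n⇒m%n≡m; m%n%n≡m%n)
open import Data.Nat.Induction using (<-wellFounded)
open import Data.Nat.Logarithm using (⌈log₂_⌉; ⌈log₂⌉-mono-≤; ⌈log₂2^n⌉≡n; ⌈log₂⌈n/2⌉⌉≡⌈log₂n⌉∸1)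
open import Data.Nat.Properties hiding (_≟_)
open import Data.Nat.Solver using (module +-*-Solver)
open import Data.Product as Product using (∃; ∃₂; _,_; proj₁; proj₂; uncurry)
open import Data.Product.Properties using (≡-dec; ,-injective)
open import Data.Sum as Sum using (_⊎_; inj₁; inj₂)
open import Data.Unit using (⊤; tt)
open import Data.Vec as Vec using (Vec; []; _∷_)
open import Data.Vec.Properties using (tabulate-cong; tabulate∘lookup)
open import Function using (_∘_; flip)
open import Function.Bundles using (mk⇔; Equivalence)
open import Induction.WellFounded as WF using (WellFounded; acc)
open import Relation.Binary using (IsStrictPartialOrder; Transitive; tri<; tri≈; tri>)
open import Relation.Binary.Construct.Closure.ReflexiveTransitive as Star using (Star; ε; _◅_; _◅◅_)
open import Relation.Binary.Construct.Closure.Transitive as TC using ([_]; _∷_)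
open import Relation.Binary.PropositionalEquality
open import Relation.Nullary
open import Relation.Nullary.Decidable using (dec-true; map′; _×-dec_; _⊎-dec_; _→-dec_)

-- Blocks of positions

-- A block ends before position x + 1 when B holds of its first position and x.

module Greedy (B : ℕ → ℕ → Set) (B? : ∀ s x → Dec (B s x)) where

  abstract
    -- First position and number of the current block. Later proofs know a step only through
    -- `opens⊎continues`.
    state : ℕ → ℕ × ℕ
    state zero = 0 , 0
    state (suc x) with state x
    ... | s , b with B? s x
    ...   | yes _ = suc x , suc b
    ...   | no _  = s , b

    start blk : ℕ → ℕ
    start x = proj₁ (state x)
    blk x = proj₂ (state x)

    start-0 : start 0 ≡ 0
    start-0 = refl

    blk-0 : blk 0 ≡ 0
    blk-0 = refl

  Opens Continues : ℕ → Set
  Opens x = B (start x) x × start (suc x) ≡ suc x × blk (suc x) ≡ suc (blk x)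
  Continues x = ¬ B (start x) x × start (suc x) ≡ start x × blk (suc x) ≡ blk x

  abstract
    opens⊎continues : ∀ x → Opens x ⊎ Continues x
    opens⊎continues x with state x
    ... | s , _ with B? s x
    ...   | yes b = inj₁ (b , refl , refl)
    ...   | no ¬b = inj₂ (¬b , refl , refl)

  blk-≤-suc : ∀ x → blk x ≤ blk (suc x)
  blk-≤-suc x with opens⊎continues x
  ... | inj₁ (_ , _ , e) = subst (blk x ≤_) (sym e) (n≤1+n _)
  ... | inj₂ (_ , _ , e) = ≤-reflexive (sym e)

  blk-mono : ∀ {x y} → x ≤ y → blk x ≤ blk y
  blk-mono {zero} {zero} _ = ≤-refl
  blk-mono {x} {suc y} x≤1+y with m≤n⇒m<n∨m≡n x≤1+y
  ... | inj₁ (s≤s x≤y) = ≤-trans (blk-mono x≤y) (blk-≤-suc y)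
  ... | inj₂ refl = ≤-refl

  blk-suc : ∀ x → blk (suc x) ≡ blk x ⊎ blk (suc x) ≡ suc (blk x)
  blk-suc x with opens⊎continues x
  ... | inj₁ (_ , _ , e) = inj₂ e
  ... | inj₂ (_ , _ , e) = inj₁ e

  start-≤ : ∀ x → start x ≤ x
  start-≤ zero = ≤-reflexive start-0
  start-≤ (suc x) with opens⊎continues x
  ... | inj₁ (_ , e , _) = ≤-reflexive e
  ... | inj₂ (_ , e , _) = subst (_≤ suc x) (sym e) (m≤n⇒m≤1+n (start-≤ x))

  blk-before-start : ∀ {x} z → x < start z → blk x < blk z
  blk-before-start zero x< = contradiction (subst (_ <_) start-0 x<) λ ()
  blk-before-start {x} (suc z) x< with opens⊎continues z
  ... | inj₁ (_ , e , e′) = subst (blk x <_) (sym e′) (s≤s (blk-mono (≤-pred (subst (x <_) e x<))))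
  ... | inj₂ (_ , e , e′) = subst (blk x <_) (sym e′) (blk-before-start z (subst (x <_) e x<))

-- Every border is h y for some y before it in the previous block, so (x , h x] contains one or two
-- borders if x < h x, and (h x , x] none if h x ≤ x.
module Rising (h : ℕ → ℕ) (h-mono : ∀ {x y} → x ≤ y → h x ≤ h y) where

  Hits : ℕ → ℕ → Set
  Hits s x = ∃ λ y → y < suc x × s ≤ y × h y ≡ suc x

  open Greedy Hits (λ s x → anyUpTo? (λ y → s ≤? y ×-dec h y ℕ.≟ suc x) (suc x)) public

  -- A border z + 1 in (h x , x] would be `h y` for some y ≤ z < x, whereas monotonicity gives h y ≤
  -- h x ≤ z.
  blk-flat : ∀ x → h x ≤ x → blk (h x) ≡ blk x
  blk-flat x hx≤x = go x hx≤x ≤-refl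
    where
    go : ∀ z → h x ≤ z → z ≤ x → blk (h x) ≡ blk z
    go z hx≤z z≤x with m≤n⇒m<n∨m≡n hx≤z
    ... | inj₂ e = cong blk e
    go (suc z) _ z<x | inj₁ (s≤s hx≤z) with opens⊎continues z
    ... | inj₂ (_ , _ , e) = trans (go z hx≤z (<⇒≤ z<x)) (sym e)
    ... | inj₁ ((y , s≤s y≤z , _ , hy≡) , _) =
      contradiction (h-mono (≤-trans y≤z (<⇒≤ z<x)))
        (<⇒≱ (subst (h x <_) (sym hy≡) (s≤s hx≤z)))

  -- If no border stands at `h x`, then x did not count as a witness for one there, which is only
  -- possible if a block has started after x.
  blk-rise : ∀ x → x < h x → blk x < blk (h x)
  blk-rise x x<hx = go (h x) refl x<hx
    where
    go : ∀ z → z ≡ h x → x < z → blk x < blk z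
    go (suc z) e (s≤s x≤z) with opens⊎continues z
    ... | inj₁ (_ , _ , e′) = subst (blk x <_) (sym e′) (s≤s (blk-mono x≤z))
    ... | inj₂ (¬b , _ , e′) with start z ≤? x
    ...   | yes s≤x = contradiction (x , s≤s x≤z , s≤x , sym e) ¬b
    ...   | no s≰x = subst (blk x <_) (sym e′) (blk-before-start z (≰⇒> s≰x))

  -- A second border strictly before `h x` would be `h y` for some y in a block that starts after x,
  -- but then h x ≤ h y. One more border may stand at `h x` itself, whence 2.
  blk-rise-≤ : ∀ x → x < h x → blk (h x) ≤ 2 + blk x
  blk-rise-≤ x x<hx = last (h x) refl x<hx
    where
    go : ∀ z → x ≤ z → z < h x → blk z ≡ blk x ⊎ (blk z ≡ suc (blk x) × x < start z)
    go z x≤z z<h with m≤n⇒m<n∨m≡n x≤z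
    ... | inj₂ e = inj₁ (cong blk (sym e))
    go (suc z) _ z<h | inj₁ (s≤s x≤z) with opens⊎continues z | go z x≤z (<-trans (n<1+n z) z<h)
    ... | inj₂ (_ , _ , e′) | inj₁ e = inj₁ (trans e′ e)
    ... | inj₂ (_ , e″ , e′) | inj₂ (e , x<s) = inj₂ (trans e′ e , subst (x <_) (sym e″) x<s)
    ... | inj₁ (_ , e″ , e′) | inj₁ e = inj₂ (trans e′ (cong suc e) , subst (x <_) (sym e″) (s≤s x≤z))
    ... | inj₁ ((y , _ , s≤y , hy≡) , _) | inj₂ (_ , x<s) =
      contradiction (h-mono (<⇒≤ (<-≤-trans x<s s≤y))) (<⇒≱ (subst (_< h x) (sym hy≡) z<h))
    last : ∀ z → z ≡ h x → x < z → blk z ≤ 2 + blk x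
    last (suc z) e (s≤s x≤z) = ≤-trans blk-suc-≤ (s≤s blk-z)
      where
      blk-suc-≤ : blk (suc z) ≤ suc (blk z)
      blk-suc-≤ with blk-suc z
      ... | inj₁ e = subst (_≤ suc (blk z)) (sym e) (n≤1+n _)
      ... | inj₂ e = ≤-reflexive e
      blk-z : blk z ≤ suc (blk x)
      blk-z with go z x≤z (≤-reflexive e)
      ... | inj₁ e = subst (_≤ suc (blk x)) (sym e) (n≤1+n _)
      ... | inj₂ (e , _) = ≤-reflexive e

-- A border follows x when (h x , x] contains none, so (h x , x + 1] contains exactly one border if
-- h x ≤ x, and (x + 1 , h x] none if x < h x.
module Falling (h : ℕ → ℕ) (h-mono : ∀ {x y} → x ≤ y → h x ≤ h y) where

  -- Greedy stabbing of the intervals (h x , x + 1] with h x ≤ x, each border being placed at the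
  -- last moment. Ending at x + 1 keeps the interval nonempty when `h x` is x.
  Unstabbed : ℕ → ℕ → Set
  Unstabbed s x = s ≤ h x × h x ≤ x

  open Greedy Unstabbed (λ s x → s ≤? h x ×-dec h x ≤? x) public

  -- A border z + 1 in (x + 1 , h x] requires h z ≤ z < h x, but x ≤ z gives h x ≤ h z.
  blk-flat : ∀ x → x < h x → blk (suc x) ≡ blk (h x)
  blk-flat x x<hx = go (h x) x<hx ≤-refl
    where
    go : ∀ z → x < z → z ≤ h x → blk (suc x) ≡ blk z
    go z x<z z≤ with m≤n⇒m<n∨m≡n x<z
    ... | inj₂ e = cong blk e
    go (suc z) _ z< | inj₁ (s≤s x<z) with opens⊎continues z
    ... | inj₂ (_ , _ , e) = trans (go z x<z (<⇒≤ z<)) (sym e)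
    ... | inj₁ ((_ , hz≤z) , _) = contradiction (h-mono (<⇒≤ x<z)) (<⇒≱ (≤-<-trans hz≤z z<))

  -- At most one border: a second one, at z + 1 with z ≤ x, requires that the block of z start no
  -- later than h z ≤ h x, but it starts after `h x`. At least one: if none is put at x + 1, the
  -- current block already starts after `h x`.
  blk-fall : ∀ x → h x ≤ x → blk (suc x) ≡ suc (blk (h x))
  blk-fall x hx≤x with go (suc x) (m≤n⇒m≤1+n hx≤x) ≤-refl
    where
    go : ∀ z → h x ≤ z → z ≤ suc x →
         blk z ≡ blk (h x) ⊎ (blk z ≡ suc (blk (h x)) × h x < start z)
    go z hx≤z z≤ with m≤n⇒m<n∨m≡n hx≤z
    ... | inj₂ e = inj₁ (cong blk (sym e))
    go (suc z) _ (s≤s z≤x) | inj₁ (s≤s hx≤z)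
      with opens⊎continues z | go z hx≤z (m≤n⇒m≤1+n z≤x)
    ... | inj₂ (_ , _ , e′) | inj₁ e = inj₁ (trans e′ e)
    ... | inj₂ (_ , e″ , e′) | inj₂ (e , h<s) = inj₂ (trans e′ e , subst (h x <_) (sym e″) h<s)
    ... | inj₁ (_ , e″ , e′) | inj₁ e = inj₂ (trans e′ (cong suc e) , subst (h x <_) (sym e″) (s≤s hx≤z))
    ... | inj₁ ((s≤hz , _) , _) | inj₂ (_ , h<s) = contradiction (h-mono z≤x) (<⇒≱ (<-≤-trans h<s s≤hz))
  ... | inj₂ (e , _) = e
  ... | inj₁ e = contradiction e (>⇒≢ blk<)
    where
    blk< : blk (h x) < blk (suc x)
    blk< with opens⊎continues x
    ... | inj₁ (_ , _ , e′) = subst (blk (h x) <_) (sym e′) (s≤s (blk-mono hx≤x))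
    ... | inj₂ (¬b , _) = <-≤-trans (blk-before-start x (≰⇒> λ s≤ → ¬b (s≤ , hx≤x))) (blk-≤-suc x)

-- Block numbers modulo 4

Colour : Set
Colour = Fin 4

Adv : ℕ → Colour → Colour → Set
Adv d c c′ = toℕ c′ ≡ (toℕ c + d) % 4

Later Step₁ Near : Colour → Colour → Set
Later c c′ = Adv 1 c c′ ⊎ Adv 2 c c′
Step₁ c c′ = Adv 0 c c′ ⊎ Adv 1 c c′
Near c c′ = Adv 0 c c′ ⊎ Later c c′

adv? : ∀ d c c′ → Dec (Adv d c c′)
adv? d c c′ = toℕ c′ ℕ.≟ (toℕ c + d) % 4

later? : ∀ c c′ → Dec (Later c c′)
later? c c′ = adv? 1 c c′ ⊎-dec adv? 2 c c′

step₁? : ∀ c c′ → Dec (Step₁ c c′)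
step₁? c c′ = adv? 0 c c′ ⊎-dec adv? 1 c c′

near? : ∀ c c′ → Dec (Near c c′)
near? c c′ = adv? 0 c c′ ⊎-dec later? c c′

_mod4 : ℕ → Colour
a mod4 = F.fromℕ< (m%n<n a 4)

toℕ-mod4 : ∀ a → toℕ (a mod4) ≡ a % 4
toℕ-mod4 a = toℕ-fromℕ< _

+-%4 : ∀ a d → (a % 4 + d) % 4 ≡ (a + d) % 4
+-%4 a d = trans (%-distribˡ-+ (a % 4) d 4)
          (trans (cong (λ r → (r + d % 4) % 4) (m%n%n≡m%n a 4)) (sym (%-distribˡ-+ a d 4)))

mod4-adv : ∀ {a b} d → b ≡ a + d → Adv d (a mod4) (b mod4)
mod4-adv {a} d refl = trans (toℕ-mod4 (a + d))
  (trans (sym (+-%4 a d)) (cong (λ r → (r + d) % 4) (sym (toℕ-mod4 a))))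

quotient-≤ : ∀ a b → a % 4 ≡ b % 4 → b < a + 4 → b / 4 ≤ a / 4
quotient-≤ a b e b<a+4 = ≮⇒≥ λ q<q′ → <⇒≱ b<a+4 (begin
  a + 4                        ≡⟨ cong (_+ 4) (m≡m%n+[m/n]*n a 4) ⟩
  a % 4 + a / 4 * 4 + 4        ≡⟨ +-assoc (a % 4) _ 4 ⟩
  a % 4 + (a / 4 * 4 + 4)      ≡⟨ cong₂ _+_ e (+-comm (a / 4 * 4) 4) ⟩
  b % 4 + suc (a / 4) * 4      ≤⟨ +-monoʳ-≤ (b % 4) (*-monoˡ-≤ 4 q<q′) ⟩
  b % 4 + b / 4 * 4            ≡⟨ sym (m≡m%n+[m/n]*n b 4) ⟩
  b                            ∎)
  where open ≤-Reasoning

-- Equal residues make the difference a multiple of 4, and a positive one would be at least 4.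
%4-≤ : ∀ a b → a % 4 ≡ b % 4 → b < a + 4 → b ≤ a
%4-≤ a b e b< = begin
  b                  ≡⟨ m≡m%n+[m/n]*n b 4 ⟩
  b % 4 + b / 4 * 4  ≤⟨ +-mono-≤ (≤-reflexive (sym e)) (*-monoˡ-≤ 4 (quotient-≤ a b e b<)) ⟩
  a % 4 + a / 4 * 4  ≡⟨ sym (m≡m%n+[m/n]*n a 4) ⟩
  a                  ∎
  where open ≤-Reasoning

-- Conversely, residues decide on which side of x its image h x lies: a difference of block numbers
-- drops by at most one between adjacent positions, and −1 has the forbidden residue 3.
module Lift (col : ℕ → Colour) (col-0 : toℕ (col 0) ≡ 0)
            (col-step : ∀ x → Step₁ (col x) (col (suc x))) where

  -- The colours unwound into block numbers, starting from 0.
  blk : ℕ → ℕ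
  blk zero = 0
  blk (suc x) with col-step x
  ... | inj₁ _ = blk x
  ... | inj₂ _ = suc (blk x)

  blk-col : ∀ x → blk x % 4 ≡ toℕ (col x)
  blk-col zero = sym col-0
  blk-col (suc x) with col-step x
  ... | inj₁ adv = trans (cong (_% 4) (sym (+-identityʳ (blk x))))
      (trans (sym (+-%4 (blk x) 0)) (trans (cong (λ r → (r + 0) % 4) (blk-col x)) (sym adv)))
  ... | inj₂ adv = trans (cong (_% 4) (+-comm 1 (blk x)))
      (trans (sym (+-%4 (blk x) 1)) (trans (cong (λ r → (r + 1) % 4) (blk-col x)) (sym adv)))

  blk-≤-suc : ∀ x → blk x ≤ blk (suc x)
  blk-≤-suc x with col-step x
  ... | inj₁ _ = ≤-refl
  ... | inj₂ _ = n≤1+n _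

  blk-suc-≤ : ∀ x → blk (suc x) ≤ suc (blk x)
  blk-suc-≤ x with col-step x
  ... | inj₁ _ = n≤1+n _
  ... | inj₂ _ = ≤-refl

  blk-mono : ∀ {x y} → x ≤ y → blk x ≤ blk y
  blk-mono {zero} _ = z≤n
  blk-mono {x} {suc y} x≤1+y with m≤n⇒m<n∨m≡n x≤1+y
  ... | inj₁ (s≤s x≤y) = ≤-trans (blk-mono x≤y) (blk-≤-suc y)
  ... | inj₂ refl = ≤-refl

  blk-reflects-< : ∀ {x y} → blk x < blk y → x < y
  blk-reflects-< b< = ≰⇒> λ y≤x → <⇒≱ b< (blk-mono y≤x)

  -- The origin of the modulus: `d + blk x` has the residue of `blk y` and exceeds it by at most 2 +
  -- 1, which is less than 4, hence not at all.
  adv-lift : ∀ {x y} d → d ≤ 2 → Adv d (col x) (col y) → blk x ≤ suc (blk y) → d + blk x ≤ blk y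
  adv-lift {x} {y} d d≤2 adv x≤ = subst (_≤ blk y) (+-comm (blk x) d) (%4-≤ (blk y) (blk x + d) same
    (subst₂ _<_ (+-comm d (blk x)) (+-comm 4 (blk y)) (s≤s (+-mono-≤ d≤2 x≤))))
    where
    same : blk y % 4 ≡ (blk x + d) % 4
    same = trans (blk-col y) (trans adv
      (trans (cong (λ r → (r + d) % 4) (sym (blk-col x))) (+-%4 (blk x) d)))

  near-lift : ∀ {x y} → Near (col x) (col y) → blk x ≤ suc (blk y) → blk x ≤ blk y
  near-lift (inj₁ adv) x≤ = adv-lift 0 z≤n adv x≤
  near-lift (inj₂ (inj₁ adv)) x≤ = m+n≤o⇒n≤o 1 (adv-lift 1 (s≤s z≤n) adv x≤)
  near-lift (inj₂ (inj₂ adv)) x≤ = m+n≤o⇒n≤o 2 (adv-lift 2 ≤-refl adv x≤)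

  later-lift : ∀ {x y} → Later (col x) (col y) → blk x ≤ blk y → x < y
  later-lift (inj₁ adv) x≤ = blk-reflects-< (adv-lift 1 (s≤s z≤n) adv (m≤n⇒m≤1+n x≤))
  later-lift (inj₂ adv) x≤ = blk-reflects-< (m+n≤o⇒n≤o 1 (adv-lift 2 ≤-refl adv (m≤n⇒m≤1+n x≤)))

  module _ (ℓ : ℕ) (h : ℕ → ℕ) (h-mono : ∀ {x y} → x ≤ y → h x ≤ h y) where

    -- Upward induction: from x to x + 1 the left side grows by at most one and the right side does
    -- not fall, which is the slack that `near-lift` allows. It starts at position 1, since `blk 0`
    -- is 0.
    rising-≤ : (∀ x → 1 ≤ x → x ≤ ℓ → Near (col x) (col (h x))) →
               ∀ x → 1 ≤ x → x ≤ ℓ → blk x ≤ blk (h x)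
    rising-≤ near (suc zero) 1≤x x≤ℓ =
      near-lift (near 1 1≤x x≤ℓ) (≤-trans (blk-suc-≤ 0) (s≤s z≤n))
    rising-≤ near (suc (suc x)) 1≤x x≤ℓ = near-lift (near _ 1≤x x≤ℓ)
      (≤-trans (blk-suc-≤ (suc x)) (s≤s (≤-trans
        (rising-≤ near (suc x) (s≤s z≤n) (<⇒≤ x≤ℓ)) (blk-mono (h-mono (n≤1+n _))))))

    -- Here the slack appears going down: from x + 1 to x the side of the successor falls by at most
    -- one and that of `h` does not grow. The induction starts at ℓ, whose successor ∞ has the
    -- largest block number.
    falling-≤ : (∀ x → blk x ≤ blk (suc ℓ)) →
                (∀ x → 1 ≤ x → x ≤ ℓ → Near (col (h x)) (col (suc x))) →
                ∀ x → 1 ≤ x → x ≤ ℓ → blk (h x) ≤ blk (suc x)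
    falling-≤ blk-∞ near x 1≤x x≤ℓ = go (ℓ ∸ x) x 1≤x (m∸n+n≡m x≤ℓ)
      where
      go : ∀ d x → 1 ≤ x → d + x ≡ ℓ → blk (h x) ≤ blk (suc x)
      go zero x _ refl = blk-∞ (h x)
      go (suc d) x 1≤x e = near-lift (near x 1≤x (subst (x ≤_) e (m≤n+m x (suc d))))
        (≤-trans (blk-mono (h-mono (n≤1+n x)))
        (≤-trans (go d (suc x) (s≤s z≤n) (trans (+-suc d x) e)) (blk-suc-≤ (suc x))))

  -- A step of at most one between equal residues is zero, so nothing grows beyond ∞.
  blk-∞ : ∀ ℓ → (∀ x → ℓ < x → col x ≡ col (suc ℓ)) → ∀ x → blk x ≤ blk (suc ℓ)
  blk-∞ ℓ col-∞ zero = z≤n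
  blk-∞ ℓ col-∞ (suc x) with suc x ≤? suc ℓ
  ... | yes x≤ = blk-mono x≤
  ... | no x≰ = ≤-trans (%4-≤ (blk x) (blk (suc x))
          (trans (blk-col x) (trans (cong toℕ same) (sym (blk-col (suc x)))))
          (≤-<-trans (blk-suc-≤ x) (subst (suc (blk x) <_) (+-comm 4 (blk x)) (s≤s (s≤s (m≤n+m (blk x) 2))))))
          (blk-∞ ℓ col-∞ x)
    where
    same : col x ≡ col (suc x)
    same = trans (col-∞ x (≤-pred (≰⇒> x≰))) (sym (col-∞ (suc x) (<⇒≤ (≰⇒> x≰))))

-- Positions and neighbours of events

data View (ℓ : ℕ) : ℕ → Set where
  bot : View ℓ 0
  ev  : (i : Fin ℓ) → View ℓ (suc (toℕ i))
  top : ∀ {x} → ℓ < x → View ℓ x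

view : ∀ ℓ x → View ℓ x
view ℓ zero = bot
view ℓ (suc y) with y <? ℓ
... | yes y<ℓ = subst (View ℓ ∘ suc) (toℕ-fromℕ< y<ℓ) (ev (fromℕ< y<ℓ))
... | no y≮ℓ = top (s≤s (≮⇒≥ y≮ℓ))

module _ {n : ℕ} {A : Set} (w : Word n A) where

  event≟ : (e f : Event w) → Dec (e ≡ f)
  event≟ = ≡-dec _≟_ _≟_

  -- The i-th letter of w_p is at position i + 1; 0 and length (w p) + 1 play the roles of −∞ and ∞.
  at : Fin n → ℕ → Maybe (Event w)
  at p zero = nothing
  at p (suc y) with y <? length (w p)
  ... | yes y<ℓ = just (p , fromℕ< y<ℓ)
  ... | no _ = nothing

  at-event : ∀ p i → at p (suc (toℕ i)) ≡ just (p , i)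
  at-event p i with toℕ i <? length (w p)
  ... | yes i<ℓ = cong (λ j → just (p , j)) (fromℕ<-toℕ i i<ℓ)
  ... | no i≮ℓ = contradiction (toℕ<n i) i≮ℓ

  at-top : ∀ p {x} → length (w p) < x → at p x ≡ nothing
  at-top p {suc y} (s≤s ℓ≤y) with y <? length (w p)
  ... | yes y<ℓ = contradiction (<-≤-trans y<ℓ ℓ≤y) (<-irrefl refl)
  ... | no _ = refl

data Partner (Y : Set) : Set where
  none : Partner Y
  out inn : Y → Partner Y

module _ {Y : Set} where

  outOf innOf : Partner Y → Maybe Y
  outOf (out f) = just f
  outOf _ = nothing
  innOf (inn f) = just f
  innOf _ = nothing

mapPartner : ∀ {Y Z : Set} → (Y → Z) → Partner Y → Partner Z
mapPartner g none = none
mapPartner g (out f) = out (g f)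
mapPartner g (inn f) = inn (g f)

outOf-map : ∀ {Y Z : Set} (g : Y → Z) c → outOf (mapPartner g c) ≡ Maybe.map g (outOf c)
outOf-map g none = refl
outOf-map g (out f) = refl
outOf-map g (inn f) = refl

innOf-map : ∀ {Y Z : Set} (g : Y → Z) c → innOf (mapPartner g c) ≡ Maybe.map g (innOf c)
innOf-map g none = refl
innOf-map g (out f) = refl
innOf-map g (inn f) = refl

module _ {n : ℕ} {A : Set} (N : MSC n A) where

  private
    _⊲_ : Event (word N) → Event (word N) → Set
    _⊲_ = Msg (word N) (msgs N)

  data IsPartner (e : Event (word N)) : Partner (Event (word N)) → Set where
    is-none : (∀ f → ¬ e ⊲ f) → (∀ f → ¬ f ⊲ e) → IsPartner e none
    is-out  : ∀ {f} → e ⊲ f → IsPartner e (out f)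
    is-inn  : ∀ {f} → f ⊲ e → IsPartner e (inn f)

  findPartner : ∀ e → ∃ (IsPartner e)
  findPartner e with Any.any? (λ m → event≟ (word N) (proj₁ m) e) (msgs N)
                   | Any.any? (λ m → event≟ (word N) (proj₂ m) e) (msgs N)
  ... | yes a | _ with find {P = λ m → proj₁ m ≡ e} a
  ...   | (_ , f) , m , refl = out f , is-out m
  findPartner e | no _ | yes a with find {P = λ m → proj₂ m ≡ e} a
  ...   | (f , _) , m , refl = inn f , is-inn m
  findPartner e | no ¬a | no ¬b = none , is-none (λ f m → ¬a (lose m refl)) (λ f m → ¬b (lose m refl))

  partner : Event (word N) → Partner (Event (word N))
  partner e = proj₁ (findPartner e)

  open IsMSC (isMSC N)

  out-partner : ∀ {e f} → e ⊲ f → partner e ≡ out f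
  out-partner {e} {f} m with findPartner e
  ... | _ , is-none ¬out _ = contradiction m (¬out f)
  ... | _ , is-out m′ = cong out (proj₂ (,-injective (atMostOne e _ _ _ _ m′ m (inj₁ refl) (inj₁ refl))))
  ... | _ , is-inn m′ = contradiction (cong proj₁ (sym (proj₂ (,-injective
          (atMostOne e _ _ _ _ m′ m (inj₂ refl) (inj₁ refl)))))) (msgDistinct e f m ∘ sym)

  inn-partner : ∀ {e f} → f ⊲ e → partner e ≡ inn f
  inn-partner {e} {f} m with findPartner e
  ... | _ , is-none _ ¬inn = contradiction m (¬inn f)
  ... | _ , is-inn m′ = cong inn (proj₁ (,-injective (atMostOne e _ _ _ _ m′ m (inj₂ refl) (inj₂ refl))))
  ... | _ , is-out m′ = contradiction (cong proj₁ (proj₁ (,-injective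
          (atMostOne e _ _ _ _ m m′ (inj₂ refl) (inj₁ refl))))) (msgDistinct f e m)

  partner-out : ∀ {e f} → partner e ≡ out f → e ⊲ f
  partner-out {e} eq with findPartner e
  partner-out refl | _ , is-out m = m

  partner-inn : ∀ {e f} → partner e ≡ inn f → f ⊲ e
  partner-inn {e} eq with findPartner e
  partner-inn refl | _ , is-inn m = m

-- Local labellings as runs of a CFM

-- Turns local constraints on a guessed labelling into transitions. Every process guesses the
-- constant κ separately and carries it along; only the acceptance condition, which sees all final
-- states, makes the guesses agree. It is the place for data that no message delivers.
module Automaton {n : ℕ} {A : Set} (x y : ℕ)
  (Φ : Fin y → Fin n → A → Maybe (Fin x) → Fin x → Maybe (Fin x) → Partner (Fin n × Fin x) → Set)
  (Φ? : ∀ κ p a prv c nxt m → Dec (Φ κ p a prv c nxt m))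
  (Ψ : Fin y → Fin n → Maybe (Fin x) → Set)
  (Ψ? : ∀ κ p last → Dec (Ψ κ p last)) where

  Φ-cong : ∀ {κ κ′ p a a′ pr pr′ c nx nx′ m m′} → κ ≡ κ′ → a ≡ a′ → pr ≡ pr′ → nx ≡ nx′ → m ≡ m′ →
           Φ κ p a pr c nx m → Φ κ′ p a′ pr′ c nx′ m′
  Φ-cong refl refl refl refl refl φ = φ

  -- After an event, a process remembers the global constant, the label of this event,
  -- and the label it has guessed for its next event.
  data State : Set where
    ι  : State
    st : Fin y → Fin x → Maybe (Fin x) → State

  #State : ℕ
  #State = suc (y * (x * suc x))

  encode : State → Fin #State
  encode ι = zero
  encode (st κ c nothing) = suc (combine κ (combine c zero))
  encode (st κ c (just d)) = suc (combine κ (combine c (suc d)))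

  decodeNext : Fin (suc x) → Maybe (Fin x)
  decodeNext zero = nothing
  decodeNext (suc d) = just d

  unpack : Fin y → Fin x × Fin (suc x) → State
  unpack κ (c , d) = st κ c (decodeNext d)

  decode : Fin #State → State
  decode zero = ι
  decode (suc s) = uncurry (λ κ r → unpack κ (remQuot (suc x) r)) (remQuot (x * suc x) s)

  decode-combine : ∀ κ c d → decode (suc (combine κ (combine c d))) ≡ st κ c (decodeNext d)
  decode-combine κ c d = trans
    (cong (uncurry λ κ r → unpack κ (remQuot (suc x) r)) (remQuot-combine κ (combine c d)))
    (cong (unpack κ) (remQuot-combine c d))

  decode-encode : ∀ s → decode (encode s) ≡ s
  decode-encode ι = refl
  decode-encode (st κ c nothing) = decode-combine κ c zero
  decode-encode (st κ c (just d)) = decode-combine κ c (suc d)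

  -- A message carries the labels of both its ends, so that the constraint at a send may depend on
  -- the label of the receive. Each end vouches for its own component through `Own`.
  sender receiver : Fin (x * x) → Fin x
  sender m = proj₁ (remQuot {x} x m)
  receiver m = proj₂ (remQuot {x} x m)

  prevOf : State → Maybe (Fin x)
  prevOf ι = nothing
  prevOf (st _ c _) = just c

  Compatible : State → Fin y → Fin x → Set
  Compatible ι _ _ = ⊤
  Compatible (st κ′ _ nxt) κ c = κ′ ≡ κ × nxt ≡ just c

  Own : Action n A (x * x) → Fin x → Set
  Own (internal _) _ = ⊤
  Own (send _ m _) c = sender m ≡ c
  Own (recv _ m _) c = receiver m ≡ c

  partnerOf : Action n A (x * x) → Partner (Fin n × Fin x)
  partnerOf (internal _) = none
  partnerOf (send _ m q) = out (q , receiver m)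
  partnerOf (recv _ m q) = inn (q , sender m)

  data Trans (p : Fin n) (s : State) (a : Action n A (x * x)) : State → Set where
    tr : ∀ {κ c nxt} → Compatible s κ c → Own a c →
            Φ κ p (actLabel a) (prevOf s) c nxt (partnerOf a) → Trans p s a (st κ c nxt)

  compatible? : ∀ s κ c → Dec (Compatible s κ c)
  compatible? ι _ _ = yes tt
  compatible? (st κ′ _ nxt) κ c = κ′ ≟ κ ×-dec Maybe.≡-dec _≟_ nxt (just c)

  own? : ∀ a c → Dec (Own a c)
  own? (internal _) _ = yes tt
  own? (send _ m _) c = sender m ≟ c
  own? (recv _ m _) c = receiver m ≟ c

  trans? : ∀ p s a s′ → Dec (Trans p s a s′)
  trans? p s a ι = no λ ()
  trans? p s a (st κ c nxt) = map′ (λ (k , o , φ) → tr k o φ) (λ { (tr k o φ) → k , o , φ })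
    (compatible? s κ c ×-dec own? a c ×-dec Φ? κ p _ _ c nxt _)

  Final : Fin y → Fin n → State → Set
  Final κ p ι = Ψ κ p nothing
  Final κ p (st κ′ c nxt) = κ′ ≡ κ × nxt ≡ nothing × Ψ κ p (just c)

  final? : ∀ κ p s → Dec (Final κ p s)
  final? κ p ι = Ψ? κ p nothing
  final? κ p (st κ′ c nxt) = κ′ ≟ κ ×-dec Maybe.≡-dec _≟_ nxt nothing ×-dec Ψ? κ p (just c)

  accepting? : (s : Fin n → Fin #State) → Dec (∃ λ κ → ∀ p → Final κ p (decode (s p)))
  accepting? s = any? λ κ → all? λ p → final? κ p (decode (s p))

  automaton : CFM n A
  automaton = record
    { nMsg = x * x
    ; size = λ _ → #State
    ; init = λ _ → zero
    ; Δ = λ p s a s′ → does (trans? p (decode s) a (decode s′))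
    ; Acc = λ s → does (accepting? s)
    }

  module _ (N : MSC n A) where

    private
      w : Word n A
      w = word N

    prevLab nextLab : (Event w → Fin x) → Event w → Maybe (Fin x)
    prevLab lab (p , i) = Maybe.map lab (at w p (toℕ i))
    nextLab lab (p , i) = Maybe.map lab (at w p (2 + toℕ i))

    withProcess : (Event w → Fin x) → Event w → Fin n × Fin x
    withProcess lab f = proj₁ f , lab f

    record Labelling (κ : Fin y) (lab : Event w → Fin x) : Set where
      field
        local : ∀ e → Φ κ (proj₁ e) (letter w e) (prevLab lab e) (lab e) (nextLab lab e)
                        (mapPartner (withProcess lab) (partner N e))
        final : ∀ p → Ψ κ p (Maybe.map lab (at w p (length (w p))))

    does⇒ : ∀ {P : Set} (d : Dec P) → does d ≡ true → P
    does⇒ (yes p) _ = p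

    lastOr-event : ∀ {X : Set} {l} (f : Fin l → X) d (i : Fin l) → suc (toℕ i) ≡ l → lastOr l f d ≡ f i
    lastOr-event {l = suc l} f d i e = cong f (toℕ-injective (trans (toℕ-fromℕ l) (sym (suc-injective e))))

    module Sound (ρ : Run automaton N) (κ : Fin y)
                 (final : ∀ p → Final κ p (decode (Run.finalState ρ p))) where
      open Run ρ

      record Reading (e : Event w) : Set where
        field
          const : Fin y
          code : Fin x
          promise : Maybe (Fin x)
          tgt≡ : decode (tgt e) ≡ st const code promise
          compatible : Compatible (decode (src e)) const code
          own : Own (act e) code
          local : Φ const (proj₁ e) (actLabel (act e)) (prevOf (decode (src e))) code promise (partnerOf (act e))

      reading : ∀ e → Reading e
      reading e = inversion refl (does⇒ (trans? _ _ _ _) (valid e))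
        where
        inversion : ∀ {s} → decode (tgt e) ≡ s → Trans (proj₁ e) (decode (src e)) (act e) s → Reading e
        inversion eq (tr k o φ) = record { tgt≡ = eq ; compatible = k ; own = o ; local = φ }

      module R e = Reading (reading e)

      lab : Event w → Fin x
      lab = R.code

      linked : ∀ {p i j} → toℕ j ≡ suc (toℕ i) →
               decode (src (p , j)) ≡ st (R.const (p , i)) (lab (p , i)) (R.promise (p , i))
      linked {p} {i} {j} e = trans (cong decode (sym (chain p i j e))) (R.tgt≡ (p , i))

      linked-compatible : ∀ {p i j} → toℕ j ≡ suc (toℕ i) →
        R.const (p , i) ≡ R.const (p , j) × R.promise (p , i) ≡ just (lab (p , j))
      linked-compatible {p} {i} {j} e =
        subst (λ s → Compatible s (R.const (p , j)) (lab (p , j))) (linked e) (R.compatible (p , j))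

      final-last : ∀ {p} i → suc (toℕ i) ≡ length (w p) →
        R.const (p , i) ≡ κ × R.promise (p , i) ≡ nothing × Ψ κ p (just (lab (p , i)))
      final-last {p} i e = subst (Final κ p)
        (trans (cong decode (lastOr-event (λ i → tgt (p , i)) zero i e)) (R.tgt≡ (p , i))) (final p)

      -- Acceptance fixes the constant of the last event only; compatibility of successive states
      -- carries it backwards.
      const≡κ : ∀ e → R.const e ≡ κ
      const≡κ (p , i) = go (length (w p) ∸ suc (toℕ i)) i (m∸n+n≡m (toℕ<n i))
        where
        go : ∀ d i → d + suc (toℕ i) ≡ length (w p) → R.const (p , i) ≡ κ
        go zero i e = proj₁ (final-last i e)
        go (suc d) i e = trans (proj₁ (linked-compatible {j = j} toℕ-j))
          (go d j (trans (cong (λ k → d + suc k) toℕ-j) (trans (+-suc d _) e)))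
          where
          j<ℓ : suc (toℕ i) < length (w p)
          j<ℓ = subst (suc (toℕ i) <_) e (s≤s (m≤n+m (suc (toℕ i)) d))
          j : Fin (length (w p))
          j = fromℕ< j<ℓ
          toℕ-j : toℕ j ≡ suc (toℕ i)
          toℕ-j = toℕ-fromℕ< j<ℓ

      prev≡ : ∀ e → prevOf (decode (src e)) ≡ prevLab lab e
      prev≡ (p , i) = go (toℕ i) refl
        where
        go : ∀ x → toℕ i ≡ x → prevOf (decode (src (p , i))) ≡ Maybe.map lab (at w p x)
        go x e with view (length (w p)) x
        ... | bot = cong (prevOf ∘ decode) (start p i e)
        ... | ev j = trans (cong prevOf (linked e)) (cong (Maybe.map lab) (sym (at-event w p j)))
        ... | top ℓ<x = contradiction (toℕ<n i) (<⇒≯ (subst (length (w p) <_) (sym e) ℓ<x))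

      next≡ : ∀ e → R.promise e ≡ nextLab lab e
      next≡ (p , i) = go (2 + toℕ i) refl
        where
        go : ∀ x → x ≡ 2 + toℕ i → R.promise (p , i) ≡ Maybe.map lab (at w p x)
        go x e with view (length (w p)) x
        ... | ev j = trans (proj₂ (linked-compatible (suc-injective e))) (cong (Maybe.map lab) (sym (at-event w p j)))
        ... | top ℓ<x = trans (proj₁ (proj₂ (final-last i (≤-antisym (toℕ<n i) (≤-pred (subst (length (w p) <_) e ℓ<x))))))
                                (cong (Maybe.map lab) (sym (at-top w p ℓ<x)))

      partner≡ : ∀ e → partnerOf (act e) ≡ mapPartner (withProcess lab) (partner N e)
      partner≡ e with findPartner N e
      ... | _ , is-none ¬out ¬inn = internal-none (act e) (intl e ¬out ¬inn)
        where
        internal-none : ∀ a → IsInternal a → partnerOf a ≡ none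
        internal-none (internal _) _ = refl
      ... | _ , is-out {f} m with comm e f m
      ...   | μ , act-e , act-f rewrite act-e = cong (λ c → out (proj₁ f , c)) (subst (λ a → Own a (lab f)) act-f (R.own f))
      partner≡ e | _ , is-inn {f} m with comm f e m
      ...   | μ , act-f , act-e rewrite act-e = cong (λ c → inn (proj₁ f , c)) (subst (λ a → Own a (lab f)) act-f (R.own f))

      final≡ : ∀ p → Ψ κ p (Maybe.map lab (at w p (length (w p))))
      final≡ p = go (length (w p)) refl
        where
        go : ∀ l → length (w p) ≡ l → Ψ κ p (Maybe.map lab (at w p l))
        go l e with view (length (w p)) l
        ... | ev i = subst (Ψ κ p ∘ Maybe.map lab) (sym (at-event w p i)) (proj₂ (proj₂ (final-last i (sym e))))
        ... | top ℓ<l = contradiction e (<⇒≢ ℓ<l)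
        -- The length is abstracted together with all that depends on it, so that `lastOr` reduces
        -- to the initial state.
        ... | bot with length (w p) | e | (λ i → tgt (p , i)) | final p
        ...   | zero | refl | _ | ψ = ψ

      labelling : Labelling κ lab
      labelling = record
        { local = λ e → Φ-cong (const≡κ e) (label e) (prev≡ e) (next≡ e) (partner≡ e) (R.local e)
        ; final = final≡
        }

    module Complete (κ : Fin y) (lab : Event w → Fin x) (labelling : Labelling κ lab) where
      open Labelling labelling

      stateAfter : Event w → State
      stateAfter (p , i) = st κ (lab (p , i)) (nextLab lab (p , i))

      stateBefore : Event w → State
      stateBefore (p , i) = Maybe.maybe′ stateAfter ι (at w p (toℕ i))

      action : Event w → Action n A (x * x)
      action e with partner N e
      ... | none = internal (letter w e)
      ... | out f = send (letter w e) (combine (lab e) (lab f)) (proj₁ f)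
      ... | inn f = recv (letter w e) (combine (lab f) (lab e)) (proj₁ f)

      action-label : ∀ e → actLabel (action e) ≡ letter w e
      action-label e with partner N e
      ... | none = refl
      ... | out f = refl
      ... | inn f = refl

      action-own : ∀ e → Own (action e) (lab e)
      action-own e with partner N e
      ... | none = tt
      ... | out f = cong proj₁ (remQuot-combine (lab e) (lab f))
      ... | inn f = cong proj₂ (remQuot-combine (lab f) (lab e))

      action-partner : ∀ e → mapPartner (withProcess lab) (partner N e) ≡ partnerOf (action e)
      action-partner e with partner N e
      ... | none = refl
      ... | out f = cong (λ c → out (proj₁ f , c)) (sym (cong proj₂ (remQuot-combine (lab e) (lab f))))
      ... | inn f = cong (λ c → inn (proj₁ f , c)) (sym (cong proj₁ (remQuot-combine (lab f) (lab e))))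

      action-out : ∀ {e f} → partner N e ≡ out f →
                   action e ≡ send (letter w e) (combine (lab e) (lab f)) (proj₁ f)
      action-out eq rewrite eq = refl

      action-inn : ∀ {e f} → partner N e ≡ inn f →
                   action e ≡ recv (letter w e) (combine (lab f) (lab e)) (proj₁ f)
      action-inn eq rewrite eq = refl

      action-none : ∀ e → (∀ f → ¬ Msg w (msgs N) e f) → (∀ f → ¬ Msg w (msgs N) f e) → IsInternal (action e)
      action-none e ¬out ¬inn with findPartner N e
      ... | _ , is-none _ _ = tt
      ... | _ , is-out m = contradiction m (¬out _)
      ... | _ , is-inn m = contradiction m (¬inn _)

      before-chain : ∀ p (i j : Fin (length (w p))) → toℕ j ≡ suc (toℕ i) →
                     stateAfter (p , i) ≡ stateBefore (p , j)
      before-chain p i j e = cong (Maybe.maybe′ stateAfter ι) (sym (trans (cong (at w p) e) (at-event w p i)))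

      before-prev : ∀ e → prevLab lab e ≡ prevOf (stateBefore e)
      before-prev (p , i) with at w p (toℕ i)
      ... | nothing = refl
      ... | just _ = refl

      before-compatible : ∀ e → Compatible (stateBefore e) κ (lab e)
      before-compatible (p , i) = go (toℕ i) refl
        where
        go : ∀ x → x ≡ toℕ i → Compatible (Maybe.maybe′ stateAfter ι (at w p x)) κ (lab (p , i))
        go x e with view (length (w p)) x
        ... | bot = tt
        ... | ev j = subst (λ m → Compatible (Maybe.maybe′ stateAfter ι m) κ (lab (p , i))) (sym (at-event w p j))
            (refl , cong (Maybe.map lab) (trans (cong (at w p ∘ suc) e) (at-event w p i)))
        ... | top ℓ<x = contradiction (toℕ<n i) (<⇒≯ (subst (length (w p) <_) e ℓ<x))

      run : Run automaton N
      run = record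
        { src = encode ∘ stateBefore
        ; act = action
        ; tgt = encode ∘ stateAfter
        ; valid = λ e → dec-true (trans? _ _ _ _)
            (subst₂ (λ s s′ → Trans (proj₁ e) s (action e) s′)
              (sym (decode-encode (stateBefore e))) (sym (decode-encode (stateAfter e)))
              (tr (before-compatible e) (action-own e)
                (Φ-cong refl (sym (action-label e)) (before-prev e) refl (action-partner e) (local e))))
        ; label = action-label
        ; start = λ p i e → cong (λ x → encode (Maybe.maybe′ stateAfter ι (at w p x))) e
        ; chain = λ p i j e → cong encode (before-chain p i j e)
        ; intl = action-none
        ; comm = λ e f m → combine (lab e) (lab f) , action-out (out-partner N m) , action-inn (inn-partner N m)
        }

      finally : ∀ p → Final κ p (decode (Run.finalState run p))
      finally p = go (length (w p)) refl
        where
        go : ∀ l → length (w p) ≡ l → Final κ p (decode (Run.finalState run p))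
        go l e with view (length (w p)) l
        ... | ev i = subst (Final κ p) (sym (trans (cong decode (lastOr-event _ zero i (sym e)))
                        (decode-encode (stateAfter (p , i)))))
                     (refl , cong (Maybe.map lab) (at-top w p (s≤s (≤-reflexive e)))
                     , subst (Ψ κ p ∘ Maybe.map lab) (trans (cong (at w p) e) (at-event w p i)) (final p))
        ... | top ℓ<l = contradiction e (<⇒≢ ℓ<l)
        ... | bot with length (w p) | e | (λ i → encode (stateAfter (p , i))) | final p
        ...   | zero | refl | _ | ψ = ψ

    accepts⇔labelling : Accepts automaton N ⇔ ∃₂ Labelling
    accepts⇔labelling = mk⇔
      (λ (ρ , accepted) → let κ , fin = does⇒ (accepting? (Run.finalState ρ)) accepted in κ , _ , Sound.labelling ρ κ fin)
      (λ (κ , lab , l) → Complete.run κ lab l ,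
        dec-true (accepting? (Run.finalState (Complete.run κ lab l))) (κ , Complete.finally κ lab l))

-- Recurrences over the neighbours of an event

On : {Y : Set} → (Y → Set) → Maybe Y → Set
On P nothing = ⊥
On P (just y) = P y

on? : {Y : Set} {P : Y → Set} → (∀ y → Dec (P y)) → ∀ m → Dec (On P m)
on? P? nothing = no λ ()
on? P? (just y) = P? y

on-intro : {Y : Set} (P : Y → Set) {m : Maybe Y} {y : Y} → m ≡ just y → P y → On P m
on-intro P refl py = py

on-elim : {Y : Set} {P : Y → Set} (m : Maybe Y) → On P m → ∃ λ y → m ≡ just y × P y
on-elim (just y) py = y , refl , py

-- An equality of types rather than an equivalence, so that it passes through sums, products and
-- negations by congruence.
on-map : {Y Z : Set} (P : Z → Set) (g : Y → Z) (m : Maybe Y) → On P (Maybe.map g m) ≡ On (P ∘ g) m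
on-map P g nothing = refl
on-map P g (just y) = refl

on-⇔ : {Y : Set} {P Q : Y → Set} (m : Maybe Y) → (∀ y → m ≡ just y → P y ⇔ Q y) → On P m ⇔ On Q m
on-⇔ nothing _ = mk⇔ (λ x → x) (λ x → x)
on-⇔ (just y) h = h y refl

-- Stated for arbitrary predicates S and T, so that the same steps serve the true counts and the
-- guessed bits.
module Recurrence {E L : Set} (λᴱ : E → L) (nb₁ nb₂ : E → Maybe E) where

  OnceStep : (E → L → Set) → E → L → Set
  OnceStep S e x = λᴱ e ≡ x ⊎ On (λ g → S g x) (nb₁ e) ⊎ On (λ g → S g x) (nb₂ e)

  TwiceStep : (E → L → Set) → (E → L → Set) → E → L → Set
  TwiceStep S T e x = On (λ g → T g x) (nb₁ e) ⊎ On (λ g → T g x) (nb₂ e) ⊎ (λᴱ e ≡ x × On (λ g → S g x) (nb₁ e))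

  FarStep : (E → L → Set) → (E → L → Set) → E → L → Set
  FarStep S T e x = On (λ g → T g x) (nb₁ e) ⊎ On (λ g → T g x) (nb₂ e) ⊎
    ((On (λ g → S g x) (nb₁ e) ⊎ On (λ g → S g x) (nb₂ e)) ×
     ¬ On (λ g → λᴱ g ≡ x) (nb₁ e) × ¬ On (λ g → λᴱ g ≡ x) (nb₂ e))

-- Threshold counting of labels below an event: the labels occurring at least once and at least
-- twice are computed from the two neighbours, because a process occurs as a chain below an event.

module Direction {E L C : Set} (λᴱ : E → L) (proc : L → C) (event≟ : (e f : E) → Dec (e ≡ f))
  (label≟ : (x y : L) → Dec (x ≡ y)) (nb₁ nb₂ : E → Maybe E) (_⊰_ : E → E → Set)
  (⊰-wf : WellFounded _⊰_)
  (⊰-trans : ∀ {e f g} → e ⊰ f → f ⊰ g → e ⊰ g)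
  (⊰-irrefl : ∀ {e} → ¬ e ⊰ e)
  (⊰-nb : ∀ {f e} → f ⊰ e → ∃ λ g → (nb₁ e ≡ just g ⊎ nb₂ e ≡ just g) × (f ≡ g ⊎ f ⊰ g))
  (nb₁-⊰ : ∀ {g e} → nb₁ e ≡ just g → g ⊰ e)
  (nb₂-⊰ : ∀ {g e} → nb₂ e ≡ just g → g ⊰ e)
  (chain : ∀ f g → proc (λᴱ f) ≡ proc (λᴱ g) → f ≡ g ⊎ f ⊰ g ⊎ g ⊰ f)
  (nb₁-proc : ∀ {g e} → nb₁ e ≡ just g → proc (λᴱ g) ≡ proc (λᴱ e))
  (nb₂-proc : ∀ {g e} → nb₂ e ≡ just g → proc (λᴱ g) ≢ proc (λᴱ e))
  (nb₁-top : ∀ {f e} → f ⊰ e → proc (λᴱ f) ≡ proc (λᴱ e) → ∃ λ g → nb₁ e ≡ just g × (f ≡ g ⊎ f ⊰ g))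
  where

  _⊴_ : E → E → Set
  f ⊴ e = f ≡ e ⊎ f ⊰ e

  ⊴-⊰ : ∀ {f g e} → f ⊴ g → g ⊰ e → f ⊰ e
  ⊴-⊰ (inj₁ refl) g⊰e = g⊰e
  ⊴-⊰ (inj₂ f⊰g) g⊰e = ⊰-trans f⊰g g⊰e

  Once Twice Far : E → L → Set
  Once e x = ∃ λ f → f ⊴ e × λᴱ f ≡ x
  Twice e x = ∃₂ λ f f′ → f ⊴ e × f′ ⊴ e × f ≢ f′ × λᴱ f ≡ x × λᴱ f′ ≡ x
  Far e x = ∃ λ f → f ⊰ e × nb₁ e ≢ just f × nb₂ e ≢ just f × λᴱ f ≡ x

  open Recurrence λᴱ nb₁ nb₂ public

  on-nb : ∀ (P : E → Set) {e g} → nb₁ e ≡ just g ⊎ nb₂ e ≡ just g → P g → On P (nb₁ e) ⊎ On P (nb₂ e)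
  on-nb P (inj₁ eq) p = inj₁ (on-intro P eq p)
  on-nb P (inj₂ eq) p = inj₂ (on-intro P eq p)

  once-⊰ : ∀ {f e x} → f ⊰ e → λᴱ f ≡ x → On (λ g → Once g x) (nb₁ e) ⊎ On (λ g → Once g x) (nb₂ e)
  once-⊰ {f} {x = x} f⊰e λf with ⊰-nb f⊰e
  ... | g , nb , f⊴g = on-nb (λ g → Once g x) nb (f , f⊴g , λf)

  once-step : ∀ e x → Once e x ⇔ OnceStep Once e x
  once-step e x = mk⇔ to from
    where
    to : Once e x → OnceStep Once e x
    to (f , inj₁ refl , λf) = inj₁ λf
    to (f , inj₂ f⊰e , λf) = inj₂ (once-⊰ f⊰e λf)
    from : OnceStep Once e x → Once e x
    from (inj₁ λe) = e , inj₁ refl , λe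
    from (inj₂ (inj₁ o)) with on-elim (nb₁ e) o
    ... | g , eq , f , f⊴g , λf = f , inj₂ (⊴-⊰ f⊴g (nb₁-⊰ eq)) , λf
    from (inj₂ (inj₂ o)) with on-elim (nb₂ e) o
    ... | g , eq , f , f⊴g , λf = f , inj₂ (⊴-⊰ f⊴g (nb₂-⊰ eq)) , λf

  -- The upper event `f′` reaches e through some neighbour, and f reaches that neighbour through
  -- `f′`.
  twice-at-neighbour : ∀ {f f′ e x} → f ⊰ f′ → f′ ⊰ e → λᴱ f ≡ x → λᴱ f′ ≡ x →
                       On (λ g → Twice g x) (nb₁ e) ⊎ On (λ g → Twice g x) (nb₂ e)
  twice-at-neighbour {f} {f′} {x = x} f⊰f′ f′⊰e λf λf′ with ⊰-nb f′⊰e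
  ... | g , nb , f′⊴g = on-nb (λ g → Twice g x) nb
    (f , f′ , inj₂ (f⊰g f′⊴g) , f′⊴g , (λ { refl → ⊰-irrefl f⊰f′ }) , λf , λf′)
    where
    f⊰g : f′ ⊴ g → f ⊰ g
    f⊰g (inj₁ refl) = f⊰f′
    f⊰g (inj₂ f′⊰g) = ⊰-trans f⊰f′ f′⊰g

  -- Equal labels force equal processes, so two events labelled x are comparable. If the upper one
  -- is strictly below e, both lie at or below one neighbour. If it is e, the other lies on the
  -- process of e, at or below `nb₁ e`.
  twice-step : ∀ e x → Twice e x ⇔ TwiceStep Once Twice e x
  twice-step e x = mk⇔ to from
    where
    self : ∀ {f} → f ⊰ e → λᴱ f ≡ x → λᴱ e ≡ x → TwiceStep Once Twice e x
    self {f} f⊰e λf λe with nb₁-top f⊰e (cong proc (trans λf (sym λe)))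
    ... | g , eq , f⊴g = inj₂ (inj₂ (λe , on-intro (λ g → Once g x) eq (f , f⊴g , λf)))
    below : ∀ {f f′} → f ⊰ f′ → f′ ⊰ e → λᴱ f ≡ x → λᴱ f′ ≡ x → TwiceStep Once Twice e x
    below f⊰f′ f′⊰e λf λf′ with twice-at-neighbour f⊰f′ f′⊰e λf λf′
    ... | inj₁ o = inj₁ o
    ... | inj₂ o = inj₂ (inj₁ o)
    to : Twice e x → TwiceStep Once Twice e x
    to (f , f′ , inj₁ refl , inj₁ refl , f≢f′ , _ , _) = contradiction refl f≢f′
    to (f , f′ , inj₁ refl , inj₂ f′⊰e , _ , λf , λf′) = self f′⊰e λf′ λf
    to (f , f′ , inj₂ f⊰e , inj₁ refl , _ , λf , λf′) = self f⊰e λf λf′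
    to (f , f′ , inj₂ f⊰e , inj₂ f′⊰e , f≢f′ , λf , λf′) with chain f f′ (cong proc (trans λf (sym λf′)))
    ... | inj₁ f≡f′ = contradiction f≡f′ f≢f′
    ... | inj₂ (inj₁ f⊰f′) = below f⊰f′ f′⊰e λf λf′
    ... | inj₂ (inj₂ f′⊰f) = below f′⊰f f⊰e λf′ λf
    lift : ∀ {g} → g ⊰ e → Twice g x → Twice e x
    lift g⊰e (f , f′ , f⊴g , f′⊴g , rest) = f , f′ , inj₂ (⊴-⊰ f⊴g g⊰e) , inj₂ (⊴-⊰ f′⊴g g⊰e) , rest
    from : TwiceStep Once Twice e x → Twice e x
    from (inj₁ o) with on-elim (nb₁ e) o
    ... | g , eq , t = lift (nb₁-⊰ eq) t
    from (inj₂ (inj₁ o)) with on-elim (nb₂ e) o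
    ... | g , eq , t = lift (nb₂-⊰ eq) t
    from (inj₂ (inj₂ (λe , o))) with on-elim (nb₁ e) o
    ... | g , eq , f , f⊴g , λf =
      f , e , inj₂ f⊰e , inj₁ refl , (λ { refl → ⊰-irrefl f⊰e }) , λf , λe
      where f⊰e = ⊴-⊰ f⊴g (nb₁-⊰ eq)

  -- If a neighbour carries x, any other x-event below e is comparable with it, so two of them lie
  -- at or below a neighbour; if none does, every x-event strictly below e qualifies. Conversely, of
  -- two x-events at most one is a neighbour of e, because the neighbours lie on different
  -- processes.
  far-step : ∀ e x → Far e x ⇔ FarStep Once Twice e x
  far-step e x = mk⇔ to from
    where
    below : ∀ {f f′} → f ⊰ f′ → f′ ⊰ e → λᴱ f ≡ x → λᴱ f′ ≡ x → FarStep Once Twice e x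
    below f⊰f′ f′⊰e λf λf′ with twice-at-neighbour f⊰f′ f′⊰e λf λf′
    ... | inj₁ o = inj₁ o
    ... | inj₂ o = inj₂ (inj₁ o)
    other : ∀ {f g} → f ⊰ e → g ⊰ e → f ≢ g → λᴱ f ≡ x → λᴱ g ≡ x → FarStep Once Twice e x
    other {f} {g} f⊰e g⊰e f≢g λf λg with chain f g (cong proc (trans λf (sym λg)))
    ... | inj₁ f≡g = contradiction f≡g f≢g
    ... | inj₂ (inj₁ f⊰g) = below f⊰g g⊰e λf λg
    ... | inj₂ (inj₂ g⊰f) = below g⊰f f⊰e λg λf
    to : Far e x → FarStep Once Twice e x
    to (f , f⊰e , ≢₁ , ≢₂ , λf)
      with on? (λ g → label≟ (λᴱ g) x) (nb₁ e) | on? (λ g → label≟ (λᴱ g) x) (nb₂ e)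
    ... | no ¬1 | no ¬2 = inj₂ (inj₂ (once-⊰ f⊰e λf , ¬1 , ¬2))
    ... | yes o | _ with on-elim (nb₁ e) o
    ...   | g , eq , λg = other f⊰e (nb₁-⊰ eq) (λ { refl → ≢₁ eq }) λf λg
    to (f , f⊰e , ≢₁ , ≢₂ , λf) | no _ | yes o with on-elim (nb₂ e) o
    ...   | g , eq , λg = other f⊰e (nb₂-⊰ eq) (λ { refl → ≢₂ eq }) λf λg
    twice : ∀ {g} → g ⊰ e → Twice g x → Far e x
    twice g⊰e (f , f′ , f⊴g , f′⊴g , f≢f′ , λf , λf′)
      with Maybe.≡-dec event≟ (nb₁ e) (just f) | Maybe.≡-dec event≟ (nb₂ e) (just f)
    ... | no ≢₁ | no ≢₂ = f , ⊴-⊰ f⊴g g⊰e , ≢₁ , ≢₂ , λf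
    ... | yes eq | _ = f′ , ⊴-⊰ f′⊴g g⊰e
      , (λ eq′ → f≢f′ (Maybe.just-injective (trans (sym eq) eq′)))
      , (λ eq′ → nb₂-proc eq′ (trans (cong proc (trans λf′ (sym λf))) (nb₁-proc eq))) , λf′
    ... | no _ | yes eq = f′ , ⊴-⊰ f′⊴g g⊰e
      , (λ eq′ → nb₂-proc eq (trans (cong proc (trans λf (sym λf′))) (nb₁-proc eq′)))
      , (λ eq′ → f≢f′ (Maybe.just-injective (trans (sym eq) eq′))) , λf′
    once : ∀ {g} → g ⊰ e → ¬ On (λ g → λᴱ g ≡ x) (nb₁ e) → ¬ On (λ g → λᴱ g ≡ x) (nb₂ e) → Once g x → Far e x
    once g⊰e ¬1 ¬2 (f , f⊴g , λf) = f , ⊴-⊰ f⊴g g⊰e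
      , (λ eq → ¬1 (on-intro (λ g → λᴱ g ≡ x) eq λf)) , (λ eq → ¬2 (on-intro (λ g → λᴱ g ≡ x) eq λf)) , λf
    from : FarStep Once Twice e x → Far e x
    from (inj₁ o) with on-elim (nb₁ e) o
    ... | g , eq , t = twice (nb₁-⊰ eq) t
    from (inj₂ (inj₁ o)) with on-elim (nb₂ e) o
    ... | g , eq , t = twice (nb₂-⊰ eq) t
    from (inj₂ (inj₂ (inj₁ o , ¬1 , ¬2))) with on-elim (nb₁ e) o
    ... | g , eq , t = once (nb₁-⊰ eq) ¬1 ¬2 t
    from (inj₂ (inj₂ (inj₂ o , ¬1 , ¬2))) with on-elim (nb₂ e) o
    ... | g , eq , t = once (nb₂-⊰ eq) ¬1 ¬2 t

  open Equivalence

  onceStep-cong : ∀ (S S′ : E → L → Set) {e x} →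
    (∀ g → g ⊰ e → S g x ⇔ S′ g x) → OnceStep S e x ⇔ OnceStep S′ e x
  onceStep-cong S S′ {e} h = mk⇔
    (Sum.map₂ (Sum.map (to (on-⇔ (nb₁ e) λ g eq → h g (nb₁-⊰ eq))) (to (on-⇔ (nb₂ e) λ g eq → h g (nb₂-⊰ eq)))))
    (Sum.map₂ (Sum.map (from (on-⇔ (nb₁ e) λ g eq → h g (nb₁-⊰ eq))) (from (on-⇔ (nb₂ e) λ g eq → h g (nb₂-⊰ eq)))))

  twiceStep-cong : ∀ (S S′ T T′ : E → L → Set) {e x} →
    (∀ g → S g x ⇔ S′ g x) → (∀ g → g ⊰ e → T g x ⇔ T′ g x) → TwiceStep S T e x ⇔ TwiceStep S′ T′ e x
  twiceStep-cong S S′ T T′ {e} h h′ = mk⇔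
    (Sum.map (to (on-⇔ (nb₁ e) λ g eq → h′ g (nb₁-⊰ eq))) (Sum.map (to (on-⇔ (nb₂ e) λ g eq → h′ g (nb₂-⊰ eq)))
      (Product.map₂ (to (on-⇔ (nb₁ e) λ g _ → h g)))))
    (Sum.map (from (on-⇔ (nb₁ e) λ g eq → h′ g (nb₁-⊰ eq))) (Sum.map (from (on-⇔ (nb₂ e) λ g eq → h′ g (nb₂-⊰ eq)))
      (Product.map₂ (from (on-⇔ (nb₁ e) λ g _ → h g)))))

  farStep-cong : ∀ (S S′ T T′ : E → L → Set) {e x} →
    (∀ g → S g x ⇔ S′ g x) → (∀ g → T g x ⇔ T′ g x) → FarStep S T e x → FarStep S′ T′ e x
  farStep-cong S S′ T T′ {e} h h′ = Sum.map (to (on-⇔ (nb₁ e) λ g _ → h′ g)) (Sum.map (to (on-⇔ (nb₂ e) λ g _ → h′ g))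
      (Product.map₁ (Sum.map (to (on-⇔ (nb₁ e) λ g _ → h g)) (to (on-⇔ (nb₂ e) λ g _ → h g)))))

  module _ {S T : E → L → Set} {x : L}
    (S-step : ∀ e → S e x ⇔ OnceStep S e x) (T-step : ∀ e → T e x ⇔ TwiceStep S T e x) where

    -- Well-founded induction: the recurrence has only one solution, so guessed bits that satisfy it
    -- are the true ones. This allows bits about the future.
    once-unique : ∀ e → S e x ⇔ Once e x
    once-unique e = go e (⊰-wf e)
      where
      go : ∀ e → WF.Acc _⊰_ e → S e x ⇔ Once e x
      go e (acc rec) = mk⇔ (from (once-step e x) ∘ to steps ∘ to (S-step e))
                           (from (S-step e) ∘ from steps ∘ to (once-step e x))
        where
        steps : OnceStep S e x ⇔ OnceStep Once e x
        steps = onceStep-cong S Once λ g g⊰e → go g (rec g⊰e)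

    twice-unique : ∀ e → T e x ⇔ Twice e x
    twice-unique e = go e (⊰-wf e)
      where
      go : ∀ e → WF.Acc _⊰_ e → T e x ⇔ Twice e x
      go e (acc rec) = mk⇔ (from (twice-step e x) ∘ to steps ∘ to (T-step e))
                           (from (T-step e) ∘ from steps ∘ to (twice-step e x))
        where
        steps : TwiceStep S T e x ⇔ TwiceStep Once Twice e x
        steps = twiceStep-cong S Once T Twice once-unique λ g g⊰e → go g (rec g⊰e)

    far-unique : ∀ e → FarStep S T e x ⇔ Far e x
    far-unique e = mk⇔ (from (far-step e x) ∘ farStep-cong S Once T Twice once-unique twice-unique)
      (farStep-cong Once S Twice T (λ g → mk⇔ (from (once-unique g)) (to (once-unique g)))
                    (λ g → mk⇔ (from (twice-unique g)) (to (twice-unique g))) ∘ to (far-step e x))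

-- The order on events

module _ {n : ℕ} {A : Set} (w : Word n A) where

  anyEvent? : {P : Event w → Set} → (∀ e → Dec (P e)) → Dec (∃ P)
  anyEvent? P? = map′ (λ (p , i , h) → (p , i) , h) (λ ((p , i) , h) → p , i , h)
    (any? λ p → any? λ i → P? (p , i))

  bound : ℕ
  bound = max 0 (tabulate (length ∘ w))

  length-≤-bound : ∀ p → length (w p) ≤ bound
  length-≤-bound p = All.lookup (xs≤max 0 (tabulate (length ∘ w))) (∈-tabulate⁺ p)

  index : Event w → Fin (n * bound)
  index (p , i) = combine p (inject≤ i (length-≤-bound p))

  index-injective : ∀ {e f} → index e ≡ index f → e ≡ f
  index-injective {p , i} {q , j} eq with combine-injective p _ q _ eq
  ... | refl , eq′ = cong (p ,_) (inject≤-injective _ _ i j eq′)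

  -- There are finitely many events, and a strict partial order on a finite set is well-founded.
  -- Applied to the order and to its converse.
  spo-on-events-wf : {_<_ : Event w → Event w → Set} → (∀ {e} → ¬ e < e) → Transitive _<_ → WellFounded _<_
  spo-on-events-wf {_<_} irrefl <-trans e = go e (spo-wellFounded isSPO (index e))
    where
    _<ⁱ_ : Fin (n * bound) → Fin (n * bound) → Set
    a <ⁱ b = ∃₂ λ e f → index e ≡ a × index f ≡ b × e < f
    isSPO : IsStrictPartialOrder _≡_ _<ⁱ_
    isSPO = record
      { isEquivalence = isEquivalence
      ; irrefl = λ { refl (e , f , eq , eq′ , e<f) →
          irrefl (subst (_< f) (index-injective (trans eq (sym eq′))) e<f) }
      ; trans = λ { (e , f , eq , eq′ , e<f) (f′ , g , eq″ , eq‴ , f′<g) →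
          e , g , eq , eq‴ , <-trans e<f (subst (_< g) (index-injective (trans eq″ (sym eq′))) f′<g) }
      ; <-resp-≈ = (λ { refl lt → lt }) , (λ { refl lt → lt })
      }
    go : ∀ e → WF.Acc _<ⁱ_ (index e) → WF.Acc _<_ e
    go e (acc rec) = acc λ f<e → go _ (rec (_ , e , refl , refl , f<e))

  at⇒ : ∀ p x {g} → at w p x ≡ just g → ∃ λ j → g ≡ (p , j) × x ≡ suc (toℕ j)
  at⇒ p x eq with view (length (w p)) x
  ... | ev j = j , Maybe.just-injective (trans (sym eq) (at-event w p j)) , refl
  ... | top ℓ<x with () ← trans (sym (at-top w p ℓ<x)) eq

  prevEvent nextEvent : Event w → Maybe (Event w)
  prevEvent (p , i) = at w p (toℕ i)
  nextEvent (p , i) = at w p (2 + toℕ i)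

  prev⇔Next : ∀ e g → prevEvent e ≡ just g ⇔ Next w g e
  prev⇔Next (p , i) g = mk⇔ to λ { (next _ j _ e) → trans (cong (at w p) e) (at-event w p j) }
    where
    to : prevEvent (p , i) ≡ just g → Next w g (p , i)
    to eq with at⇒ p (toℕ i) eq
    ... | j , refl , e = next p j i e

  next⇔Next : ∀ e g → nextEvent e ≡ just g ⇔ Next w e g
  next⇔Next (p , i) g = mk⇔ to λ { (next _ _ j e) → trans (cong (at w p ∘ suc) (sym e)) (at-event w p j) }
    where
    to : nextEvent (p , i) ≡ just g → Next w (p , i) g
    to eq with at⇒ p (2 + toℕ i) eq
    ... | j , refl , e = next p i j (sym (suc-injective e))

  next-* : ∀ {p} (i j : Fin (length (w p))) → toℕ i ≤ toℕ j → Star (Next w) (p , i) (p , j)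
  next-* {p} i j i≤j = go (toℕ j ∸ toℕ i) i (m∸n+n≡m i≤j)
    where
    go : ∀ d i → d + toℕ i ≡ toℕ j → Star (Next w) (p , i) (p , j)
    go zero i e = subst (λ k → Star (Next w) (p , i) (p , k)) (toℕ-injective e) ε
    go (suc d) i e = next p i k toℕ-k ◅ go d k (trans (cong (d +_) toℕ-k) (trans (+-suc d _) e))
      where
      k< : suc (toℕ i) < length (w p)
      k< = ≤-<-trans (subst (suc (toℕ i) ≤_) e (s≤s (m≤n+m _ d))) (toℕ<n j)
      k = fromℕ< k<
      toℕ-k : toℕ k ≡ suc (toℕ i)
      toℕ-k = toℕ-fromℕ< k<

  next-*⇒ : ∀ {e f} → Star (Next w) e f → proj₁ e ≡ proj₁ f × toℕ (proj₂ e) ≤ toℕ (proj₂ f)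
  next-*⇒ ε = refl , ≤-refl
  next-*⇒ (next p i j e ◅ s) with next-*⇒ s
  ... | refl , le = refl , ≤-trans (subst (toℕ i ≤_) (sym e) (n≤1+n _)) le

module Order {n : ℕ} {A : Set} (N : MSC n A) where

  w : Word n A
  w = word N

  open IsMSC (isMSC N) public

  infix 4 _<ᴱ_ _≤ᴱ_ _⊲ᴱ_

  _<ᴱ_ _≤ᴱ_ _⊲ᴱ_ : Event w → Event w → Set
  _<ᴱ_ = _≺_ w (msgs N)
  _≤ᴱ_ = _≼_ w (msgs N)
  _⊲ᴱ_ = Msg w (msgs N)

  <-≤-trans′ : ∀ {e f g} → e <ᴱ f → f ≤ᴱ g → e <ᴱ g
  <-≤-trans′ e<f ε = e<f
  <-≤-trans′ e<f (s ◅ ss) = <-≤-trans′ (e<f TC.∷ʳ s) ss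

  <⇒≤ᴱ : ∀ {e f} → e <ᴱ f → e ≤ᴱ f
  <⇒≤ᴱ [ s ] = s ◅ ε
  <⇒≤ᴱ (s ∷ ss) = s ◅ <⇒≤ᴱ ss

  ≤⇒≡⊎< : ∀ {e f} → e ≤ᴱ f → e ≡ f ⊎ e <ᴱ f
  ≤⇒≡⊎< ε = inj₁ refl
  ≤⇒≡⊎< (s ◅ ss) = inj₂ (<-≤-trans′ [ s ] ss)

  process-≤ : ∀ {p i j} → toℕ i ≤ toℕ j → (p , i) ≤ᴱ (p , j)
  process-≤ {p} {i} {j} i≤j = Star.map step→ (next-* w i j i≤j)

  process-< : ∀ {p i j} → toℕ i < toℕ j → (p , i) <ᴱ (p , j)
  process-< {i = i} {j} i<j with ≤⇒≡⊎< (process-≤ {i = i} {j} (<⇒≤ i<j))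
  ... | inj₁ refl = contradiction i<j (<-irrefl refl)
  ... | inj₂ lt = lt

  <ᴱ-process : ∀ {p i j} → (p , i) <ᴱ (p , j) → toℕ i < toℕ j
  <ᴱ-process {p} {i} {j} lt = ≰⇒> λ j≤i → acyclic _ (<-≤-trans′ lt (process-≤ {i = j} {i} j≤i))

  <ᴱ-first : ∀ {e f} → e <ᴱ f → ∃ λ g → Step w (msgs N) e g × (f ≡ g ⊎ g <ᴱ f)
  <ᴱ-first [ s ] = _ , s , inj₁ refl
  <ᴱ-first (s ∷ ss) = _ , s , inj₂ ss

  <ᴱ-last : ∀ {f e} → f <ᴱ e → ∃ λ g → Step w (msgs N) g e × (f ≡ g ⊎ f <ᴱ g)
  <ᴱ-last [ s ] = _ , s , inj₁ refl
  <ᴱ-last (s ∷ ss) with <ᴱ-last ss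
  ... | g , s′ , inj₁ refl = g , s′ , inj₂ [ s ]
  ... | g , s′ , inj₂ lt = g , s′ , inj₂ (s ∷ lt)

  outEvent innEvent : Event w → Maybe (Event w)
  outEvent e = outOf (partner N e)
  innEvent e = innOf (partner N e)

  outOf-just : ∀ {Y : Set} {c : Partner Y} {y} → outOf c ≡ just y → c ≡ out y
  outOf-just {c = out _} refl = refl

  innOf-just : ∀ {Y : Set} {c : Partner Y} {y} → innOf c ≡ just y → c ≡ inn y
  innOf-just {c = inn _} refl = refl

  out⇔Msg : ∀ e g → outEvent e ≡ just g ⇔ e ⊲ᴱ g
  out⇔Msg e g = mk⇔ (λ eq → partner-out N {e} {g} (outOf-just eq)) (cong outOf ∘ out-partner N)

  inn⇔Msg : ∀ e g → innEvent e ≡ just g ⇔ g ⊲ᴱ e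
  inn⇔Msg e g = mk⇔ (λ eq → partner-inn N {e} {g} (innOf-just eq)) (cong innOf ∘ inn-partner N)

  process-trichotomy : ∀ (f g : Event w) → proj₁ f ≡ proj₁ g → f ≡ g ⊎ f <ᴱ g ⊎ g <ᴱ f
  process-trichotomy (p , i) (_ , j) refl with <-cmp (toℕ i) (toℕ j)
  ... | tri< i<j _ _ = inj₂ (inj₁ (process-< i<j))
  ... | tri≈ _ i≡j _ = inj₁ (cong (p ,_) (toℕ-injective i≡j))
  ... | tri> _ _ j<i = inj₂ (inj₂ (process-< j<i))

  process-⊴ : ∀ {p i j} → toℕ i ≤ toℕ j → _≡_ {A = Event w} (p , i) (p , j) ⊎ (p , i) <ᴱ (p , j)
  process-⊴ i≤j = ≤⇒≡⊎< (process-≤ i≤j)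

  next-step : ∀ {e f} → Next w e f → e <ᴱ f
  next-step s = [ step→ s ]

  msg-step : ∀ {e f} → e ⊲ᴱ f → e <ᴱ f
  msg-step m = [ step⊲ m ]

  module _ {L : Set} (λᴬ : A → L) (label≟ : (x y : L) → Dec (x ≡ y)) where
    open Equivalence

    label : Event w → Fin n × L
    label e = proj₁ e , λᴬ (letter w e)

    labelPair≟ : (x y : Fin n × L) → Dec (x ≡ y)
    labelPair≟ = ≡-dec _≟_ label≟

    past-nb : ∀ {f e} → f <ᴱ e → ∃ λ g → (prevEvent w e ≡ just g ⊎ innEvent e ≡ just g) × (f ≡ g ⊎ f <ᴱ g)
    past-nb lt with <ᴱ-last lt
    ... | g , step→ s , le = g , inj₁ (from (prev⇔Next w _ g) s) , le
    ... | g , step⊲ s , le = g , inj₂ (from (inn⇔Msg _ g) s) , le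
    Next-process : ∀ {g e} → Next w g e → proj₁ g ≡ proj₁ e
    Next-process (next _ _ _ _) = refl
    prev-top : ∀ {f e} → f <ᴱ e → proj₁ f ≡ proj₁ e → ∃ λ g → prevEvent w e ≡ just g × (f ≡ g ⊎ f <ᴱ g)
    prev-top {p , j} {_ , i} lt refl = go (toℕ i) refl
      where
      go : ∀ x → x ≡ toℕ i → ∃ λ g → at w p x ≡ just g × ((p , j) ≡ g ⊎ (p , j) <ᴱ g)
      go x eq with view (length (w p)) x
      ... | bot = contradiction (subst (toℕ j <_) (sym eq) (<ᴱ-process lt)) λ ()
      ... | ev k = (p , k) , at-event w p k , process-⊴ (≤-pred (subst (toℕ j <_) (sym eq) (<ᴱ-process lt)))
      ... | top ℓ<x = contradiction (toℕ<n i) (<⇒≯ (subst (length (w p) <_) eq ℓ<x))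

    future-nb : ∀ {f e} → e <ᴱ f → ∃ λ g → (nextEvent w e ≡ just g ⊎ outEvent e ≡ just g) × (f ≡ g ⊎ g <ᴱ f)
    future-nb lt with <ᴱ-first lt
    ... | g , step→ s , le = g , inj₁ (from (next⇔Next w _ g) s) , le
    ... | g , step⊲ s , le = g , inj₂ (from (out⇔Msg _ g) s) , le
    next-top : ∀ {f e} → e <ᴱ f → proj₁ f ≡ proj₁ e → ∃ λ g → nextEvent w e ≡ just g × (f ≡ g ⊎ g <ᴱ f)
    next-top {p , j} {_ , i} lt refl = (p , k) , at-k , le
      where
      k< : suc (toℕ i) < length (w p)
      k< = ≤-<-trans (<ᴱ-process lt) (toℕ<n j)
      k = fromℕ< k<
      at-k : at w p (2 + toℕ i) ≡ just (p , k)
      at-k = trans (cong (at w p ∘ suc) (sym (toℕ-fromℕ< k<))) (at-event w p k)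
      le : (p , j) ≡ (p , k) ⊎ (p , k) <ᴱ (p , j)
      le with process-⊴ {p} {k} {j} (subst (_≤ toℕ j) (sym (toℕ-fromℕ< k<)) (<ᴱ-process lt))
      ... | inj₁ eq = inj₁ (sym eq)
      ... | inj₂ lt′ = inj₂ lt′

    module Past = Direction label proj₁ (event≟ w) labelPair≟ (prevEvent w) innEvent _<ᴱ_
      (spo-on-events-wf w (acyclic _) TC._++_) TC._++_ (acyclic _)
      past-nb (λ {g} {e} eq → next-step (to (prev⇔Next w e g) eq)) (λ {g} {e} eq → msg-step (to (inn⇔Msg e g) eq)) process-trichotomy
      (λ {g} {e} eq → Next-process (to (prev⇔Next w e g) eq)) (λ {g} {e} eq → msgDistinct g e (to (inn⇔Msg e g) eq)) prev-top

    module Future = Direction label proj₁ (event≟ w) labelPair≟ (nextEvent w) outEvent (flip _<ᴱ_)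
      (spo-on-events-wf w (acyclic _) (flip TC._++_)) (flip TC._++_) (acyclic _)
      future-nb (λ {g} {e} eq → next-step (to (next⇔Next w e g) eq)) (λ {g} {e} eq → msg-step (to (out⇔Msg e g) eq))
      (λ f g eq → Sum.map₂ Sum.swap (process-trichotomy f g eq))
      (λ {g} {e} eq → sym (Next-process (to (next⇔Next w e g) eq))) (λ {g} {e} eq → msgDistinct e g (to (out⇔Msg e g) eq) ∘ sym) next-top

-- Monotone maps, duplicate-free lists and minima

step-mono : (f : ℕ → ℕ) → (∀ x → f x ≤ f (suc x)) → ∀ {x y} → x ≤ y → f x ≤ f y
step-mono f step {x} {zero} z≤n = ≤-refl
step-mono f step {x} {suc y} x≤1+y with m≤n⇒m<n∨m≡n x≤1+y
... | inj₁ (s≤s x≤y) = ≤-trans (step-mono f step x≤y) (step y)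
... | inj₂ refl = ≤-refl

unique-lookup-injective : ∀ {X : Set} {xs : List X} → Unique xs → ∀ i j → List.lookup xs i ≡ List.lookup xs j → i ≡ j
unique-lookup-injective (_ ∷ _) zero zero _ = refl
unique-lookup-injective (x≢ ∷ _) zero (suc j) eq = contradiction eq (All.lookup x≢ (∈-lookup j))
unique-lookup-injective (x≢ ∷ _) (suc i) zero eq = contradiction (sym eq) (All.lookup x≢ (∈-lookup i))
unique-lookup-injective (_ ∷ u) (suc i) (suc j) eq = cong suc (unique-lookup-injective u i j eq)

unique-length : ∀ {n} {xs : List (Fin n)} → Unique xs → length xs ≤ n
unique-length u = injective⇒≤ λ {i} {j} → unique-lookup-injective u i j

unique-suffix : ∀ {X : Set} (xs : List X) {ys} → Unique (xs List.++ ys) → Unique ys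
unique-suffix [] u = u
unique-suffix (_ ∷ xs) (_ ∷ u) = unique-suffix xs u

minimise : ∀ {m} (f : Fin m → ℕ) {P : Fin m → Set} → (∀ c → Dec (P c)) → ∃ P →
           ∃ λ c → P c × ∀ c′ → P c′ → f c ≤ f c′
minimise f {P} P? (c , pc) = go c pc (<-wellFounded (f c))
  where
  go : ∀ c → P c → WF.Acc _<_ (f c) → ∃ λ c → P c × ∀ c′ → P c′ → f c ≤ f c′
  go c pc (acc rec) with any? (λ c′ → P? c′ ×-dec f c′ <? f c)
  ... | yes (c′ , pc′ , lt) = go c′ pc′ (rec lt)
  ... | no ¬better = c , pc , λ c′ pc′ → ≮⇒≥ λ lt → ¬better (c′ , pc′ , lt)

-- Routes between processes

-- go s: follow the first message to s sent from here on; back b: the last b-event strictly before.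
data Instr (n k : ℕ) : Set where
  go   : Fin n → Instr n k
  back : Fin k → Instr n k

dest : ∀ {n k} → Instr n k → Fin n → Fin n
dest (go s) r = s
dest (back b) r = r

dests : ∀ {n k m} → Vec (Instr n k) m → Fin n → Fin n
dests [] r = r
dests (i ∷ is) r = dests is (dest i r)

-- Always n hops: a simple path has fewer, and a hop to the current process stays put. Numbering the
-- sequences lets routes index a table.
hops : ∀ {n} → Fin (n ^ n) → Vec (Fin n) n
hops c = Vec.tabulate (finToFun c)

hops-surjective : ∀ {n} (v : Vec (Fin n) n) → ∃ λ c → hops c ≡ v
hops-surjective v = funToFin (Vec.lookup v)
  , trans (tabulate-cong (finToFun-funToFin (Vec.lookup v))) (tabulate∘lookup v)

gos : ∀ {n k m} → Vec (Fin n) m → Vec (Instr n k) m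
gos = Vec.map go

route : ∀ {n k} → Fin (n ^ n) → Fin k → Fin (n ^ n) → Vec (Instr n k) (n + suc n)
route c b c′ = gos (hops c) Vec.++ back b ∷ gos (hops c′)

module Paths {n k : ℕ} {A : Set} (N : MSC n A) (λᴬ : A → Fin k) where

  open Order N

  ℓ : Fin n → ℕ
  ℓ p = length (w p)

  -- Position on s of the receive event, if the event at position x of r sends to s.
  receipt : Fin n → Event w → Maybe ℕ
  receipt s e with outEvent e
  ... | nothing = nothing
  ... | just (q , j) with q ≟ s
  ...   | yes _ = just (suc (toℕ j))
  ...   | no _ = nothing

  receiptAt : Fin n → Fin n → ℕ → Maybe ℕ
  receiptAt r s x = at w r x Maybe.>>= receipt s

  -- The argument d counts the positions still to be searched; running out of them means ∞ on s.
  scan : Fin n → Fin n → ℕ → ℕ → ℕ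
  scan r s zero x = suc (ℓ s)
  scan r s (suc d) x = Maybe.maybe′ (λ y → y) (scan r s d (suc x)) (receiptAt r s x)

  goPos : Fin n → Fin n → ℕ → ℕ
  goPos r s zero = 0
  goPos r s x@(suc _) = scan r s (suc (ℓ r) ∸ x) x

  backPos : Fin n → Fin k → ℕ → ℕ
  backPos r b zero = 0
  backPos r b (suc y) with on? (λ e → λᴬ (letter w e) ≟ b) (at w r y)
  ... | yes _ = y
  ... | no _ = backPos r b y

  move : Instr n k → Fin n → ℕ → ℕ
  move (go s) r x with r ≟ s
  ... | yes _ = x
  ... | no _ = goPos r s x
  move (back b) r x = backPos r b x

  moves : ∀ {m} → Vec (Instr n k) m → Fin n → ℕ → ℕ
  moves [] r x = x
  moves (i ∷ is) r x = moves is (dest i r) (move i r x)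

  dests-++ : ∀ {m m′} (is : Vec (Instr n k) m) (js : Vec (Instr n k) m′) r →
             dests (is Vec.++ js) r ≡ dests js (dests is r)
  dests-++ [] js r = refl
  dests-++ (i ∷ is) js r = dests-++ is js (dest i r)

  moves-++ : ∀ {m m′} (is : Vec (Instr n k) m) (js : Vec (Instr n k) m′) r x →
             moves (is Vec.++ js) r x ≡ moves js (dests is r) (moves is r x)
  moves-++ [] js r x = refl
  moves-++ (i ∷ is) js r x = moves-++ is js (dest i r) (move i r x)

  receipt-msg : ∀ {e s j} → e ⊲ᴱ (s , j) → receipt s e ≡ just (suc (toℕ j))
  receipt-msg {e} {s} {j} m rewrite Equivalence.from (out⇔Msg e (s , j)) m with s ≟ s
  ... | yes _ = refl
  ... | no s≢s = contradiction refl s≢s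

  receipt-just : ∀ e {s y} → receipt s e ≡ just y → ∃ λ j → y ≡ suc (toℕ j) × e ⊲ᴱ (s , j)
  receipt-just e {s} eq with outEvent e in eq′
  ... | just (q , j) with q ≟ s
  receipt-just e refl | just (q , j) | yes refl = j , refl , Equivalence.to (out⇔Msg e (q , j)) eq′

  receiptAt-event : ∀ {r i} s → receiptAt r s (suc (toℕ i)) ≡ receipt s (r , i)
  receiptAt-event {r} {i} s = cong (Maybe._>>= receipt s) (at-event w r i)

  receiptAt-just : ∀ r s x {y} → receiptAt r s x ≡ just y →
                   ∃₂ λ i j → x ≡ suc (toℕ i) × y ≡ suc (toℕ j) × (r , i) ⊲ᴱ (s , j)
  receiptAt-just r s x eq with view (ℓ r) x
  ... | top ℓ<x with () ← trans (sym (cong (Maybe._>>= receipt s) (at-top w r ℓ<x))) eq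
  receiptAt-just r s .(suc (toℕ i)) eq | ev i with receipt-just (r , i) (trans (sym (receiptAt-event s)) eq)
  ... | j , eq′ , m = i , j , refl , eq′ , m

  goPos-event : ∀ r s (i : Fin (ℓ r)) →
    goPos r s (suc (toℕ i)) ≡ Maybe.maybe′ (λ y → y) (goPos r s (2 + toℕ i)) (receipt s (r , i))
  goPos-event r s i = trans (cong (λ d → scan r s d (suc (toℕ i))) (+-∸-assoc 1 (toℕ<n i)))
    (cong (Maybe.maybe′ (λ y → y) (goPos r s (2 + toℕ i))) (receiptAt-event s))

  goPos-top : ∀ r s {x} → ℓ r < x → goPos r s x ≡ suc (ℓ s)
  goPos-top r s {suc x} (s≤s ℓ≤x) = cong (λ d → scan r s d (suc x)) (m≤n⇒m∸n≡0 ℓ≤x)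

  -- FIFO forbids a later message from r to s to be received earlier, and ∞ exceeds every position.
  -- This is the source of monotonicity.
  scan-fifo : ∀ {r s i j} → (r , i) ⊲ᴱ (s , j) → ∀ d x → toℕ i < x → suc (toℕ j) ≤ scan r s d x
  scan-fifo m zero x _ = s≤s (<⇒≤ (toℕ<n _))
  scan-fifo {r} {s} {i} {j} m (suc d) x i<x with receiptAt r s x in eq
  ... | nothing = scan-fifo m d (suc x) (m≤n⇒m≤1+n i<x)
  ... | just y with receiptAt-just r s x eq
  ...   | i′ , j′ , refl , refl , m′ = s≤s (proj₂ (next-*⇒ w (Equivalence.to (fifo _ _ _ _ m m′ refl refl)
            (next-* w i i′ (≤-pred i<x)))))

  goPos-mono : ∀ r s {x y} → x ≤ y → goPos r s x ≤ goPos r s y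
  goPos-mono r s = step-mono (goPos r s) go-suc
    where
    go-suc : ∀ x → goPos r s x ≤ goPos r s (suc x)
    go-suc x with view (ℓ r) x
    ... | bot = z≤n
    ... | top ℓ<x = ≤-reflexive (trans (goPos-top r s ℓ<x) (sym (goPos-top r s (m≤n⇒m≤1+n ℓ<x))))
    ... | ev i = subst (_≤ goPos r s (2 + toℕ i)) (sym (goPos-event r s i)) le
      where
      le : Maybe.maybe′ (λ y → y) (goPos r s (2 + toℕ i)) (receipt s (r , i)) ≤ goPos r s (2 + toℕ i)
      le with receipt s (r , i) in eq
      ... | nothing = ≤-refl
      ... | just y with receipt-just (r , i) eq
      ...   | j , refl , m = scan-fifo m (suc (ℓ r) ∸ (2 + toℕ i)) (2 + toℕ i) (s≤s (n≤1+n _))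

  backPos-≤ : ∀ r b x → backPos r b x ≤ x
  backPos-≤ r b zero = z≤n
  backPos-≤ r b (suc y) with on? (λ e → λᴬ (letter w e) ≟ b) (at w r y)
  ... | yes _ = n≤1+n y
  ... | no _ = m≤n⇒m≤1+n (backPos-≤ r b y)

  backPos-mono : ∀ r b {x y} → x ≤ y → backPos r b x ≤ backPos r b y
  backPos-mono r b = step-mono (backPos r b) back-suc
    where
    back-suc : ∀ x → backPos r b x ≤ backPos r b (suc x)
    back-suc x with on? (λ e → λᴬ (letter w e) ≟ b) (at w r x)
    ... | yes _ = backPos-≤ r b x
    ... | no _ = ≤-refl

  backPos-event : ∀ {r b} (j : Fin (ℓ r)) → λᴬ (letter w (r , j)) ≡ b → backPos r b (2 + toℕ j) ≡ suc (toℕ j)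
  backPos-event {r} {b} j eq with on? (λ e → λᴬ (letter w e) ≟ b) (at w r (suc (toℕ j)))
  ... | yes _ = refl
  ... | no ¬o = contradiction (on-intro (λ e → λᴬ (letter w e) ≡ b) (at-event w r j) eq) ¬o

  backPos-skip : ∀ {r b} (j : Fin (ℓ r)) → λᴬ (letter w (r , j)) ≢ b →
                 backPos r b (2 + toℕ j) ≡ backPos r b (suc (toℕ j))
  backPos-skip {r} {b} j ≢b with on? (λ e → λᴬ (letter w e) ≟ b) (at w r (suc (toℕ j)))
  ... | no _ = refl
  ... | yes o = contradiction (subst (On (λ e → λᴬ (letter w e) ≡ b)) (at-event w r j) o) ≢b

  backPos-top : ∀ {r b x} → ℓ r < x → backPos r b (suc x) ≡ backPos r b x
  backPos-top {r} {b} {x} ℓ<x with on? (λ e → λᴬ (letter w e) ≟ b) (at w r x)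
  ... | no _ = refl
  ... | yes o = ⊥-elim (subst (On (λ e → λᴬ (letter w e) ≡ b)) (at-top w r ℓ<x) o)

  backPos-target : ∀ r b x → backPos r b x ≡ 0 ⊎
    ∃ λ j → backPos r b x ≡ suc (toℕ j) × suc (toℕ j) < x × λᴬ (letter w (r , j)) ≡ b
  backPos-target r b zero = inj₁ refl
  backPos-target r b (suc y) with on? (λ e → λᴬ (letter w e) ≟ b) (at w r y)
  ... | no _ = Sum.map₂ (λ (j , eq , lt , l) → j , eq , m≤n⇒m≤1+n lt , l) (backPos-target r b y)
  ... | yes o with on-elim (at w r y) o
  ...   | e , eq , l with at⇒ w r y eq
  ...     | j , refl , refl = inj₂ (j , refl , ≤-refl , l)

  move-mono : ∀ i r {x y} → x ≤ y → move i r x ≤ move i r y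
  move-mono (go s) r x≤y with r ≟ s
  ... | yes _ = x≤y
  ... | no _ = goPos-mono r s x≤y
  move-mono (back b) r x≤y = backPos-mono r b x≤y

  moves-mono : ∀ {m} (is : Vec (Instr n k) m) r {x y} → x ≤ y → moves is r x ≤ moves is r y
  moves-mono [] r x≤y = x≤y
  moves-mono (i ∷ is) r x≤y = moves-mono is (dest i r) (move-mono i r x≤y)

  scan-≤ : ∀ r s d x → scan r s d x ≤ suc (ℓ s)
  scan-≤ r s zero x = ≤-refl
  scan-≤ r s (suc d) x with receiptAt r s x in eq
  ... | nothing = scan-≤ r s d (suc x)
  ... | just y with receiptAt-just r s x eq
  ...   | i , j , refl , refl , m = s≤s (<⇒≤ (toℕ<n j))

  move-≤ : ∀ i r {x} → x ≤ suc (ℓ r) → move i r x ≤ suc (ℓ (dest i r))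
  move-≤ (back b) r x≤ = ≤-trans (backPos-≤ r b _) x≤
  move-≤ (go s) r {x} x≤ with r ≟ s
  ... | yes refl = x≤
  move-≤ (go s) r {zero} x≤ | no _ = z≤n
  move-≤ (go s) r {suc x} x≤ | no _ = scan-≤ r s (suc (ℓ r) ∸ suc x) (suc x)

  move-0 : ∀ i r → move i r 0 ≡ 0
  move-0 (go s) r with r ≟ s
  ... | yes _ = refl
  ... | no _ = refl
  move-0 (back b) r = refl

  moves-0 : ∀ {m} (is : Vec (Instr n k) m) r → moves is r 0 ≡ 0
  moves-0 [] r = refl
  moves-0 (i ∷ is) r = trans (cong (moves is (dest i r)) (move-0 i r)) (moves-0 is (dest i r))

  move-go-msg : ∀ {r s i j} → (r , i) ⊲ᴱ (s , j) → move (go s) r (suc (toℕ i)) ≡ suc (toℕ j)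
  move-go-msg {r} {s} {i} m with r ≟ s
  ... | yes r≡s = contradiction r≡s (msgDistinct _ _ m)
  ... | no _ = trans (goPos-event r s i) (cong (Maybe.maybe′ (λ y → y) _) (receipt-msg m))

  -- Vacuous at ∞, so a missing message needs no separate treatment.
  Dominates : Event w → Fin n → ℕ → Set
  Dominates e p x = ∀ j → x ≤ suc (toℕ j) → e ≤ᴱ (p , j)

  dominates-self : ∀ {p} i {x} → suc (toℕ i) ≤ x → Dominates (p , i) p x
  dominates-self i i≤x j x≤j = process-≤ (≤-pred (≤-trans i≤x x≤j))

  -- The lower bound 1 travels along because -∞ is fixed by every move: from there nothing could be
  -- concluded about the next process.
  scan-dominates : ∀ {e r s} d x → 1 ≤ x → Dominates e r x → 1 ≤ scan r s d x × Dominates e s (scan r s d x)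
  scan-dominates {s = s} zero x _ _ = s≤s z≤n , λ j ℓ<j → contradiction ℓ<j (<⇒≱ (s≤s (toℕ<n j)))
  scan-dominates {r = r} {s} (suc d) x 1≤x dom with receiptAt r s x in eq
  ... | nothing = scan-dominates d (suc x) (s≤s z≤n) (λ j x<j → dom j (<⇒≤ x<j))
  ... | just y with receiptAt-just r s x eq
  ...   | i , j , refl , refl , m = s≤s z≤n , λ j′ j≤j′ →
          dom i ≤-refl ◅◅ (step⊲ m ◅ process-≤ (≤-pred j≤j′))

  move-go-dominates : ∀ {e} s r {x} → 1 ≤ x → Dominates e r x →
                      1 ≤ move (go s) r x × Dominates e s (move (go s) r x)
  move-go-dominates s r {suc x} 1≤x dom with r ≟ s
  ... | yes refl = 1≤x , dom
  ... | no _ = scan-dominates (suc (ℓ r) ∸ suc x) (suc x) 1≤x dom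

  moves-gos-dominates : ∀ {m e} (v : Vec (Fin n) m) r {x} → 1 ≤ x → Dominates e r x →
                        Dominates e (dests (gos {k = k} v) r) (moves (gos v) r x)
  moves-gos-dominates [] r _ dom = dom
  moves-gos-dominates (s ∷ v) r 1≤x dom with move-go-dominates s r 1≤x dom
  ... | 1≤x′ , dom′ = moves-gos-dominates v s 1≤x′ dom′

  -- Hop sequences of arbitrary length, in which paths are built and cut; `pad` brings them to
  -- length n.
  travel : List (Fin n) → Fin n → ℕ → ℕ
  travel [] r x = x
  travel (s ∷ u) r x = travel u s (move (go s) r x)

  end : List (Fin n) → Fin n → Fin n
  end [] r = r
  end (s ∷ u) r = end u s

  travel-mono : ∀ u r {x y} → x ≤ y → travel u r x ≤ travel u r y
  travel-mono [] r x≤y = x≤y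
  travel-mono (s ∷ u) r x≤y = travel-mono u s (move-mono (go s) r x≤y)

  travel-++ : ∀ u v r x → travel (u List.++ v) r x ≡ travel v (end u r) (travel u r x)
  travel-++ [] v r x = refl
  travel-++ (s ∷ u) v r x = travel-++ u v s (move (go s) r x)

  end-++ : ∀ u v r → end (u List.++ v) r ≡ end v (end u r)
  end-++ [] v r = refl
  end-++ (s ∷ u) v r = end-++ u v s

  travel-dominates : ∀ {e} u r {x} → 1 ≤ x → Dominates e r x →
                     1 ≤ travel u r x × Dominates e (end u r) (travel u r x)
  travel-dominates [] r 1≤x dom = 1≤x , dom
  travel-dominates (s ∷ u) r 1≤x dom with move-go-dominates s r 1≤x dom
  ... | 1≤x′ , dom′ = travel-dominates u s 1≤x′ dom′

  stay : ∀ m (r : Fin n) → ∃ λ (v : Vec (Fin n) m) → dests (gos {k = k} v) r ≡ r × ∀ x → moves (gos v) r x ≡ x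
  stay zero r = [] , refl , λ _ → refl
  stay (suc m) r with stay m r
  ... | v , d , mv = r ∷ v , d , λ x → trans (cong (moves (gos v) r) (here x)) (mv x)
    where
    here : ∀ x → move (go r) r x ≡ x
    here x with r ≟ r
    ... | yes _ = refl
    ... | no r≢r = contradiction refl r≢r

  pad : ∀ m u r → length u ≤ m → ∃ λ (v : Vec (Fin n) m) →
        dests (gos {k = k} v) r ≡ end u r × ∀ x → moves (gos v) r x ≡ travel u r x
  pad m [] r _ = stay m r
  pad (suc m) (s ∷ u) r (s≤s u≤m) with pad m u s u≤m
  ... | v , d , mv = s ∷ v , d , λ x → mv (move (go s) r x)

  -- A path is made simple by cutting it back to the process it revisits: staying there is no slower.
  ≤ᴱ⇒travel : ∀ {e f} → e ≤ᴱ f → ∃ λ u → Unique (proj₁ e ∷ u) × end u (proj₁ e) ≡ proj₁ f ×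
              travel u (proj₁ e) (suc (toℕ (proj₂ e))) ≤ suc (toℕ (proj₂ f))
  ≤ᴱ⇒travel ε = [] , All.[] ∷ [] , refl , ≤-refl
  ≤ᴱ⇒travel (step→ (next p i j eq) ◅ ss) with ≤ᴱ⇒travel ss
  ... | u , uniq , d , le = u , uniq , d
    , ≤-trans (travel-mono u p (s≤s (subst (toℕ i ≤_) (sym eq) (n≤1+n _)))) le
  ≤ᴱ⇒travel {p , i} (step⊲ {f = s , j} m ◅ ss) with ≤ᴱ⇒travel ss
  ... | u , uniq , d , le with Any.any? (p ≟_) (s ∷ u)
  ...   | no p∉ = s ∷ u , ¬Any⇒All¬ _ p∉ ∷ uniq , d
    , subst (λ x → travel u s x ≤ _) (sym (move-go-msg m)) le
  ...   | yes (Any.here p≡s) = contradiction p≡s (msgDistinct _ _ m)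
  ...   | yes (Any.there p∈u) with ∈-∃++ p∈u
  ...     | u₁ , u₂ , refl = u₂ , unique-suffix u₁ (unique-tail uniq) , trans (sym (end-++ u₁ (p ∷ u₂) s)) d
    , ≤-trans (travel-mono u₂ p (≰⇒≥ revisit))
              (subst (_≤ _) (travel-++ u₁ (p ∷ u₂) s (suc (toℕ j))) le)
    where
    unique-tail : ∀ {x xs} → Unique (x ∷ xs) → Unique {A = Fin n} xs
    unique-tail (_ ∷ u) = u
    x′ : ℕ
    x′ = move (go p) (end u₁ s) (travel u₁ s (suc (toℕ j)))
    dom : Dominates (s , j) p x′
    dom = let 1≤x , dom = travel-dominates u₁ s (s≤s z≤n) (dominates-self j ≤-refl)
          in proj₂ (move-go-dominates p (end u₁ s) 1≤x dom)
    -- Coming back to p no later than the event left would put the receive event below the send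
    -- event.
    revisit : ¬ x′ ≤ suc (toℕ i)
    revisit x′≤ = acyclic _ (<-≤-trans′ (msg-step m) (dom i x′≤))

  -- Reduces reachability to finitely many arrival positions; decidability of the order is a
  -- by-product.
  ≤ᴱ⇔hops : ∀ {e f} → e ≤ᴱ f ⇔ ∃ λ c → dests (gos {k = k} (hops c)) (proj₁ e) ≡ proj₁ f ×
            moves (gos (hops c)) (proj₁ e) (suc (toℕ (proj₂ e))) ≤ suc (toℕ (proj₂ f))
  ≤ᴱ⇔hops {p , i} {q , j} = mk⇔ to λ { (c , refl , le) →
      moves-gos-dominates (hops c) p (s≤s z≤n) (dominates-self i ≤-refl) j le }
    where
    to : (p , i) ≤ᴱ (q , j) → _
    to e≤f with ≤ᴱ⇒travel e≤f
    ... | u , uniq , d , le with pad n u p (<⇒≤ (unique-length uniq))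
    ...   | v , d′ , mv with hops-surjective v
    ...     | c , refl = c , trans d′ d , subst (_≤ _) (sym (mv (suc (toℕ i)))) le

  _≤ᴱ?_ : ∀ e f → Dec (e ≤ᴱ f)
  e ≤ᴱ? f = map′ (Equivalence.from ≤ᴱ⇔hops) (Equivalence.to ≤ᴱ⇔hops)
    (any? λ c → _ ≟ _ ×-dec _ ≤? _)

  -- A hop sequence leads to q even if no message does; it then arrives at ∞. Hence the quantifiers
  -- in `Escapes` are not vacuous.
  hops-to : ∀ p q → ∃ λ c → dests (gos {k = k} (hops c)) p ≡ q
  hops-to p q with pad n (q ∷ []) p (≤-trans (s≤s z≤n) (toℕ<n p))
  ... | v , d , _ with hops-surjective v
  ...   | c , refl = c , d

  Escapes : Event w → Fin n → Fin k → Set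
  Escapes (p , i) q b = ∀ c c′ → dests (gos {k = k} (hops c)) p ≡ q → dests (gos {k = k} (hops c′)) q ≡ p →
    suc (toℕ i) < moves (route c b c′) p (suc (toℕ i))

  Parallel : Event w → Fin n → Fin k → Set
  Parallel e q b = ∃ λ f → _∥_ w (msgs N) e f × proj₁ f ≡ q × λᴬ (letter w f) ≡ b

  moves-route : ∀ c b c′ p x → moves (route c b c′) p x ≡
    (let q = dests (gos {k = k} (hops c)) p in
     moves (gos (hops c′)) q (backPos q b (moves (gos (hops c)) p x)))
  moves-route c b c′ p x = moves-++ (gos (hops c)) (back b ∷ gos (hops c′)) p x

  parallel-process : ∀ {e q b} → Parallel e q b → proj₁ e ≢ q
  parallel-process {p , i} ((_ , j) , (¬≤ , ¬≥) , refl , _) refl with ≤-total (toℕ i) (toℕ j)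
  ... | inj₁ i≤j = ¬≤ (process-≤ i≤j)
  ... | inj₂ j≤i = ¬≥ (process-≤ j≤i)

  -- Every arrival on q lies above e, hence after the parallel event f, so stepping back cannot pass
  -- f. If the route then returned no later than e, f would be below e.
  parallel⇒escapes : ∀ {e q b} → Parallel e q b → Escapes e q b
  parallel⇒escapes {p , i} {b = b} ((q , j) , (¬≤ , ¬≥) , refl , l) c c′ refl d′ =
    subst (suc (toℕ i) <_) (sym (moves-route c b c′ p (suc (toℕ i))))
      (≰⇒> λ le → ¬≥ (subst (λ r → Dominates (q , j) r (moves (gos (hops c′)) q z)) d′ dom′ i le))
    where
    y z : ℕ
    y = moves (gos (hops c)) p (suc (toℕ i))
    z = backPos q b y
    dom : Dominates (p , i) q y
    dom = moves-gos-dominates (hops c) p (s≤s z≤n) (dominates-self i ≤-refl)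
    j≤z : suc (toℕ j) ≤ z
    j≤z = subst (_≤ z) (backPos-event j l) (backPos-mono q b (≰⇒> λ y≤ → ¬≤ (dom j y≤)))
    dom′ : Dominates (q , j) (dests (gos {k = k} (hops c′)) q) (moves (gos (hops c′)) q z)
    dom′ = moves-gos-dominates (hops c′) q (≤-trans (s≤s z≤n) j≤z) (dominates-self j j≤z)

  -- The outward hops are chosen with the earliest arrival on q. The last b-event before it is then
  -- not above e, and it is not below e because no way back from it arrives by e.
  escapes⇒parallel : ∀ {e q b} → Escapes e q b → Parallel e q b
  escapes⇒parallel {p , i} {q} {b} esc
    with minimise (λ c → moves (gos (hops c)) p (suc (toℕ i))) (λ c → dests (gos {k = k} (hops c)) p ≟ q) (hops-to p q)
  ... | c , refl , least = found (backPos-target q b y)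
    where
    y : ℕ
    y = moves (gos (hops c)) p (suc (toℕ i))
    esc′ : ∀ c′ → dests (gos {k = k} (hops c′)) q ≡ p → suc (toℕ i) < moves (gos (hops c′)) q (backPos q b y)
    esc′ c′ d′ = subst (suc (toℕ i) <_) (moves-route c b c′ p (suc (toℕ i))) (esc c c′ refl d′)
    found : _ → Parallel (p , i) q b
    -- Without a b-event before the arrival, the route falls to -∞ and stays there, so it cannot
    -- escape.
    found (inj₁ eq) = let c′ , d′ = hops-to q p in
      contradiction (subst (suc (toℕ i) <_) (trans (cong (moves (gos (hops c′)) q) eq) (moves-0 (gos (hops c′)) q)) (esc′ c′ d′)) λ ()
    found (inj₂ (j , eq , lt , l)) = (q , j) , (not-above , not-below) , refl , l
      where
      not-above : ¬ (p , i) ≤ᴱ (q , j)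
      not-above le with Equivalence.to ≤ᴱ⇔hops le
      ... | c″ , d , le′ = <⇒≱ lt (≤-trans (least c″ d) le′)
      not-below : ¬ (q , j) ≤ᴱ (p , i)
      not-below le with Equivalence.to ≤ᴱ⇔hops le
      ... | c″ , d , le′ = <⇒≱ (subst (λ z → suc (toℕ i) < moves (gos (hops c″)) q z) eq (esc′ c″ d)) le′

-- Codes of events and their local conditions

_⇔-dec_ : ∀ {P Q : Set} → Dec P → Dec Q → Dec (P ⇔ Q)
p? ⇔-dec q? = map′ (λ (f , g) → mk⇔ f g) (λ e → Equivalence.to e , Equivalence.from e)
  ((p? →-dec q?) ×-dec (q? →-dec p?))

module Codes (n k : ℕ) where

  Q #Suffixes : ℕ
  Q = n ^ n
  #Suffixes = suc (n + suc n)

  -- Number of functions that assign one of v values to each route, flag and suffix. A route has 2n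
  -- + 1 instructions and thus 2n + 2 suffixes.
  #Table : ℕ → ℕ
  #Table v = ((((v ^ #Suffixes) ^ 2) ^ Q) ^ k) ^ Q

  entry : ∀ {v} → Fin (#Table v) → Fin Q → Fin k → Fin Q → Fin 2 → Fin #Suffixes → Fin v
  entry t c b c′ φ j = finToFun (finToFun (finToFun (finToFun (finToFun t c) b) c′) φ) j

  module _ {v : ℕ} (V : Fin Q → Fin k → Fin Q → Fin 2 → Fin #Suffixes → Fin v) where

    private
      table₄ : ∀ c b c′ → Fin 2 → Fin (v ^ #Suffixes)
      table₄ c b c′ φ = funToFin (V c b c′ φ)
      table₃ : ∀ c b → Fin Q → Fin ((v ^ #Suffixes) ^ 2)
      table₃ c b c′ = funToFin (table₄ c b c′)
      table₂ : ∀ c → Fin k → Fin (((v ^ #Suffixes) ^ 2) ^ Q)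
      table₂ c b = funToFin (table₃ c b)
      table₁ : Fin Q → Fin ((((v ^ #Suffixes) ^ 2) ^ Q) ^ k)
      table₁ c = funToFin (table₂ c)

    table : Fin (#Table v)
    table = funToFin table₁

    entry-table : ∀ c b c′ φ j → entry table c b c′ φ j ≡ V c b c′ φ j
    entry-table c b c′ φ j =
      trans (cong (λ s → finToFun (finToFun (finToFun (finToFun s b) c′) φ) j) (finToFun-funToFin table₁ c))
      (trans (cong (λ s → finToFun (finToFun (finToFun s c′) φ) j) (finToFun-funToFin (table₂ c) b))
      (trans (cong (λ s → finToFun (finToFun s φ) j) (finToFun-funToFin (table₃ c b) c′))
      (trans (cong (λ s → finToFun s j) (finToFun-funToFin (table₄ c b c′) φ)) (finToFun-funToFin (V c b c′ φ) j))))

  -- Four sets of labelled processes; a code adds a letter and a table of colours; the constant is a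
  -- table of colours at ∞, one for each process.
  #Sets #Code #Const : ℕ
  #Sets = ((2 ^ k) ^ n) ^ 4
  #Code = k * (#Sets * #Table 4)
  #Const = #Table (4 ^ n)

  Code Const : Set
  Code = Fin #Code
  Const = Fin #Const

  labelOf : Code → Fin k
  labelOf s = proj₁ (remQuot {k} (#Sets * #Table 4) s)

  private
    rest : Code → Fin #Sets × Fin (#Table 4)
    rest s = remQuot {#Sets} (#Table 4) (proj₂ (remQuot {k} (#Sets * #Table 4) s))

  bit : Code → Fin 4 → Fin n → Fin k → Fin 2
  bit s i q b = finToFun (finToFun (finToFun (proj₁ (rest s)) i) q) b

  colour : Fin Q → Fin k → Fin Q → Fin 2 → Fin #Suffixes → Code → Colour
  colour c b c′ φ j s = entry (proj₂ (rest s)) c b c′ φ j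

  constant : Const → Fin Q → Fin k → Fin Q → Fin 2 → Fin #Suffixes → Fin n → Colour
  constant κ c b c′ φ j r = finToFun (entry κ c b c′ φ j) r

  module _ (l : Fin k) (S : Fin 4 → Fin n → Fin k → Fin 2)
           (V : Fin Q → Fin k → Fin Q → Fin 2 → Fin #Suffixes → Colour) where

    private
      rows : ∀ i → Fin n → Fin (2 ^ k)
      rows i q = funToFin (S i q)
      planes : Fin 4 → Fin ((2 ^ k) ^ n)
      planes i = funToFin (rows i)
      sets : Fin #Sets
      sets = funToFin planes
      colours : Fin (#Table 4)
      colours = table V

    code : Code
    code = combine l (combine sets colours)

    labelOf-code : labelOf code ≡ l
    labelOf-code = cong proj₁ (remQuot-combine l (combine sets colours))

    private
      rest-code : rest code ≡ (sets , colours)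
      rest-code = trans (cong (remQuot {#Sets} (#Table 4) ∘ proj₂) (remQuot-combine l (combine sets colours)))
                        (remQuot-combine sets colours)

    bit-code : ∀ i q b → bit code i q b ≡ S i q b
    bit-code i q b = trans (cong (λ s → finToFun (finToFun (finToFun (proj₁ s) i) q) b) rest-code)
      (trans (cong (λ s → finToFun (finToFun s q) b) (finToFun-funToFin planes i))
      (trans (cong (λ s → finToFun s b) (finToFun-funToFin (rows i) q)) (finToFun-funToFin (S i q) b)))

    colour-code : ∀ c b c′ φ j → colour c b c′ φ j code ≡ V c b c′ φ j
    colour-code c b c′ φ j = trans (cong (λ s → entry (proj₂ s) c b c′ φ j) rest-code) (entry-table V c b c′ φ j)

  module _ (K : Fin Q → Fin k → Fin Q → Fin 2 → Fin #Suffixes → Fin n → Colour) where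

    const : Const
    const = table λ c b c′ φ j → funToFin (K c b c′ φ j)

    constant-const : ∀ c b c′ φ j r → constant const c b c′ φ j r ≡ K c b c′ φ j r
    constant-const c b c′ φ j r =
      trans (cong (λ s → finToFun s r) (entry-table (λ c b c′ φ j → funToFin (K c b c′ φ j)) c b c′ φ j))
            (finToFun-funToFin (K c b c′ φ j) r)

  -- Indices 0 and 1: labels occurring at least once and twice up to the event; 2 and 3: from it on.
  Holds : Fin 4 → Code → Fin n → Fin k → Set
  Holds i s q b = bit s i q b ≡ suc zero

  holds? : ∀ i s q b → Dec (Holds i s q b)
  holds? i s q b = bit s i q b ≟ suc zero

  pair≟ : (x y : Fin n × Fin k) → Dec (x ≡ y)
  pair≟ = ≡-dec _≟_ _≟_

  module _ (i₁ i₂ : Fin 4) (p : Fin n) (s : Code) (nb₁ : Maybe Code) (nb₂ : Maybe (Fin n × Code))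
           (q : Fin n) (b : Fin k) where

    Labelled₁ Labelled₂ : Set
    Labelled₁ = On (λ d → (p , labelOf d) ≡ (q , b)) nb₁
    Labelled₂ = On (λ (r , d) → (r , labelOf d) ≡ (q , b)) nb₂

    -- The steps of `Recurrence`, rewritten over the codes of neighbours, which is all that a
    -- transition sees.
    OnceCode TwiceCode FarCode : Set
    OnceCode = (p , labelOf s) ≡ (q , b) ⊎
      On (λ d → Holds i₁ d q b) nb₁ ⊎ On (λ d → Holds i₁ (proj₂ d) q b) nb₂
    TwiceCode = On (λ d → Holds i₂ d q b) nb₁ ⊎ On (λ d → Holds i₂ (proj₂ d) q b) nb₂ ⊎
      ((p , labelOf s) ≡ (q , b) × On (λ d → Holds i₁ d q b) nb₁)
    FarCode = On (λ d → Holds i₂ d q b) nb₁ ⊎ On (λ d → Holds i₂ (proj₂ d) q b) nb₂ ⊎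
      ((On (λ d → Holds i₁ d q b) nb₁ ⊎ On (λ d → Holds i₁ (proj₂ d) q b) nb₂) × ¬ Labelled₁ × ¬ Labelled₂)

    SetsCode : Set
    SetsCode = (Holds i₁ s q b ⇔ OnceCode) × (Holds i₂ s q b ⇔ TwiceCode)

    private
      on₁? : ∀ i → Dec (On (λ d → Holds i d q b) nb₁)
      on₁? i = on? (λ d → holds? i d q b) nb₁
      on₂? : ∀ i → Dec (On (λ d → Holds i (proj₂ d) q b) nb₂)
      on₂? i = on? (λ d → holds? i (proj₂ d) q b) nb₂

    labelled₁? : Dec Labelled₁
    labelled₁? = on? (λ d → pair≟ _ _) nb₁

    labelled₂? : Dec Labelled₂
    labelled₂? = on? (λ d → pair≟ _ _) nb₂

    farCode? : Dec FarCode
    farCode? = on₁? i₂ ⊎-dec on₂? i₂ ⊎-dec ((on₁? i₁ ⊎-dec on₂? i₁) ×-dec ¬? labelled₁? ×-dec ¬? labelled₂?)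

    setsCode? : Dec SetsCode
    setsCode? = (holds? i₁ s q b ⇔-dec (pair≟ _ _ ⊎-dec on₁? i₁ ⊎-dec on₂? i₁))
      ×-dec (holds? i₂ s q b ⇔-dec (on₁? i₂ ⊎-dec on₂? i₂ ⊎-dec (pair≟ _ _ ×-dec on₁? i₁)))

  -- The recursion of `goPos` with colours for positions: the remaining route starts at the receive
  -- event if there is one here, and otherwise the search is left to the next event or to ∞.
  goTarget : Fin n → Fin n → (V₀ V₁ : Code → Colour) → Colour → Code → Maybe Code → Maybe (Fin n × Code) → Colour
  goTarget r s V₀ V₁ K₀ c nxt m with r ≟ s
  ... | yes _ = V₁ c
  ... | no _ with m
  ...   | nothing = Maybe.maybe′ V₀ K₀ nxt
  ...   | just (q , d) with q ≟ s
  ...     | yes _ = V₁ d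
  ...     | no _ = Maybe.maybe′ V₀ K₀ nxt

  backTarget : Fin k → (V₀ V₁ : Code → Colour) → Maybe Code → Colour
  backTarget b V₀ V₁ nothing = zero
  backTarget b V₀ V₁ (just d) with labelOf d ≟ b
  ... | yes _ = V₁ d
  ... | no _ = V₀ d

  target : Instr n k → Fin n → (V₀ V₁ : Code → Colour) → Colour → Maybe Code → Code → Maybe Code →
           Maybe (Fin n × Code) → Colour
  target (go s) r V₀ V₁ K₀ prv c nxt m = goTarget r s V₀ V₁ K₀ c nxt m
  target (back b) r V₀ V₁ K₀ prv c nxt m = backTarget b V₀ V₁ prv

  -- Governs the value at ∞: a hop from ∞ leads to ∞ on the other process, and a step back from ∞
  -- begins at the last event.
  lastTarget : Instr n k → Fin n → (V₀ V₁ : Code → Colour) → (Fin n → Colour) → Maybe Code → Colour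
  lastTarget (go s) r V₀ V₁ K₁ last = K₁ s
  lastTarget (back b) r V₀ V₁ K₁ last = backTarget b V₀ V₁ last

  -- V j is the colour at the end of the route with its first j instructions removed, K j its value at ∞.
  LocalEq : ∀ {m} → Vec (Instr n k) m → (Fin (suc m) → Code → Colour) → (Fin (suc m) → Fin n → Colour) →
            Fin n → Maybe Code → Code → Maybe Code → Maybe (Fin n × Code) → Set
  LocalEq [] V K p prv c nxt m = ⊤
  LocalEq (i ∷ is) V K p prv c nxt m =
    V zero c ≡ target i p (V zero) (V (suc zero)) (K zero p) prv c nxt m ×
    LocalEq is (V ∘ suc) (K ∘ suc) p prv c nxt m

  LastEq : ∀ {m} → Vec (Instr n k) m → (Fin (suc m) → Code → Colour) → (Fin (suc m) → Fin n → Colour) →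
           Fin n → Maybe Code → Set
  LastEq [] V K p last = ⊤
  LastEq (i ∷ is) V K p last =
    K zero p ≡ lastTarget i p (V zero) (V (suc zero)) (K (suc zero)) last × LastEq is (V ∘ suc) (K ∘ suc) p last

  localEq? : ∀ {m} (is : Vec (Instr n k) m) V K p prv c nxt m′ → Dec (LocalEq is V K p prv c nxt m′)
  localEq? [] V K p prv c nxt m = yes tt
  localEq? (i ∷ is) V K p prv c nxt m = (_ ≟ _) ×-dec localEq? is (V ∘ suc) (K ∘ suc) p prv c nxt m

  lastEq? : ∀ {m} (is : Vec (Instr n k) m) V K p last → Dec (LastEq is V K p last)
  lastEq? [] V K p last = yes tt
  lastEq? (i ∷ is) V K p last = (_ ≟ _) ×-dec lastEq? is (V ∘ suc) (K ∘ suc) p last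

  end-index : Fin #Suffixes
  end-index = fromℕ (n + suc n)

  -- The colour at the far end of the route, as guessed at its starting event, and the colour of that
  -- event itself. The flag φ is 0 for the rising and 1 for the falling blocks.
  seen own : Fin Q → Fin k → Fin Q → Fin 2 → Code → Colour
  seen c b c′ φ = colour c b c′ φ zero
  own c b c′ φ = colour c b c′ φ end-index

  ColourStep : Fin Q → Fin k → Fin Q → Fin 2 → Maybe Code → Colour → Set
  ColourStep c b c′ φ prv = Step₁ (Maybe.maybe′ (own c b c′ φ) zero prv)

  colourStep? : ∀ c b c′ φ prv col → Dec (ColourStep c b c′ φ prv col)
  colourStep? c b c′ φ prv = step₁? (Maybe.maybe′ (own c b c′ φ) zero prv)

  Escape : Fin Q → Fin k → Fin Q → Code → Set
  Escape c b c′ s = Later (own c b c′ zero s) (seen c b c′ zero s)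

  escape? : ∀ c b c′ s → Dec (Escape c b c′ s)
  escape? c b c′ s = later? (own c b c′ zero s) (seen c b c′ zero s)

  module _ (κ : Const) (c : Fin Q) (b : Fin k) (c′ : Fin Q) (p : Fin n) (s : Code) (nxt : Maybe Code) where

    nextOwn : Colour
    nextOwn = Maybe.maybe′ (own c b c′ (suc zero)) (constant κ c b c′ (suc zero) end-index p) nxt

    -- Holding at all events, the two `Near` conditions keep the differences of block numbers
    -- nonnegative. After that, `Later` proves e < h e in the rising colours and h e ≤ e in the
    -- falling ones, and the disjunction forces a verdict.
    LoopColours : Set
    LoopColours = Near (own c b c′ zero s) (seen c b c′ zero s) ×
                  Near (seen c b c′ (suc zero) s) nextOwn ×
                  (Escape c b c′ s ⊎ Later (seen c b c′ (suc zero) s) nextOwn)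

    loopColours? : Dec LoopColours
    loopColours? = near? (own c b c′ zero s) (seen c b c′ zero s) ×-dec near? (seen c b c′ (suc zero) s) nextOwn ×-dec
      (escape? c b c′ s ⊎-dec later? (seen c b c′ (suc zero) s) nextOwn)

  record Consistent (κ : Const) (p : Fin n) (a : Fin k) (prv : Maybe Code) (s : Code) (nxt : Maybe Code)
                    (m : Partner (Fin n × Code)) : Set where
    constructor mkConsistent
    field
      label-ok : labelOf s ≡ a
      past : ∀ q b → SetsCode zero (suc zero) p s prv (innOf m) q b
      future : ∀ q b → SetsCode (suc (suc zero)) (suc (suc (suc zero))) p s nxt (outOf m) q b
      local-eq : ∀ c b c′ φ → LocalEq (route c b c′) (colour c b c′ φ) (constant κ c b c′ φ) p prv s nxt (outOf m)
      colour-step : ∀ c b c′ φ → ColourStep c b c′ φ prv (own c b c′ φ s)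
      loop : ∀ c b c′ → dests (route c b c′) p ≡ p → LoopColours κ c b c′ p s nxt

  consistent? : ∀ κ p a prv s nxt m → Dec (Consistent κ p a prv s nxt m)
  consistent? κ p a prv s nxt m = map′
    (λ (x₁ , x₂ , x₃ , x₄ , x₅ , x₆) → mkConsistent x₁ x₂ x₃ x₄ x₅ x₆)
    (λ (mkConsistent x₁ x₂ x₃ x₄ x₅ x₆) → x₁ , x₂ , x₃ , x₄ , x₅ , x₆)
    (labelOf s ≟ a
     ×-dec (all? λ q → all? λ b → setsCode? zero (suc zero) p s prv (innOf m) q b)
     ×-dec (all? λ q → all? λ b → setsCode? (suc (suc zero)) (suc (suc (suc zero))) p s nxt (outOf m) q b)
     ×-dec (all? λ c → all? λ b → all? λ c′ → all? λ φ → localEq? (route c b c′) (colour c b c′ φ) (constant κ c b c′ φ) p prv s nxt (outOf m))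
     ×-dec (all? λ c → all? λ b → all? λ c′ → all? λ φ → colourStep? c b c′ φ prv (own c b c′ φ s))
     ×-dec (all? λ c → all? λ b → all? λ c′ → (_ ≟ _) →-dec loopColours? κ c b c′ p s nxt))

  Formula : Fin n → Fin k → Maybe Code → Code → Maybe Code → Partner (Fin n × Code) → Rel → Fin n → Fin k → Set
  Formula p a prv s nxt m r= q b = (p , a) ≡ (q , b)
  Formula p a prv s nxt m r→ q b = On (λ d → (p , labelOf d) ≡ (q , b)) nxt
  Formula p a prv s nxt m r⊲ q b = On (λ (r , d) → (r , labelOf d) ≡ (q , b)) (outOf m)
  Formula p a prv s nxt m r∥ q b = p ≢ q × ∀ c c′ → dests (gos {k = k} (hops c)) p ≡ q →
    dests (gos {k = k} (hops c′)) q ≡ p → Escape c b c′ s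
  Formula p a prv s nxt m r→⁻¹ q b = On (λ d → (p , labelOf d) ≡ (q , b)) prv
  Formula p a prv s nxt m r⊲⁻¹ q b = On (λ (r , d) → (r , labelOf d) ≡ (q , b)) (innOf m)
  Formula p a prv s nxt m r⊏ q b = FarCode (suc (suc zero)) (suc (suc (suc zero))) p s nxt (outOf m) q b
  Formula p a prv s nxt m r⊏⁻¹ q b = FarCode zero (suc zero) p s prv (innOf m) q b

  formula? : ∀ p a prv s nxt m r q b → Dec (Formula p a prv s nxt m r q b)
  formula? p a prv s nxt m r= q b = pair≟ _ _
  formula? p a prv s nxt m r→ q b = on? (λ d → pair≟ _ _) nxt
  formula? p a prv s nxt m r⊲ q b = on? (λ d → pair≟ _ _) (outOf m)
  formula? p a prv s nxt m r∥ q b = ¬? (p ≟ q) ×-dec all? λ c → all? λ c′ → (_ ≟ _) →-dec (_ ≟ _) →-dec escape? c b c′ s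
  formula? p a prv s nxt m r→⁻¹ q b = on? (λ d → pair≟ _ _) prv
  formula? p a prv s nxt m r⊲⁻¹ q b = on? (λ d → pair≟ _ _) (innOf m)
  formula? p a prv s nxt m r⊏ q b = farCode? (suc (suc zero)) (suc (suc (suc zero))) p s nxt (outOf m) q b
  formula? p a prv s nxt m r⊏⁻¹ q b = farCode? zero (suc zero) p s prv (innOf m) q b

  allRel? : ∀ {P : Rel → Set} → (∀ r → Dec (P r)) → Dec (∀ r → P r)
  allRel? P? = map′
    (λ { (x₁ , x₂ , x₃ , x₄ , x₅ , x₆ , x₇ , x₈) → λ
       { r= → x₁ ; r→ → x₂ ; r⊲ → x₃ ; r∥ → x₄ ; r→⁻¹ → x₅ ; r⊲⁻¹ → x₆ ; r⊏ → x₇ ; r⊏⁻¹ → x₈ } })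
    (λ h → h r= , h r→ , h r⊲ , h r∥ , h r→⁻¹ , h r⊲⁻¹ , h r⊏ , h r⊏⁻¹)
    (P? r= ×-dec P? r→ ×-dec P? r⊲ ×-dec P? r∥ ×-dec P? r→⁻¹ ×-dec P? r⊲⁻¹ ×-dec P? r⊏ ×-dec P? r⊏⁻¹)

  -- Consistency does not mention the annotation γ. Thus a consistent labelling can be built for any
  -- MSC, and as the formulas express the true types in every such labelling, γ is accepted exactly
  -- if it agrees with them.
  Φ : Const → Fin n → Fin k × Types n k → Maybe Code → Code → Maybe Code → Partner (Fin n × Code) → Set
  Φ κ p (a , γ) prv s nxt m = Consistent κ p a prv s nxt m ×
    ∀ r q b → (γ r q b ≡ true) ⇔ Formula p a prv s nxt m r q b

  Φ? : ∀ κ p a prv s nxt m → Dec (Φ κ p a prv s nxt m)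
  Φ? κ p (a , γ) prv s nxt m = consistent? κ p a prv s nxt m ×-dec
    allRel? λ r → all? λ q → all? λ b → (γ r q b Bool.≟ true) ⇔-dec formula? p a prv s nxt m r q b

  Ψ : Const → Fin n → Maybe Code → Set
  Ψ κ p last = ∀ c b c′ φ → LastEq (route c b c′) (colour c b c′ φ) (constant κ c b c′ φ) p last ×
    ColourStep c b c′ φ last (constant κ c b c′ φ end-index p)

  Ψ? : ∀ κ p last → Dec (Ψ κ p last)
  Ψ? κ p last = all? λ c → all? λ b → all? λ c′ → all? λ φ → 
    lastEq? (route c b c′) (colour c b c′ φ) (constant κ c b c′ φ) p last ×-dec
    colourStep? c b c′ φ last (constant κ c b c′ φ end-index p)

-- Transport of colours along routes

module Verification {n k : ℕ} (N : MSC n (Fin k × Types n k)) where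

  open Codes n k
  open Order N
  open Paths N proj₁
  open Automaton #Code #Const Φ Φ? Ψ Ψ? using (prevLab; nextLab; withProcess; Labelling)
  open Equivalence

  labelᴱ : Event w → Fin n × Fin k
  labelᴱ = label proj₁ _≟_

  module P = Past proj₁ _≟_
  module F′ = Future proj₁ _≟_

  module Values (lab : Event w → Code) (label-ok : ∀ e → labelOf (lab e) ≡ proj₁ (letter w e)) where

    partnerLab : Event w → Partner (Fin n × Code)
    partnerLab e = mapPartner (withProcess N lab) (partner N e)

    -- Extends the colours from events to all positions, with colour `zero` at -∞ and the guessed
    -- constant from ∞ on, so that equations along moves need no exceptions.
    val : (Code → Colour) → (Fin n → Colour) → Fin n → ℕ → Colour
    val V K r zero = zero
    val V K r x@(suc _) = Maybe.maybe′ V (K r) (Maybe.map lab (at w r x))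

    val-event : ∀ V K r i → val V K r (suc (toℕ i)) ≡ V (lab (r , i))
    val-event V K r i = cong (Maybe.maybe′ V (K r) ∘ Maybe.map lab) (at-event w r i)

    val-top : ∀ V K r {x} → ℓ r < x → val V K r x ≡ K r
    val-top V K r {suc x} ℓ<x = cong (Maybe.maybe′ V (K r) ∘ Maybe.map lab) (at-top w r ℓ<x)

    val-before : ∀ V K r x → x ≤ ℓ r → Maybe.maybe′ V zero (Maybe.map lab (at w r x)) ≡ val V K r x
    val-before V K r x x≤ with view (ℓ r) x
    ... | bot = refl
    ... | ev i = trans (cong (Maybe.maybe′ V zero ∘ Maybe.map lab) (at-event w r i)) (sym (val-event V K r i))
    ... | top ℓ<x = contradiction x≤ (<⇒≱ ℓ<x)

    module _ (V₀ V₁ : Code → Colour) (K₀ K₁ : Fin n → Colour) where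

      private
        val₀ val₁ : Fin n → ℕ → Colour
        val₀ = val V₀ K₀
        val₁ = val V₁ K₁

      goTarget-stay : ∀ {r s} → r ≡ s → ∀ j →
        goTarget r s V₀ V₁ (K₀ r) (lab (r , j)) (nextLab N lab (r , j)) (outOf (partnerLab (r , j))) ≡ V₁ (lab (r , j))
      goTarget-stay {r} {s} r≡s j with r ≟ s
      ... | yes _ = refl
      ... | no r≢s = contradiction r≡s r≢s

      goTarget-leave : ∀ r s i → r ≢ s →
        goTarget r s V₀ V₁ (K₀ r) (lab (r , i)) (nextLab N lab (r , i)) (outOf (partnerLab (r , i))) ≡
        Maybe.maybe′ (val₁ s) (val₀ r (2 + toℕ i)) (receipt s (r , i))
      goTarget-leave r s i r≢s with r ≟ s
      ... | yes r≡s = contradiction r≡s r≢s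
      ... | no _ rewrite outOf-map (withProcess N lab) (partner N (r , i)) with outEvent (r , i)
      ...   | nothing = refl
      ...   | just (q , j) with q ≟ s
      ...     | yes refl = sym (val-event V₁ K₁ s j)
      ...     | no _ = refl

      goPos-val : ∀ r s i → val₀ r (2 + toℕ i) ≡ val₁ s (goPos r s (2 + toℕ i)) →
        Maybe.maybe′ (val₁ s) (val₀ r (2 + toℕ i)) (receipt s (r , i)) ≡ val₁ s (goPos r s (suc (toℕ i)))
      goPos-val r s i ih = trans go-maybe (cong (val₁ s) (sym (goPos-event r s i)))
        where
        go-maybe : Maybe.maybe′ (val₁ s) (val₀ r (2 + toℕ i)) (receipt s (r , i)) ≡
                   val₁ s (Maybe.maybe′ (λ y → y) (goPos r s (2 + toℕ i)) (receipt s (r , i)))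
        go-maybe with receipt s (r , i)
        ... | nothing = ih
        ... | just _ = refl

      backTarget-val : ∀ b r y → y ≤ ℓ r → val₀ r y ≡ val₁ r (backPos r b y) →
        backTarget b V₀ V₁ (Maybe.map lab (at w r y)) ≡ val₁ r (backPos r b (suc y))
      backTarget-val b r y y≤ ih with view (ℓ r) y
      ... | top ℓ<y = contradiction y≤ (<⇒≱ ℓ<y)
      ... | bot = refl
      ... | ev j = trans (cong (backTarget b V₀ V₁ ∘ Maybe.map lab) (at-event w r j)) (split (labelOf (lab (r , j)) ≟ b))
        where
        split : Dec (labelOf (lab (r , j)) ≡ b) → backTarget b V₀ V₁ (just (lab (r , j))) ≡ val₁ r (backPos r b (2 + toℕ j))
        split _ with labelOf (lab (r , j)) ≟ b
        ... | yes eq = trans (sym (val-event V₁ K₁ r j))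
            (cong (val₁ r) (sym (backPos-event j (trans (sym (label-ok (r , j))) eq))))
        ... | no ≢b = trans (sym (val-event V₀ K₀ r j)) (trans ih
            (cong (val₁ r) (sym (backPos-skip j (≢b ∘ trans (label-ok (r , j)))))))

      module _ (i : Instr n k)
        (local : ∀ r j → V₀ (lab (r , j)) ≡ target i r V₀ V₁ (K₀ r) (prevLab N lab (r , j)) (lab (r , j))
                   (nextLab N lab (r , j)) (outOf (partnerLab (r , j))))
        (final : ∀ r → K₀ r ≡ lastTarget i r V₀ V₁ K₁ (Maybe.map lab (at w r (ℓ r)))) where

        -- A hop looks ahead, so its induction runs down from ∞; a step back looks behind, so its
        -- induction runs up from -∞.
        val-move : ∀ r x → val₀ r x ≡ val₁ (dest i r) (move i r x)
        val-move = dispatch i refl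
          where
          leave : ∀ {s} r → i ≡ go s → r ≢ s → ∀ d x → suc (ℓ r) ≤ d + x → val₀ r x ≡ val₁ s (goPos r s x)
          leave {s} r refl r≢s d x le with view (ℓ r) x
          ... | bot = refl
          ... | top ℓ<x = trans (val-top V₀ K₀ r ℓ<x) (trans (final r)
              (trans (sym (val-top V₁ K₁ s ≤-refl)) (cong (val₁ s) (sym (goPos-top r s ℓ<x)))))
          leave {s} r refl r≢s zero _ le | ev j = contradiction le (<⇒≱ (s≤s (toℕ<n j)))
          leave {s} r refl r≢s (suc d) _ le | ev j =
            trans (val-event V₀ K₀ r j) (trans (local r j) (trans (goTarget-leave r s j r≢s)
              (goPos-val r s j (leave r refl r≢s d (2 + toℕ j) (subst (suc (ℓ r) ≤_) (sym (+-suc d _)) le)))))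
          go-case : ∀ s → i ≡ go s → ∀ r x → val₀ r x ≡ val₁ s (move (go s) r x)
          go-case s i≡ r x with r ≟ s
          ... | no r≢s = leave r i≡ r≢s (suc (ℓ r)) x (m≤m+n (suc (ℓ r)) x)
          go-case s refl r x | yes refl with view (ℓ r) x
          ... | bot = refl
          ... | ev j = trans (val-event V₀ K₀ r j) (trans (local r j) 
                (trans (goTarget-stay refl j) (sym (val-event V₁ K₁ r j))))
          ... | top ℓ<x = trans (val-top V₀ K₀ r ℓ<x) (trans (final r) (sym (val-top V₁ K₁ r ℓ<x)))
          back-suc : ∀ b → i ≡ back b → ∀ r y {x} → View (ℓ r) x → x ≡ suc y →
                     val₀ r y ≡ val₁ r (backPos r b y) → val₀ r x ≡ val₁ r (backPos r b x)
          back-suc b refl r y (ev j) refl ih = trans (val-event V₀ K₀ r j) (trans (local r j)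
            (backTarget-val b r (toℕ j) (<⇒≤ (toℕ<n j)) ih))
          back-suc b refl r y (top ℓ<x) refl ih with m≤n⇒m<n∨m≡n ℓ<x
          ... | inj₁ (s≤s ℓ<y) = trans (val-top V₀ K₀ r ℓ<x) (trans (sym (val-top V₀ K₀ r ℓ<y))
                (trans ih (cong (val₁ r) (sym (backPos-top ℓ<y)))))
          ... | inj₂ refl = trans (val-top V₀ K₀ r ℓ<x) (trans (final r) (backTarget-val b r y ≤-refl ih))
          back-case : ∀ b → i ≡ back b → ∀ r x → val₀ r x ≡ val₁ r (backPos r b x)
          back-case b i≡ r zero = refl
          back-case b i≡ r (suc y) = back-suc b i≡ r y (view (ℓ r) (suc y)) refl (back-case b i≡ r y)
          dispatch : ∀ i′ → i ≡ i′ → ∀ r x → val₀ r x ≡ val₁ (dest i′ r) (move i′ r x)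
          dispatch (go s) i≡ = go-case s i≡
          dispatch (back b) i≡ = back-case b i≡

      -- The converse of `val-move`. Positions are limited by ∞, because `val` is constant from
      -- there on, whereas actual block numbers may go on growing.
      module _ (i : Instr n k)
        (along : ∀ r x → x ≤ suc (ℓ r) → val₀ r x ≡ val₁ (dest i r) (move i r x)) where

        local-target : ∀ r j → V₀ (lab (r , j)) ≡ target i r V₀ V₁ (K₀ r) (prevLab N lab (r , j)) (lab (r , j))
                         (nextLab N lab (r , j)) (outOf (partnerLab (r , j)))
        local-target r j = trans (sym (val-event V₀ K₀ r j))
          (trans (along r (suc (toℕ j)) (s≤s (<⇒≤ (toℕ<n j)))) (dispatch i refl))
          where
          go-case : ∀ s → i ≡ go s → val₁ s (move (go s) r (suc (toℕ j))) ≡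
                    goTarget r s V₀ V₁ (K₀ r) (lab (r , j)) (nextLab N lab (r , j)) (outOf (partnerLab (r , j)))
          go-case s refl with r ≟ s | along r (2 + toℕ j) (s≤s (toℕ<n j)) | goTarget-leave r s j | goTarget-stay {r} {s}
          ... | yes refl | _ | _ | stay-here = trans (val-event V₁ K₁ r j) (sym (stay-here refl j))
          ... | no r≢s | ih | leaves | _ = trans (sym (goPos-val r s j ih)) (sym (leaves r≢s))
          dispatch : ∀ i′ → i ≡ i′ → val₁ (dest i′ r) (move i′ r (suc (toℕ j))) ≡
            target i′ r V₀ V₁ (K₀ r) (prevLab N lab (r , j)) (lab (r , j)) (nextLab N lab (r , j)) (outOf (partnerLab (r , j)))
          dispatch (go s) i≡ = go-case s i≡
          dispatch (back b) refl = sym (backTarget-val b r (toℕ j) (<⇒≤ (toℕ<n j)) (along r (toℕ j) (m≤n⇒m≤1+n (<⇒≤ (toℕ<n j)))))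

        last-target : ∀ r → K₀ r ≡ lastTarget i r V₀ V₁ K₁ (Maybe.map lab (at w r (ℓ r)))
        last-target r = trans (sym (val-top V₀ K₀ r ≤-refl)) (trans (along r (suc (ℓ r)) ≤-refl) (dispatch i refl))
          where
          go-case : ∀ s → val₁ s (move (go s) r (suc (ℓ r))) ≡ K₁ s
          go-case s with r ≟ s
          ... | yes refl = val-top V₁ K₁ r ≤-refl
          ... | no _ = trans (cong (val₁ s) (goPos-top r s ≤-refl)) (val-top V₁ K₁ s ≤-refl)
          dispatch : ∀ i′ → i ≡ i′ → val₁ (dest i′ r) (move i′ r (suc (ℓ r))) ≡ lastTarget i′ r V₀ V₁ K₁ (Maybe.map lab (at w r (ℓ r)))
          dispatch (go s) _ = go-case s
          dispatch (back b) refl = sym (backTarget-val b r (ℓ r) ≤-refl (along r (ℓ r) (n≤1+n _)))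

    LocalEqs LastEqs : ∀ {m} → Vec (Instr n k) m → (Fin (suc m) → Code → Colour) → (Fin (suc m) → Fin n → Colour) → Set
    LocalEqs is V K = ∀ e → LocalEq is V K (proj₁ e) (prevLab N lab e) (lab e) (nextLab N lab e) (outOf (partnerLab e))
    LastEqs is V K = ∀ r → LastEq is V K r (Maybe.map lab (at w r (ℓ r)))

    val-moves : ∀ {m} (is : Vec (Instr n k) m) V K → LocalEqs is V K → LastEqs is V K → ∀ r x →
                val (V zero) (K zero) r x ≡ val (V (fromℕ m)) (K (fromℕ m)) (dests is r) (moves is r x)
    val-moves [] V K local final r x = refl
    val-moves (i ∷ is) V K local final r x = trans
      (val-move (V zero) (V (suc zero)) (K zero) (K (suc zero)) i (λ r j → proj₁ (local (r , j))) (λ r → proj₁ (final r)) r x)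
      (val-moves is (V ∘ suc) (K ∘ suc) (λ e → proj₂ (local e)) (λ r → proj₂ (final r)) (dest i r) (move i r x))

  -- The intended guesses: j instructions have been removed, and g is the colouring of the positions
  -- at the end of the rest.
  along : ∀ {m} → Vec (Instr n k) m → Fin (suc m) → (Fin n → ℕ → Colour) → Fin n → ℕ → Colour
  along is zero g r x = g (dests is r) (moves is r x)
  along (i ∷ is) (suc j) g = along is j g

  along-end : ∀ {m} (is : Vec (Instr n k) m) g r x → along is (fromℕ m) g r x ≡ g r x
  along-end [] g r x = refl
  along-end (i ∷ is) g = along-end is g

  along-0 : ∀ {m} (is : Vec (Instr n k) m) j g r → (∀ r → g r 0 ≡ zero) → along is j g r 0 ≡ zero
  along-0 is zero g r g-0 = trans (cong (g (dests is r)) (moves-0 is r)) (g-0 _)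
  along-0 (i ∷ is) (suc j) g r g-0 = along-0 is j g r g-0

  module _ (lab : Event w → Code) (label-ok : ∀ e → labelOf (lab e) ≡ proj₁ (letter w e)) where
    open Values lab label-ok

    equations-along : ∀ {m} (is : Vec (Instr n k) m) V K g →
      (∀ j r x → x ≤ suc (ℓ r) → val (V j) (K j) r x ≡ along is j g r x) → LocalEqs is V K × LastEqs is V K
    equations-along [] V K g h = (λ _ → tt) , (λ _ → tt)
    equations-along (i ∷ is) V K g h =
      (λ (r , j) → local-target (V zero) (V (suc zero)) (K zero) (K (suc zero)) i head r j , proj₁ ih (r , j)) ,
      (λ r → last-target (V zero) (V (suc zero)) (K zero) (K (suc zero)) i head r , proj₂ ih r)
      where
      ih : LocalEqs is (V ∘ suc) (K ∘ suc) × LastEqs is (V ∘ suc) (K ∘ suc)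
      ih = equations-along is (V ∘ suc) (K ∘ suc) g (h ∘ suc)
      head : ∀ r x → x ≤ suc (ℓ r) → val (V zero) (K zero) r x ≡ val (V (suc zero)) (K (suc zero)) (dest i r) (move i r x)
      head r x x≤ = trans (h zero r x x≤) (sym (h (suc zero) (dest i r) (move i r x) (move-≤ i r x≤)))

-- Consistent labellings determine the types

adv-0 : ∀ c → Adv 0 c c
adv-0 c = sym (trans (cong (_% 4) (+-identityʳ (toℕ c))) (m<n⇒m%n≡m (toℕ<n c)))

≡⇒⇔ : ∀ {P Q : Set} → P ≡ Q → P ⇔ Q
≡⇒⇔ refl = mk⇔ (λ x → x) (λ x → x)

_⇔∘_ : ∀ {P Q R : Set} → P ⇔ Q → Q ⇔ R → P ⇔ R
p ⇔∘ q = mk⇔ (Equivalence.to q ∘ Equivalence.to p) (Equivalence.from p ∘ Equivalence.from q)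

⇔-flip : ∀ {P Q : Set} → P ⇔ Q → Q ⇔ P
⇔-flip p = mk⇔ (Equivalence.from p) (Equivalence.to p)

module Correctness {n k : ℕ} (N : MSC n (Fin k × Types n k)) where

  open Codes n k
  open Order N
  open Paths N proj₁
  open Verification N
  open Automaton #Code #Const Φ Φ? Ψ Ψ? using (prevLab; nextLab; withProcess; Labelling)
  open Equivalence

  -- Identifies conditions over codes with the recurrences over events, once for the past and once
  -- for the future.
  module Neighbours (lab : Event w → Code) (label-ok : ∀ e → labelOf (lab e) ≡ proj₁ (letter w e))
    (i₁ i₂ : Fin 4) (nb₁ nb₂ : Event w → Maybe (Event w))
    (nb₁-process : ∀ {g} e → nb₁ e ≡ just g → proj₁ g ≡ proj₁ e) where

    module R = Recurrence labelᴱ nb₁ nb₂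

    Set₁ᴱ Set₂ᴱ : Event w → Fin n × Fin k → Set
    Set₁ᴱ e (q , b) = Holds i₁ (lab e) q b
    Set₂ᴱ e (q , b) = Holds i₂ (lab e) q b

    module _ (e : Event w) (q : Fin n) (b : Fin k) where

      chain≡ : ∀ i → On (λ d → Holds i d q b) (Maybe.map lab (nb₁ e)) ≡ On (λ g → Holds i (lab g) q b) (nb₁ e)
      chain≡ i = on-map (λ d → Holds i d q b) lab (nb₁ e)

      msg≡ : ∀ i → On (λ d → Holds i (proj₂ d) q b) (Maybe.map (withProcess N lab) (nb₂ e)) ≡ On (λ g → Holds i (lab g) q b) (nb₂ e)
      msg≡ i = on-map (λ d → Holds i (proj₂ d) q b) (withProcess N lab) (nb₂ e)

      self≡ : ((proj₁ e , labelOf (lab e)) ≡ (q , b)) ≡ (labelᴱ e ≡ (q , b))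
      self≡ = cong (λ a → (proj₁ e , a) ≡ (q , b)) (label-ok e)

      labelled₁≡ : On (λ d → (proj₁ e , labelOf d) ≡ (q , b)) (Maybe.map lab (nb₁ e)) ≡ On (λ g → labelᴱ g ≡ (q , b)) (nb₁ e)
      labelled₁≡ with nb₁ e in eq
      ... | nothing = refl
      ... | just g = cong₂ (λ r a → (r , a) ≡ (q , b)) (sym (nb₁-process e eq)) (label-ok g)

      labelled₂≡ : On (λ (r , d) → (r , labelOf d) ≡ (q , b)) (Maybe.map (withProcess N lab) (nb₂ e)) ≡ On (λ g → labelᴱ g ≡ (q , b)) (nb₂ e)
      labelled₂≡ with nb₂ e
      ... | nothing = refl
      ... | just g = cong (λ a → (proj₁ g , a) ≡ (q , b)) (label-ok g)

      once≡ : OnceCode i₁ i₂ (proj₁ e) (lab e) (Maybe.map lab (nb₁ e))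
        (Maybe.map (withProcess N lab) (nb₂ e)) q b ≡ R.OnceStep Set₁ᴱ e (q , b)
      once≡ = cong₂ _⊎_ self≡ (cong₂ _⊎_ (chain≡ i₁) (msg≡ i₁))

      twice≡ : TwiceCode i₁ i₂ (proj₁ e) (lab e) (Maybe.map lab (nb₁ e))
        (Maybe.map (withProcess N lab) (nb₂ e)) q b ≡ R.TwiceStep Set₁ᴱ Set₂ᴱ e (q , b)
      twice≡ = cong₂ _⊎_ (chain≡ i₂) (cong₂ _⊎_ (msg≡ i₂) (cong₂ _×_ self≡ (chain≡ i₁)))

      far≡ : FarCode i₁ i₂ (proj₁ e) (lab e) (Maybe.map lab (nb₁ e))
        (Maybe.map (withProcess N lab) (nb₂ e)) q b ≡ R.FarStep Set₁ᴱ Set₂ᴱ e (q , b)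
      far≡ = cong₂ _⊎_ (chain≡ i₂) (cong₂ _⊎_ (msg≡ i₂)
        (cong₂ _×_ (cong₂ _⊎_ (chain≡ i₁) (msg≡ i₁)) (cong₂ _×_ (cong ¬_ labelled₁≡) (cong ¬_ labelled₂≡))))

      adjacent : ∀ {R : Event w → Set} (nb : Event w → Maybe (Event w)) → (∀ g → nb e ≡ just g ⇔ R g) →
        On (λ g → labelᴱ g ≡ (q , b)) (nb e) ⇔ (∃ λ f → R f × proj₁ f ≡ q × proj₁ (letter w f) ≡ b)
      adjacent {R} nb nb⇔R = mk⇔ there back-again
        where
        there : On (λ g → labelᴱ g ≡ (q , b)) (nb e) → ∃ λ f → R f × proj₁ f ≡ q × proj₁ (letter w f) ≡ b
        there o with on-elim (nb e) o
        ... | g , eq , refl = g , to (nb⇔R g) eq , refl , refl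
        back-again : (∃ λ f → R f × proj₁ f ≡ q × proj₁ (letter w f) ≡ b) → On (λ g → labelᴱ g ≡ (q , b)) (nb e)
        back-again (f , r , refl , refl) = on-intro (λ g → labelᴱ g ≡ (q , b)) (from (nb⇔R f) r) refl

  prev-process : ∀ {g} e → prevEvent w e ≡ just g → proj₁ g ≡ proj₁ e
  prev-process {g} e eq = Next-process proj₁ _≟_ (to (prev⇔Next w e g) eq)

  next-process : ∀ {g} e → nextEvent w e ≡ just g → proj₁ g ≡ proj₁ e
  next-process {g} e eq = sym (Next-process proj₁ _≟_ (to (next⇔Next w e g) eq))

  pattern 2F = suc (suc zero)
  pattern 3F = suc (suc (suc zero))

  module PastSets (lab : Event w → Code) (label-ok : ∀ e → labelOf (lab e) ≡ proj₁ (letter w e)) =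
    Neighbours lab label-ok zero (suc zero) (prevEvent w) innEvent prev-process
  module FutureSets (lab : Event w → Code) (label-ok : ∀ e → labelOf (lab e) ≡ proj₁ (letter w e)) =
    Neighbours lab label-ok 2F 3F (nextEvent w) outEvent next-process

  module Sound (κ : Const) (lab : Event w → Code)
    (consistent : ∀ e → Consistent κ (proj₁ e) (proj₁ (letter w e)) (prevLab N lab e) (lab e) (nextLab N lab e)
                          (mapPartner (withProcess N lab) (partner N e)))
    (final : ∀ p → Ψ κ p (Maybe.map lab (at w p (length (w p))))) where

    open Consistent

    label-ok′ : ∀ e → labelOf (lab e) ≡ proj₁ (letter w e)
    label-ok′ e = label-ok (consistent e)

    open Values lab label-ok′
    module PS = PastSets lab label-ok′
    module FS = FutureSets lab label-ok′

    inn≡ : ∀ e → innOf (partnerLab e) ≡ Maybe.map (withProcess N lab) (innEvent e)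
    inn≡ e = innOf-map (withProcess N lab) (partner N e)

    out≡ : ∀ e → outOf (partnerLab e) ≡ Maybe.map (withProcess N lab) (outEvent e)
    out≡ e = outOf-map (withProcess N lab) (partner N e)

    past-sets : ∀ e q b → SetsCode zero (suc zero) (proj₁ e) (lab e) (prevLab N lab e)
                            (Maybe.map (withProcess N lab) (innEvent e)) q b
    past-sets e q b = subst (λ m → SetsCode zero (suc zero) (proj₁ e) (lab e) (prevLab N lab e) m q b) (inn≡ e)
      (past (consistent e) q b)

    future-sets : ∀ e q b → SetsCode 2F 3F (proj₁ e) (lab e) (nextLab N lab e)
                            (Maybe.map (withProcess N lab) (outEvent e)) q b
    future-sets e q b = subst (λ m → SetsCode 2F 3F (proj₁ e) (lab e) (nextLab N lab e) m q b) (out≡ e)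
      (future (consistent e) q b)

    past-far : ∀ e q b → FarCode zero (suc zero) (proj₁ e) (lab e) (prevLab N lab e) (innOf (partnerLab e)) q b ⇔ P.Far e (q , b)
    past-far e q b =
      ≡⇒⇔ (cong (λ m → FarCode zero (suc zero) (proj₁ e) (lab e) (prevLab N lab e) m q b) (inn≡ e))
      ⇔∘ (≡⇒⇔ (PS.far≡ e q b) ⇔∘ P.far-unique {S = PS.Set₁ᴱ} {T = PS.Set₂ᴱ}
        (λ e → proj₁ (past-sets e q b) ⇔∘ ≡⇒⇔ (PS.once≡ e q b))
        (λ e → proj₂ (past-sets e q b) ⇔∘ ≡⇒⇔ (PS.twice≡ e q b)) e)

    future-far : ∀ e q b → FarCode 2F 3F (proj₁ e) (lab e) (nextLab N lab e) (outOf (partnerLab e)) q b ⇔ F′.Far e (q , b)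
    future-far e q b =
      ≡⇒⇔ (cong (λ m → FarCode 2F 3F (proj₁ e) (lab e) (nextLab N lab e) m q b) (out≡ e))
      ⇔∘ (≡⇒⇔ (FS.far≡ e q b) ⇔∘ F′.far-unique {S = FS.Set₁ᴱ} {T = FS.Set₂ᴱ}
        (λ e → proj₁ (future-sets e q b) ⇔∘ ≡⇒⇔ (FS.once≡ e q b))
        (λ e → proj₂ (future-sets e q b) ⇔∘ ≡⇒⇔ (FS.twice≡ e q b)) e)

    module Loop (c : Fin Q) (b : Fin k) (c′ : Fin Q) (p : Fin n) (loops : dests (route c b c′) p ≡ p) where

      h : ℕ → ℕ
      h = moves (route c b c′) p

      h-mono : ∀ {x y} → x ≤ y → h x ≤ h y
      h-mono = moves-mono (route c b c′) p

      col : Fin 2 → ℕ → Colour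
      col φ = val (own c b c′ φ) (constant κ c b c′ φ end-index) p

      col-top : ∀ φ x → ℓ p < x → col φ x ≡ constant κ c b c′ φ end-index p
      col-top φ x = val-top (own c b c′ φ) (constant κ c b c′ φ end-index) p

      col-step : ∀ φ x → Step₁ (col φ x) (col φ (suc x))
      col-step φ x = along-view x (view (ℓ p) (suc x)) refl
        where
        before : ∀ x → x ≤ ℓ p → Maybe.maybe′ (own c b c′ φ) zero (Maybe.map lab (at w p x)) ≡ col φ x
        before = val-before (own c b c′ φ) (constant κ c b c′ φ end-index) p
        along-view : ∀ x {y} → View (ℓ p) y → y ≡ suc x → Step₁ (col φ x) (col φ y)
        along-view x (ev i) refl = subst₂ Step₁ (before x (<⇒≤ (toℕ<n i))) (sym (val-event _ (constant κ c b c′ φ end-index) p i))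
          (colour-step (consistent (p , i)) c b c′ φ)
        along-view x (top ℓ<y) refl with m≤n⇒m<n∨m≡n ℓ<y
        ... | inj₂ refl = subst₂ Step₁ (before x ≤-refl) (sym (col-top φ (suc x) ≤-refl)) (proj₂ (final p c b c′ φ))
        ... | inj₁ (s≤s ℓ<x) = inj₁ (subst (Adv 0 (col φ x)) (trans (col-top φ x ℓ<x) (sym (col-top φ (suc x) ℓ<y))) (adv-0 (col φ x)))

      module L φ = Lift (col φ) refl (col-step φ)

      -- Transport over the whole route; as the route returns to p, both ends are coloured by the
      -- same division.
      seen≡ : ∀ φ i → seen c b c′ φ (lab (p , i)) ≡ col φ (h (suc (toℕ i)))
      seen≡ φ i = trans (sym (val-event (colour c b c′ φ zero) (constant κ c b c′ φ zero) p i))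
        (trans (val-moves (route c b c′) (colour c b c′ φ) (constant κ c b c′ φ)
                 (λ e → local-eq (consistent e) c b c′ φ) (λ r → proj₁ (final r c b c′ φ)) p (suc (toℕ i)))
               (cong (λ r → val (own c b c′ φ) (constant κ c b c′ φ end-index) r (h (suc (toℕ i)))) loops))

      own≡ : ∀ φ i → own c b c′ φ (lab (p , i)) ≡ col φ (suc (toℕ i))
      own≡ φ i = sym (val-event (own c b c′ φ) (constant κ c b c′ φ end-index) p i)

      loopColours : ∀ i → LoopColours κ c b c′ p (lab (p , i)) (nextLab N lab (p , i))
      loopColours i = loop (consistent (p , i)) c b c′ loops

      rising-near : ∀ x → 1 ≤ x → x ≤ ℓ p → Near (col zero x) (col zero (h x))
      rising-near x 1≤x x≤ℓ with view (ℓ p) x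
      ... | ev i = subst₂ Near (own≡ zero i) (seen≡ zero i) (proj₁ (loopColours i))
      ... | top ℓ<x = contradiction x≤ℓ (<⇒≱ ℓ<x)

      falling-near : ∀ x → 1 ≤ x → x ≤ ℓ p → Near (col (suc zero) (h x)) (col (suc zero) (suc x))
      falling-near x 1≤x x≤ℓ with view (ℓ p) x
      ... | ev i = subst (λ d → Near d _) (seen≡ (suc zero) i) (proj₁ (proj₂ (loopColours i)))
      ... | top ℓ<x = contradiction x≤ℓ (<⇒≱ ℓ<x)

      escape⇒ : ∀ i → Escape c b c′ (lab (p , i)) → suc (toℕ i) < h (suc (toℕ i))
      escape⇒ i esc = L.later-lift zero (subst₂ Later (own≡ zero i) (seen≡ zero i) esc)
        (L.rising-≤ zero (ℓ p) h h-mono rising-near (suc (toℕ i)) (s≤s z≤n) (toℕ<n i))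

      -- Otherwise the falling colours would show `Later`, which puts `h e` strictly before the
      -- successor of e.
      ⇒escape : ∀ i → suc (toℕ i) < h (suc (toℕ i)) → Escape c b c′ (lab (p , i))
      ⇒escape i lt with proj₂ (proj₂ (loopColours i))
      ... | inj₁ esc = esc
      ... | inj₂ later = contradiction lt (≤⇒≯ (≤-pred (L.later-lift (suc zero)
          (subst (λ d → Later d _) (seen≡ (suc zero) i) later)
          (L.falling-≤ (suc zero) (ℓ p) h h-mono
            (L.blk-∞ (suc zero) (ℓ p) λ x ℓ<x → trans (col-top (suc zero) x ℓ<x) (sym (col-top (suc zero) (suc (ℓ p)) ≤-refl)))
            falling-near (suc (toℕ i)) (s≤s z≤n) (toℕ<n i)))))

    formula-correct : ∀ e r q b →
      Formula (proj₁ e) (proj₁ (letter w e)) (prevLab N lab e) (lab e) (nextLab N lab e) (partnerLab e) r q b ⇔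
      (∃ λ f → RelHolds N r e f × proj₁ f ≡ q × proj₁ (letter w f) ≡ b)
    formula-correct e r= q b = mk⇔ (λ { refl → e , refl , refl , refl }) (λ { (_ , refl , refl , refl) → refl })
    formula-correct e r→ q b = ≡⇒⇔ (FS.labelled₁≡ e q b) ⇔∘ FS.adjacent e q b (nextEvent w) (next⇔Next w e)
    formula-correct e r→⁻¹ q b = ≡⇒⇔ (PS.labelled₁≡ e q b) ⇔∘ PS.adjacent e q b (prevEvent w) (prev⇔Next w e)
    formula-correct e r⊲ q b = ≡⇒⇔ (cong (On (λ (r , d) → (r , labelOf d) ≡ (q , b))) (out≡ e))
      ⇔∘ (≡⇒⇔ (FS.labelled₂≡ e q b) ⇔∘ FS.adjacent e q b outEvent (out⇔Msg e))
    formula-correct e r⊲⁻¹ q b = ≡⇒⇔ (cong (On (λ (r , d) → (r , labelOf d) ≡ (q , b))) (inn≡ e))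
      ⇔∘ (≡⇒⇔ (PS.labelled₂≡ e q b) ⇔∘ PS.adjacent e q b innEvent (inn⇔Msg e))
    formula-correct e r⊏ q b = future-far e q b ⇔∘ mk⇔
      (λ { (f , e<f , ≢₁ , ≢₂ , refl) → f , (e<f , ≢₁ ∘ from (next⇔Next w e f) , ≢₂ ∘ from (out⇔Msg e f)) , refl , refl })
      (λ { (f , (e<f , ≢₁ , ≢₂) , refl , refl) → f , e<f , ≢₁ ∘ to (next⇔Next w e f) , ≢₂ ∘ to (out⇔Msg e f) , refl })
    formula-correct e r⊏⁻¹ q b = past-far e q b ⇔∘ mk⇔
      (λ { (f , f<e , ≢₁ , ≢₂ , refl) → f , (f<e , ≢₁ ∘ from (prev⇔Next w e f) , ≢₂ ∘ from (inn⇔Msg e f)) , refl , refl })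
      (λ { (f , (f<e , ≢₁ , ≢₂) , refl , refl) → f , f<e , ≢₁ ∘ to (prev⇔Next w e f) , ≢₂ ∘ to (inn⇔Msg e f) , refl })
    formula-correct (p , i) r∥ q b = mk⇔
      (λ (_ , esc) → escapes⇒parallel {p , i} λ c c′ d d′ → Loop.escape⇒ c b c′ p (loops c c′ d d′) i (esc c c′ d d′))
      (λ par → parallel-process par , λ c c′ d d′ →
         Loop.⇒escape c b c′ p (loops c c′ d d′) i (parallel⇒escapes par c c′ d d′))
      where
      loops : ∀ c c′ → dests (gos {k = k} (hops c)) p ≡ q → dests (gos {k = k} (hops c′)) q ≡ p → dests (route c b c′) p ≡ p
      loops c c′ d d′ = trans (dests-++ (gos (hops c)) (back b ∷ gos (hops c′)) p)
        (trans (cong (dests (gos {k = k} (hops c′))) d) d′)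

-- Every MSC has a consistent labelling

module Existence {n k : ℕ} (N : MSC n (Fin k × Types n k)) where

  open Codes n k
  open Order N
  open Paths N proj₁
  open Verification N
  open Correctness N
  open Automaton #Code #Const Φ Φ? Ψ Ψ? using (prevLab; nextLab; withProcess; Labelling)
  open Equivalence

  _<ᴱ?_ : ∀ e f → Dec (e <ᴱ f)
  e <ᴱ? f = map′ strict (λ e<f → <⇒≤ᴱ e<f , λ { refl → acyclic _ e<f }) (e ≤ᴱ? f ×-dec ¬? (event≟ w e f))
    where
    strict : e ≤ᴱ f × e ≢ f → e <ᴱ f
    strict (e≤f , e≢f) with ≤⇒≡⊎< e≤f
    ... | inj₁ e≡f = contradiction e≡f e≢f
    ... | inj₂ e<f = e<f

  module _ {_⊰_ : Event w → Event w → Set} (_⊰?_ : ∀ f e → Dec (f ⊰ e)) where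

    once? : ∀ e x → Dec (∃ λ f → (f ≡ e ⊎ f ⊰ e) × labelᴱ f ≡ x)
    once? e x = anyEvent? w λ f → (event≟ w f e ⊎-dec f ⊰? e) ×-dec pair≟ (labelᴱ f) x

    twice? : ∀ e x → Dec (∃₂ λ f f′ → (f ≡ e ⊎ f ⊰ e) × (f′ ≡ e ⊎ f′ ⊰ e) × f ≢ f′ × labelᴱ f ≡ x × labelᴱ f′ ≡ x)
    twice? e x = anyEvent? w λ f → anyEvent? w λ f′ →
      (event≟ w f e ⊎-dec f ⊰? e) ×-dec (event≟ w f′ e ⊎-dec f′ ⊰? e) ×-dec
      ¬? (event≟ w f f′) ×-dec pair≟ (labelᴱ f) x ×-dec pair≟ (labelᴱ f′) x

  Sem : Fin 4 → Event w → Fin n × Fin k → Set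
  Sem zero = P.Once
  Sem (suc zero) = P.Twice
  Sem 2F = F′.Once
  Sem 3F = F′.Twice

  sem? : ∀ i e x → Dec (Sem i e x)
  sem? zero = once? _<ᴱ?_
  sem? (suc zero) = twice? _<ᴱ?_
  sem? 2F = once? (λ f e → e <ᴱ? f)
  sem? 3F = twice? (λ f e → e <ᴱ? f)

  toBit : ∀ {P : Set} → Dec P → Fin 2
  toBit (yes _) = suc zero
  toBit (no _) = zero

  toBit⇔ : ∀ {P : Set} (d : Dec P) → toBit d ≡ suc zero ⇔ P
  toBit⇔ (yes p) = mk⇔ (λ _ → p) (λ _ → refl)
  toBit⇔ (no ¬p) = mk⇔ (λ ()) (λ p → contradiction p ¬p)

  -- Blocks are formed on every process r, even where the route does not return to r: colours must
  -- advance by single steps everywhere, and a greedy division for any monotone `h` does so.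
  module Loop (c : Fin Q) (b : Fin k) (c′ : Fin Q) (r : Fin n) where

    h : ℕ → ℕ
    h = moves (route c b c′) r

    module Rise = Rising h (moves-mono (route c b c′) r)
    module Fall = Falling h (moves-mono (route c b c′) r)

    blk : Fin 2 → ℕ → ℕ
    blk zero = Rise.blk
    blk (suc zero) = Fall.blk

    blk-0 : ∀ φ → blk φ 0 ≡ 0
    blk-0 zero = Rise.blk-0
    blk-0 (suc zero) = Fall.blk-0

    blk-suc : ∀ φ x → blk φ (suc x) ≡ blk φ x ⊎ blk φ (suc x) ≡ suc (blk φ x)
    blk-suc zero = Rise.blk-suc
    blk-suc (suc zero) = Fall.blk-suc

    rising-colours : ∀ x → Near (blk zero x mod4) (blk zero (h x) mod4) ×
      (x < h x → Later (blk zero x mod4) (blk zero (h x) mod4))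
    rising-colours x with h x ≤? x
    ... | yes hx≤x = inj₁ (mod4-adv 0 (trans (Rise.blk-flat x hx≤x) (sym (+-identityʳ _)))) , λ x<hx → contradiction hx≤x (<⇒≱ x<hx)
    ... | no hx≰x = inj₂ later , λ _ → later
      where
      x<hx : x < h x
      x<hx = ≰⇒> hx≰x
      later : Later (blk zero x mod4) (blk zero (h x) mod4)
      later with m≤n⇒m<n∨m≡n (Rise.blk-rise x x<hx)
      ... | inj₂ e = inj₁ (mod4-adv 1 (trans (sym e) (+-comm 1 _)))
      ... | inj₁ lt = inj₂ (mod4-adv 2 (trans (≤-antisym (Rise.blk-rise-≤ x x<hx) lt) (+-comm 2 _)))

    falling-colours : ∀ x → Near (blk (suc zero) (h x) mod4) (blk (suc zero) (suc x) mod4) ×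
      (h x ≤ x → Later (blk (suc zero) (h x) mod4) (blk (suc zero) (suc x) mod4))
    falling-colours x with h x ≤? x
    ... | no hx≰x = inj₁ (mod4-adv 0 (trans (Fall.blk-flat x (≰⇒> hx≰x)) (sym (+-identityʳ _)))) , λ hx≤x → contradiction hx≤x hx≰x
    ... | yes hx≤x = inj₂ later , λ _ → later
      where
      later : Later (blk (suc zero) (h x) mod4) (blk (suc zero) (suc x) mod4)
      later = inj₁ (mod4-adv 1 (trans (Fall.blk-fall x hx≤x) (+-comm 1 _)))

  col : Fin Q → Fin k → Fin Q → Fin 2 → Fin n → ℕ → Colour
  col c b c′ φ r x = Loop.blk c b c′ r φ x mod4

  col-0 : ∀ c b c′ φ r → col c b c′ φ r 0 ≡ zero
  col-0 c b c′ φ r = cong _mod4 (Loop.blk-0 c b c′ r φ)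

  col-step : ∀ c b c′ φ r x → Step₁ (col c b c′ φ r x) (col c b c′ φ r (suc x))
  col-step c b c′ φ r x with Loop.blk-suc c b c′ r φ x
  ... | inj₁ e = inj₁ (mod4-adv 0 (trans e (sym (+-identityʳ _))))
  ... | inj₂ e = inj₂ (mod4-adv 1 (trans e (+-comm 1 _)))

  colours : Event w → Fin Q → Fin k → Fin Q → Fin 2 → Fin #Suffixes → Colour
  colours (p , i) c b c′ φ j = along (route c b c′) j (col c b c′ φ) p (suc (toℕ i))

  bits : Event w → Fin 4 → Fin n → Fin k → Fin 2
  bits e i q b = toBit (sem? i e (q , b))

  constants : Fin Q → Fin k → Fin Q → Fin 2 → Fin #Suffixes → Fin n → Colour
  constants c b c′ φ j r = along (route c b c′) j (col c b c′ φ) r (suc (ℓ r))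

  abstract
    lab : Event w → Code
    lab e = code (proj₁ (letter w e)) (bits e) (colours e)

    κ : Const
    κ = const constants

    label-ok : ∀ e → labelOf (lab e) ≡ proj₁ (letter w e)
    label-ok e = labelOf-code (proj₁ (letter w e)) (bits e) (colours e)

    bit-lab : ∀ e i q b → bit (lab e) i q b ≡ bits e i q b
    bit-lab e i q b = bit-code (proj₁ (letter w e)) (bits e) (colours e) i q b

    colours-lab : ∀ e c b c′ φ j → colour c b c′ φ j (lab e) ≡ colours e c b c′ φ j
    colours-lab e c b c′ φ j = colour-code (proj₁ (letter w e)) (bits e) (colours e) c b c′ φ j

    constants-κ : ∀ c b c′ φ j r → constant κ c b c′ φ j r ≡ constants c b c′ φ j r
    constants-κ c b c′ φ j r = constant-const constants c b c′ φ j r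

  open Values lab label-ok
  module PS = PastSets lab label-ok
  module FS = FutureSets lab label-ok

  holds⇔sem : ∀ i e q b → Holds i (lab e) q b ⇔ Sem i e (q , b)
  holds⇔sem i e q b = ≡⇒⇔ (cong (_≡ suc zero) (bit-lab e i q b))
    ⇔∘ toBit⇔ (sem? i e (q , b))

  sem⇔holds : ∀ i e q b → Sem i e (q , b) ⇔ Holds i (lab e) q b
  sem⇔holds i e q b = ⇔-flip (holds⇔sem i e q b)

  past-sets : ∀ e q b → SetsCode zero (suc zero) (proj₁ e) (lab e) (prevLab N lab e)
                          (Maybe.map (withProcess N lab) (innEvent e)) q b
  past-sets e q b =
    (holds⇔sem zero e q b ⇔∘ (P.once-step e (q , b) ⇔∘
      (P.onceStep-cong P.Once PS.Set₁ᴱ (λ g _ → sem⇔holds zero g q b) ⇔∘ ⇔-flip (≡⇒⇔ (PS.once≡ e q b))))) ,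
    (holds⇔sem (suc zero) e q b ⇔∘ (P.twice-step e (q , b) ⇔∘
      (P.twiceStep-cong P.Once PS.Set₁ᴱ P.Twice PS.Set₂ᴱ (λ g → sem⇔holds zero g q b) (λ g _ → sem⇔holds (suc zero) g q b)
        ⇔∘ ⇔-flip (≡⇒⇔ (PS.twice≡ e q b)))))

  future-sets : ∀ e q b → SetsCode 2F 3F (proj₁ e) (lab e) (nextLab N lab e)
                          (Maybe.map (withProcess N lab) (outEvent e)) q b
  future-sets e q b =
    (holds⇔sem 2F e q b ⇔∘ (F′.once-step e (q , b) ⇔∘
      (F′.onceStep-cong F′.Once FS.Set₁ᴱ (λ g _ → sem⇔holds 2F g q b) ⇔∘ ⇔-flip (≡⇒⇔ (FS.once≡ e q b))))) ,
    (holds⇔sem 3F e q b ⇔∘ (F′.twice-step e (q , b) ⇔∘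
      (F′.twiceStep-cong F′.Once FS.Set₁ᴱ F′.Twice FS.Set₂ᴱ (λ g → sem⇔holds 2F g q b) (λ g _ → sem⇔holds 3F g q b)
        ⇔∘ ⇔-flip (≡⇒⇔ (FS.twice≡ e q b)))))

  module _ (c : Fin Q) (b : Fin k) (c′ : Fin Q) (φ : Fin 2) where

    private
      V : Fin #Suffixes → Code → Colour
      V = colour c b c′ φ
      K : Fin #Suffixes → Fin n → Colour
      K = constant κ c b c′ φ

    colour-lab : ∀ j p i → V j (lab (p , i)) ≡ along (route c b c′) j (col c b c′ φ) p (suc (toℕ i))
    colour-lab j p i = colours-lab (p , i) c b c′ φ j

    val-along : ∀ j r x → x ≤ suc (ℓ r) → val (V j) (K j) r x ≡ along (route c b c′) j (col c b c′ φ) r x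
    val-along j r x x≤ with view (ℓ r) x
    ... | bot = sym (along-0 (route c b c′) j (col c b c′ φ) r (col-0 c b c′ φ))
    ... | ev i = trans (val-event (V j) (K j) r i) (colour-lab j r i)
    ... | top ℓ<x = trans (val-top (V j) (K j) r ℓ<x) (trans (constants-κ c b c′ φ j r)
        (cong (along (route c b c′) j (col c b c′ φ) r) (≤-antisym ℓ<x x≤)))

    equations : LocalEqs (route c b c′) V K × LastEqs (route c b c′) V K
    equations = equations-along lab label-ok (route c b c′) V K (col c b c′ φ) val-along

    val-own : ∀ r x → x ≤ suc (ℓ r) → val (own c b c′ φ) (K end-index) r x ≡ col c b c′ φ r x
    val-own r x x≤ = trans (val-along end-index r x x≤) (along-end (route c b c′) (col c b c′ φ) r x)

    own-lab : ∀ p i → own c b c′ φ (lab (p , i)) ≡ col c b c′ φ p (suc (toℕ i))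
    own-lab p i = trans (colour-lab end-index p i) (along-end (route c b c′) (col c b c′ φ) p (suc (toℕ i)))

    before : ∀ p x → x ≤ ℓ p → Maybe.maybe′ (own c b c′ φ) zero (Maybe.map lab (at w p x)) ≡ col c b c′ φ p x
    before p x x≤ = trans (val-before (own c b c′ φ) (K end-index) p x x≤) (val-own p x (m≤n⇒m≤1+n x≤))

    colour-step : ∀ p i → ColourStep c b c′ φ (prevLab N lab (p , i)) (own c b c′ φ (lab (p , i)))
    colour-step p i = subst₂ Step₁ (sym (before p (toℕ i) (<⇒≤ (toℕ<n i)))) (sym (own-lab p i)) (col-step c b c′ φ p (toℕ i))

    last-step : ∀ p → ColourStep c b c′ φ (Maybe.map lab (at w p (ℓ p))) (K end-index p)
    last-step p = subst₂ Step₁ (sym (before p (ℓ p) ≤-refl))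
      (trans (sym (val-own p (suc (ℓ p)) ≤-refl)) (val-top (own c b c′ φ) (K end-index) p ≤-refl))
      (col-step c b c′ φ p (ℓ p))

    seen-lab : ∀ p i → dests (route c b c′) p ≡ p →
      seen c b c′ φ (lab (p , i)) ≡ col c b c′ φ p (moves (route c b c′) p (suc (toℕ i)))
    seen-lab p i loops = trans (colour-lab zero p i)
      (cong (λ r → col c b c′ φ r (moves (route c b c′) p (suc (toℕ i)))) loops)

  loopColours : ∀ c b c′ p i → dests (route c b c′) p ≡ p → LoopColours κ c b c′ p (lab (p , i)) (nextLab N lab (p , i))
  loopColours c b c′ p i loops =
    subst₂ Near (sym own₀) (sym seen₀) (proj₁ rise) , subst₂ Near (sym seen₁) (sym next₁) (proj₁ fall) , later
    where
    open Loop c b c′ p using (h; rising-colours; falling-colours)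
    x : ℕ
    x = suc (toℕ i)
    rise = rising-colours x
    fall = falling-colours x
    own₀ = own-lab c b c′ zero p i
    seen₀ = seen-lab c b c′ zero p i loops
    seen₁ = seen-lab c b c′ (suc zero) p i loops
    next₁ : nextOwn κ c b c′ p (lab (p , i)) (nextLab N lab (p , i)) ≡ col c b c′ (suc zero) p (suc x)
    next₁ = val-own c b c′ (suc zero) p (suc x) (s≤s (toℕ<n i))
    later : Escape c b c′ (lab (p , i)) ⊎ Later (seen c b c′ (suc zero) (lab (p , i))) (nextOwn κ c b c′ p (lab (p , i)) (nextLab N lab (p , i)))
    later with h x ≤? x
    ... | yes hx≤x = inj₂ (subst₂ Later (sym seen₁) (sym next₁) (proj₂ fall hx≤x))
    ... | no hx≰x = inj₁ (subst₂ Later (sym own₀) (sym seen₀) (proj₂ rise (≰⇒> hx≰x)))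

  consistent : ∀ e → Consistent κ (proj₁ e) (proj₁ (letter w e)) (prevLab N lab e) (lab e) (nextLab N lab e) (partnerLab e)
  consistent e@(p , i) = record
    { label-ok = label-ok e
    ; past = λ q b → subst (λ m → SetsCode zero (suc zero) p (lab e) (prevLab N lab e) m q b)
        (sym (innOf-map (withProcess N lab) (partner N e))) (past-sets e q b)
    ; future = λ q b → subst (λ m → SetsCode 2F 3F p (lab e) (nextLab N lab e) m q b)
        (sym (outOf-map (withProcess N lab) (partner N e))) (future-sets e q b)
    ; local-eq = λ c b c′ φ → proj₁ (equations c b c′ φ) e
    ; colour-step = λ c b c′ φ → colour-step c b c′ φ p i
    ; loop = λ c b c′ → loopColours c b c′ p i
    }

  final : ∀ p → Ψ κ p (Maybe.map lab (at w p (ℓ p)))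
  final p c b c′ φ = proj₂ (equations c b c′ φ) p , last-step c b c′ φ p

-- The number of states

n≤2^⌈log₂n⌉ : ∀ n → n ≤ 2 ^ ⌈log₂ n ⌉
n≤2^⌈log₂n⌉ n = halve n (<-wellFounded n)
  where
  open ≤-Reasoning
  halve : ∀ n → WF.Acc _<_ n → n ≤ 2 ^ ⌈log₂ n ⌉
  halve zero _ = z≤n
  halve (suc zero) _ = m^n>0 2 ⌈log₂ 1 ⌉
  halve n@(suc (suc m)) (acc rec) = begin
    n                            ≡⟨ sym (⌊n/2⌋+⌈n/2⌉≡n n) ⟩
    ⌊ n /2⌋ + ⌈ n /2⌉            ≤⟨ +-monoˡ-≤ ⌈ n /2⌉ (⌊n/2⌋≤⌈n/2⌉ n) ⟩
    ⌈ n /2⌉ + ⌈ n /2⌉            ≡⟨ cong (⌈ n /2⌉ +_) (sym (+-identityʳ _)) ⟩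
    2 * ⌈ n /2⌉                  ≤⟨ *-monoʳ-≤ 2 (halve ⌈ n /2⌉ (rec (⌈n/2⌉<n m))) ⟩
    2 * 2 ^ ⌈log₂ ⌈ n /2⌉ ⌉      ≡⟨ cong (λ l → 2 ^ suc l) (⌈log₂⌈n/2⌉⌉≡⌈log₂n⌉∸1 n) ⟩
    2 ^ (1 + (⌈log₂ n ⌉ ∸ 1))    ≡⟨ cong (2 ^_) (m+[n∸m]≡n 1≤log) ⟩
    2 ^ ⌈log₂ n ⌉                ∎
    where
    1≤log : 1 ≤ ⌈log₂ n ⌉
    1≤log = subst (_≤ ⌈log₂ n ⌉) (⌈log₂2^n⌉≡n 1) (⌈log₂⌉-mono-≤ {2} {n} (s≤s (s≤s z≤n)))

k≤2^k : ∀ k → k ≤ 2 ^ k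
k≤2^k zero = z≤n
k≤2^k (suc k) = +-mono-≤ (m^n>0 2 k) (≤-trans (k≤2^k k) (≤-reflexive (sym (+-identityʳ _))))

suc-≤-2^suc : ∀ {a} e → a ≤ 2 ^ e → suc a ≤ 2 ^ suc e
suc-≤-2^suc e a≤ = +-mono-≤ (m^n>0 2 e) (≤-trans a≤ (≤-reflexive (sym (+-identityʳ _))))

*-≤-2^+ : ∀ {a b} e f → a ≤ 2 ^ e → b ≤ 2 ^ f → a * b ≤ 2 ^ (e + f)
*-≤-2^+ e f a≤ b≤ = ≤-trans (*-mono-≤ a≤ b≤) (≤-reflexive (sym (^-distribˡ-+-* 2 e f)))

module Size (n k : ℕ) (1≤k : 1 ≤ k) where
  open Codes n k
  open Automaton #Code #Const Φ Φ? Ψ Ψ? using (#State)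

  -- `z` bounds both n and n ^ n. Hence `D`, which counts suffixes, flags and pairs of hop
  -- sequences, is of order z³ and n * D of order z⁴, which is `W`.
  log z W D : ℕ
  log = ⌈log₂ n ⌉
  z = 2 ^ (n * log)
  W = z * z * z * z
  D = #Suffixes * 2 * Q * Q

  #Table-power : ∀ u → #Table (2 ^ u) ≡ 2 ^ (u * #Suffixes * 2 * Q * k * Q)
  #Table-power u =
    trans (cong (λ a → (((a ^ 2) ^ Q) ^ k) ^ Q) (^-*-assoc 2 u #Suffixes))
    (trans (cong (λ a → ((a ^ Q) ^ k) ^ Q) (^-*-assoc 2 (u * #Suffixes) 2))
    (trans (cong (λ a → (a ^ k) ^ Q) (^-*-assoc 2 (u * #Suffixes * 2) Q))
    (trans (cong (_^ Q) (^-*-assoc 2 (u * #Suffixes * 2 * Q) k)) (^-*-assoc 2 (u * #Suffixes * 2 * Q * k) Q))))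

  -- Binary logarithms of the bounds on codes and constants. A colour takes 2 bits, a tuple of
  -- colours for all processes 2 * n.
  X Y : ℕ
  X = k + (k * n * 4 + 2 * #Suffixes * 2 * Q * k * Q)
  Y = (2 * n) * #Suffixes * 2 * Q * k * Q

  #Code-≤ : #Code ≤ 2 ^ X
  #Code-≤ = *-≤-2^+ k _ (k≤2^k k) (*-≤-2^+ (k * n * 4) _
    (≤-reflexive (trans (cong (_^ 4) (^-*-assoc 2 k n)) (^-*-assoc 2 (k * n) 4))) (≤-reflexive (#Table-power 2)))

  #Const-≤ : #Const ≤ 2 ^ Y
  #Const-≤ = ≤-reflexive (trans (cong #Table (^-*-assoc 2 2 n)) (#Table-power (2 * n)))

  #State-≤ : #State ≤ 2 ^ suc (Y + (X + suc X))
  #State-≤ = suc-≤-2^suc (Y + (X + suc X)) (*-≤-2^+ Y (X + suc X) #Const-≤ (*-≤-2^+ X (suc X) #Code-≤ (suc-≤-2^suc X #Code-≤)))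

  1≤z : 1 ≤ z
  1≤z = m^n>0 2 (n * log)

  n≤z : n ≤ z
  n≤z = positive n (n≤2^⌈log₂n⌉ n)
    where
    positive : ∀ m → m ≤ 2 ^ log → m ≤ 2 ^ (m * log)
    positive zero _ = z≤n
    positive m@(suc _) m≤ = ≤-trans m≤ (^-monoʳ-≤ 2 (m≤n*m log m))

  Q≤z : Q ≤ z
  Q≤z = ≤-trans (^-monoˡ-≤ n (n≤2^⌈log₂n⌉ n))
    (≤-reflexive (trans (^-*-assoc 2 log n) (cong (2 ^_) (*-comm log n))))

  z≤W : z ≤ W
  z≤W = m≤n*m z (z * z * z) {{>-nonZero (*-mono-≤ (*-mono-≤ 1≤z 1≤z) 1≤z)}}

  1≤W : 1 ≤ W
  1≤W = ≤-trans 1≤z z≤W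

  #Suffixes-≤ : #Suffixes ≤ 4 * z
  #Suffixes-≤ = begin
    suc (n + suc n)      ≤⟨ s≤s (+-mono-≤ n≤z (s≤s n≤z)) ⟩
    suc (z + suc z)      ≡⟨ solve 1 (λ z → con 1 :+ (z :+ (con 1 :+ z)) := con 2 :+ con 2 :* z) refl z ⟩
    2 + 2 * z            ≤⟨ +-monoˡ-≤ (2 * z) (*-monoʳ-≤ 2 1≤z) ⟩
    2 * z + 2 * z        ≡⟨ solve 1 (λ z → con 2 :* z :+ con 2 :* z := con 4 :* z) refl z ⟩
    4 * z                ∎
    where
    open ≤-Reasoning
    open +-*-Solver

  D≤ : D ≤ 8 * (z * z * z)
  D≤ = ≤-trans (*-mono-≤ (*-mono-≤ (*-monoˡ-≤ 2 #Suffixes-≤) Q≤z) Q≤z)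
    (≤-reflexive (solve 1 (λ z → con 4 :* z :* con 2 :* z :* z := con 8 :* (z :* z :* z)) refl z))
    where open +-*-Solver

  -- The terms add up to 60 * W, which is rounded up to 64 * W, that is, 6 plus four times n * log
  -- in the exponent. The factor 6 covers both numbers.
  exponent-≤ : suc (Y + (X + suc X)) ≤ k * 2 ^ (6 * (n * log + 1))
  exponent-≤ = begin
    suc (Y + (X + suc X))
      ≡⟨ solve 4 (λ n k s q →
           con 1 :+ ((con 2 :* n) :* s :* con 2 :* q :* k :* q :+
             ((k :+ (k :* n :* con 4 :+ con 2 :* s :* con 2 :* q :* k :* q)) :+
              (con 1 :+ (k :+ (k :* n :* con 4 :+ con 2 :* s :* con 2 :* q :* k :* q))))) :=
           con 2 :+ k :* (con 2 :* (n :* (s :* con 2 :* q :* q)) :+ (con 2 :+ con 8 :* n :+ con 4 :* (s :* con 2 :* q :* q))))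
           refl n k #Suffixes Q ⟩
    2 + k * (2 * (n * D) + (2 + 8 * n + 4 * D))
      -- The bound is a multiple of k, so the additive 2 is absorbed by means of k ≥ 1.
      ≤⟨ +-monoˡ-≤ _ (*-monoˡ-≤ 2 1≤k) ⟩
    k * 2 + k * (2 * (n * D) + (2 + 8 * n + 4 * D))
      ≡⟨ sym (*-distribˡ-+ k 2 _) ⟩
    k * (2 + (2 * (n * D) + (2 + 8 * n + 4 * D)))
      ≤⟨ *-monoʳ-≤ k (+-mono-≤ (*-monoʳ-≤ 2 1≤W) (+-mono-≤ (*-monoʳ-≤ 2 nD≤)
           (+-mono-≤ (+-mono-≤ (*-monoʳ-≤ 2 1≤W) (*-monoʳ-≤ 8 (≤-trans n≤z z≤W))) (*-monoʳ-≤ 4 D≤W)))) ⟩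
    k * (2 * W + (2 * (8 * W) + (2 * W + 8 * W + 4 * (8 * W))))
      ≡⟨ cong (k *_) (solve 1 (λ W → con 2 :* W :+ (con 2 :* (con 8 :* W) :+ (con 2 :* W :+ con 8 :* W :+ con 4 :* (con 8 :* W)))
           := con 60 :* W) refl W) ⟩
    k * (60 * W)
      ≤⟨ *-monoʳ-≤ k (*-monoˡ-≤ W (m≤m+n 60 4)) ⟩
    k * (64 * W)
      ≡⟨ cong (k *_) power ⟩
    k * 2 ^ (6 + n * log * 4)
      ≤⟨ *-monoʳ-≤ k (^-monoʳ-≤ 2 6+≤) ⟩
    k * 2 ^ (6 * (n * log + 1))
      ∎
    where
    open ≤-Reasoning
    open +-*-Solver
    nD≤ : n * D ≤ 8 * W
    nD≤ = ≤-trans (*-mono-≤ n≤z D≤)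
      (≤-reflexive (solve 1 (λ z → z :* (con 8 :* (z :* z :* z)) := con 8 :* (z :* z :* z :* z)) refl z))
    D≤W : D ≤ 8 * W
    D≤W = ≤-trans D≤ (*-monoʳ-≤ 8 (m≤m*n (z * z * z) z {{>-nonZero 1≤z}}))
    power : 64 * W ≡ 2 ^ (6 + n * log * 4)
    power = trans (cong (64 *_) (trans
        (solve 1 (λ z → z :* z :* z :* z := z :* (z :* (z :* (z :* con 1)))) refl z)
        (^-*-assoc 2 (n * log) 4)))
      (sym (^-distribˡ-+-* 2 6 (n * log * 4)))
    6+≤ : 6 + n * log * 4 ≤ 6 * (n * log + 1)
    6+≤ = ≤-trans (+-monoʳ-≤ 6 (*-monoʳ-≤ (n * log) (m≤m+n 4 2)))
      (≤-reflexive (solve 1 (λ x → con 6 :+ x :* con 6 := con 6 :* (x :+ con 1)) refl (n * log)))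

  size-≤ : #State ≤ stateBound 6 n k
  size-≤ = ≤-trans #State-≤ (^-monoʳ-≤ 2 exponent-≤)

-- The empty alphabet and the assembly of the CFM

emptyAlphabet : ∀ {n B} → ¬ MSC n (Fin 0 × B)
emptyAlphabet N with IsMSC.someNonempty (isMSC N)
... | p , 0<ℓ with letter (word N) (p , F.fromℕ< 0<ℓ)
...   | () , _

-- Over the empty alphabet the bound is 2 ^ 0, a single state. That suffices, because an MSC has an
-- event and hence a letter.
trivial : ∀ {n A} → CFM n A
trivial = record { nMsg = 0 ; size = λ _ → 1 ; init = λ _ → zero ; Δ = λ _ _ _ _ → false ; Acc = λ _ → false }

theorem13 : Σ ℕ λ c → (n k : ℕ) →
    Σ (CFM n (Fin k × Types n k)) λ 𝒜 →
    ((p : Fin n) → size 𝒜 p ≤ stateBound c n k) ×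
    ((N : MSC n (Fin k × Types n k)) → Accepts 𝒜 N ⇔ IsTypeAnnotated N)
theorem13 = 6 , construct
  where
  construct : (n k : ℕ) → Σ (CFM n (Fin k × Types n k)) λ 𝒜 →
    ((p : Fin n) → size 𝒜 p ≤ stateBound 6 n k) ×
    ((N : MSC n (Fin k × Types n k)) → Accepts 𝒜 N ⇔ IsTypeAnnotated N)
  construct n zero = trivial , (λ _ → ≤-refl) , λ N → contradiction N emptyAlphabet
  construct n k@(suc _) = automaton , (λ _ → Size.size-≤ n k (s≤s z≤n)) , λ N → accepts⇔labelling N ⇔∘ mk⇔
    (λ (κ , lab , l) → let open Labelling l in
      λ e r p a → proj₂ (local e) r p a ⇔∘ Correctness.Sound.formula-correct N κ lab (proj₁ ∘ local) final e r p a)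
    -- The labelling is consistent whatever the annotation; correctness applied to it turns the true
    -- types into the formulas that `Φ` asks for.
    (λ annotated → let open Existence N in
      κ , lab , record
        { local = λ e → consistent e , λ r p a → annotated e r p a ⇔∘
            ⇔-flip (Correctness.Sound.formula-correct N κ lab consistent final e r p a)
        ; final = final })
    where
    open Codes n k
    open Automaton #Code #Const Φ Φ? Ψ Ψ?
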